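{- For every $\varepsilon>0$ there exist $c>0$ and $\delta_0$ such that the following holds. Let $G$ be a graph with minimum degree $\delta\ge\delta_0$ and maximum degree $\Delta\le e^{c\delta}$, and let $F:V(G)\to 2^{\mathbb N}$. If $|F(v)|\le(\sqrt2-1-\varepsilon)\deg_G(v)$ for each $v\in V(G)$, then $G$ has an $F$-avoiding orientation. (Informally: if $\Delta=e^{o(\delta)}$ and $|F(v)|\le(\sqrt2-1-o(1))\deg_G(v)$ for all $v$, where $o(1)\to0$ as $\delta\to\infty$ at a rate depending on how fast $\delta$ dominates $\log\Delta$, then $G$ has an $F$-avoiding orientation.)
   Context: Given $F:V(G)\to 2^{\mathbb N}$, an orientation $D$ of $G$ is $F$-avoiding if the out-degree $\deg^+_D(v)\notin F(v)$ for every $v\in V(G)$. -}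

module Defs where

open import Data.Nat using (ℕ; zero; suc; _+_; _*_)
open import Data.Fin using (Fin; zero; suc)
open import Data.Bool using (Bool; true; false; if_then_else_; _xor_)
open import Relation.Binary.PropositionalEquality using (_≡_)

count : ∀ {n} → (Fin n → Bool) → ℕ
count {zero}  p = 0
count {suc n} p = (if p zero then 1 else 0) + count (λ i → p (suc i))

record Graph (n : ℕ) : Set where
  field
    adj    : Fin n → Fin n → Bool
    sym    : ∀ u v → adj u v ≡ adj v u
    irrefl : ∀ v → adj v v ≡ false
open Graph public

deg : ∀ {n} → Graph n → Fin n → ℕ
deg G v = count (adj G v)

record Orientation {n : ℕ} (G : Graph n) : Set where
  field
    arc      : Fin n → Fin n → Bool
    arc⊆adj  : ∀ u v → arc u v ≡ true → adj G u v ≡ true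
    oriented : ∀ u v → adj G u v ≡ true → (arc u v xor arc v u) ≡ true
open Orientation public

outdeg : ∀ {n} {G : Graph n} → Orientation G → Fin n → ℕ
outdeg D v = count (arc D v)

{-# OPTIONS --safe #-}
module Submission where

-- A small random reservoir S = A ∪ B is set aside. Outside S, an orientation is obtained from the Combinatorial
-- Nullstellensatz applied to sums of two orientations: the relevant coefficient, that of ∏ z_v ^ deg v in
-- ∏ (z_u - z_v)², is up to sign a sum of squares, hence nonzero. Half of such a sum is rounded by orienting the
-- edges on which the two orientations disagree in a balanced way, and the rounding error at a vertex v is
-- corrected with a single edge to S. The other edges from v to S are grouped into paths a - v - b with a ∈ A and
-- b ∈ B; reversing a path does not affect v, so the paths act as the edges of a bipartite graph on S, in which
-- every vertex repairs itself by reversing paths it owns. The local lemma supplies the reservoir. The argument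
-- works up to |F(v)| ≤ (5/12) deg(v), and 5/12 > √2 - 1.

open import Defs hiding (sym)
import Data.Nat.Base as ℕ
open import Data.Nat.Base using (ℕ; zero; suc; pred; _≡ᵇ_; _≤_; _<_; s≤s; z≤n; NonZero)
import Data.Nat.Properties as ℕₚ
import Data.Bool.Base as Bool
open import Data.Bool.Base using (Bool; true; false; if_then_else_; not; _∧_; _∨_; _xor_)
import Data.Bool.Properties as Boolₚ
import Data.Fin.Base as Fin
open import Data.Fin.Base using (Fin; zero; suc; toℕ; remQuot; _↑ˡ_; _↑ʳ_)
import Data.Fin.Properties as Finₚ
import Data.Vec.Base as Vec
open import Data.Vec.Base using (Vec; []; _∷_; lookup; replicate; zipWith; _[_]%=_; _[_]≔_)
import Data.Vec.Properties as Vecₚ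
open import Data.Vec.Functional using (updateAt)
import Data.Vec.Functional.Properties as VFₚ
import Data.List.Base as List
open import Data.List.Base using (List; []; _∷_; _++_; map; length; filter; deduplicate; cartesianProduct; allFin)
import Data.List.Properties as Listₚ
open import Data.List.Relation.Unary.All as All using (All; []; _∷_)
import Data.List.Relation.Unary.All.Properties as Allₚ
open import Data.List.Relation.Unary.Any using (Any; here; there; any?)
open import Data.List.Relation.Unary.AllPairs using ([]; _∷_)
open import Data.List.Relation.Unary.Unique.Propositional using (Unique)
import Data.List.Relation.Unary.Unique.Propositional.Properties as Uniqₚ
import Data.List.Relation.Unary.Unique.DecPropositional.Properties as Uniqueₚ
open import Data.List.Relation.Binary.Pointwise.Base using (Pointwise; []; _∷_)
open import Data.List.Relation.Binary.Permutation.Propositional as ↭ using (_↭_; refl; prep; swap)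
open import Data.List.Relation.Binary.Permutation.Propositional.Properties using (↭-length)
open import Data.List.Membership.Propositional using (_∈_; _∉_)
import Data.List.Membership.Propositional.Properties as ∈ₚ
open import Data.List.Membership.DecPropositional ℕₚ._≟_ using (_∈?_)
open import Data.Product.Base using (_×_; _,_; proj₁; proj₂; ∃; Σ; map₂)
import Data.Product.Properties as Prodₚ
open import Data.Sum.Base using (_⊎_; inj₁; inj₂)
open import Data.Unit.Base using (tt)
open import Function.Base using (_∘_; const; id; case_of_)
open import Relation.Nullary using (¬_; Dec; yes; no; does; contradiction; _×-dec_; _⊎-dec_)
open import Relation.Nullary.Decidable using (dec-true; dec-false; toWitness)
open import Relation.Binary.Definitions using (Tri; tri<; tri≈; tri>)
open import Relation.Binary.PropositionalEquality using (_≡_; _≢_; refl; sym; trans; cong; cong₂; subst; subst₂; module ≡-Reasoning)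
open import Algebra.Properties.Semiring.Sum ℕₚ.+-*-semiring
  using (sum; sum-cong-≗; ∑-distrib-+; ∑-comm; sum-replicate-zero; *-distribˡ-sum; *-distribʳ-sum)

-- Every vertex loses a factor of two for a reason of its own, so the natural limit of the argument
-- is 1/2. Outside S, the doubled edge product has degree 2|E|, which permits deg v excluded values
-- of the sum of two orientations at v; but rounding makes one forbidden out-degree exclude two
-- values of that sum. Inside S, a path a - v - b has two ends and one owner, so a vertex of S owns
-- about half of its paths. The obstacle in S is that the two ends share a path, and repairs could
-- undo one another. Counting out-degrees on A and in-degrees on B turns every reversal into an
-- increase at both ends, so repairs only move forward. Another obstacle is that v may see A and B
-- unequally often. Every vertex carries a random group out of 12, and the edges from v to the
-- members of S in its own group are optional, which leaves room to equalise; the random criterion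
-- spreads the discarded edges fairly over S. With 1/12 of the vertices in S, a vertex of S keeps a
-- share of about (1/2)(11/12)(11/12) = 121/288, just above 5/12 = 120/288.

private variable
  n L : ℕ

-- Sums of two orientations

module Signed where

  open import Data.Integer.Base as ℤ using (ℤ; +_; -_; _+_; _-_; _*_; 0ℤ; 1ℤ; ∣_∣)
  import Data.Integer.Properties as ℤₚ
  open import Data.Integer.Tactic.RingSolver using (solve-∀)
  open ≡-Reasoning

  Edges : ℕ → Set
  Edges n = List (Fin n × Fin n)

  inc : Fin n → Vec ℕ n → Vec ℕ n
  inc u k = k [ u ]%= suc

  infixl 6 _⊕_
  _⊕_ : Vec ℕ n → Vec ℕ n → Vec ℕ n
  _⊕_ = zipWith ℕ._+_

  inc-⊕ : ∀ (u : Fin n) k l → inc u k ⊕ l ≡ inc u (k ⊕ l)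
  inc-⊕ zero    (x ∷ k) (y ∷ l) = refl
  inc-⊕ (suc u) (x ∷ k) (y ∷ l) = cong (x ℕ.+ y ∷_) (inc-⊕ u k l)

  ⊕-inc : ∀ (u : Fin n) k l → k ⊕ inc u l ≡ inc u (k ⊕ l)
  ⊕-inc zero    (x ∷ k) (y ∷ l) = cong (_∷ k ⊕ l) (ℕₚ.+-suc x y)
  ⊕-inc (suc u) (x ∷ k) (y ∷ l) = cong (x ℕ.+ y ∷_) (⊕-inc u k l)

  0⃗ : Vec ℕ n
  0⃗ = replicate _ 0

  0⃗-⊕ : (k : Vec ℕ n) → 0⃗ ⊕ k ≡ k
  0⃗-⊕ []      = refl
  0⃗-⊕ (x ∷ k) = cong (x ∷_) (0⃗-⊕ k)

  -- Σ over all orientations of es, signed by the number of reversed edges, of φ at the out-degree vector.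
  alt : Edges n → (Vec ℕ n → ℤ) → ℤ
  alt []             φ = φ 0⃗
  alt ((u , v) ∷ es) φ = alt es (φ ∘ inc u) - alt es (φ ∘ inc v)

  alt-cong : ∀ (es : Edges n) {φ ψ} → (∀ k → φ k ≡ ψ k) → alt es φ ≡ alt es ψ
  alt-cong []             eq = eq _
  alt-cong ((u , v) ∷ es) eq = cong₂ _-_ (alt-cong es (λ k → eq _)) (alt-cong es (λ k → eq _))

  alt-+ : ∀ (es : Edges n) φ ψ → alt es (λ k → φ k + ψ k) ≡ alt es φ + alt es ψ
  alt-+ []             φ ψ = refl
  alt-+ ((u , v) ∷ es) φ ψ = trans (cong₂ _-_ (alt-+ es _ _) (alt-+ es _ _)) (lemma (alt es (φ ∘ inc u)) _ _ _)
    where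
    lemma : ∀ a b c d → (a + b) - (c + d) ≡ (a - c) + (b - d)
    lemma = solve-∀

  alt-*ˡ : ∀ (es : Edges n) c φ → alt es (λ k → c * φ k) ≡ c * alt es φ
  alt-*ˡ []             c φ = refl
  alt-*ˡ ((u , v) ∷ es) c φ = trans (cong₂ _-_ (alt-*ˡ es c _) (alt-*ˡ es c _)) (lemma c (alt es (φ ∘ inc u)) _)
    where
    lemma : ∀ c a b → c * a - c * b ≡ c * (a - b)
    lemma = solve-∀

  alt-0 : ∀ (es : Edges n) → alt es (const 0ℤ) ≡ 0ℤ
  alt-0 []             = refl
  alt-0 ((u , v) ∷ es) = cong₂ _-_ (alt-0 es) (alt-0 es)

  alt-++ : ∀ (xs ys : Edges n) φ → alt (xs ++ ys) φ ≡ alt xs (λ k → alt ys (λ l → φ (k ⊕ l)))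
  alt-++ []             ys φ = alt-cong ys (λ l → cong φ (sym (0⃗-⊕ l)))
  alt-++ ((u , v) ∷ xs) ys φ = cong₂ _-_ (step u) (step v)
    where
    step : ∀ w → alt (xs ++ ys) (φ ∘ inc w) ≡ alt xs (λ k → alt ys (λ l → φ (inc w k ⊕ l)))
    step w = trans (alt-++ xs ys _) (alt-cong xs (λ k → alt-cong ys (λ l → cong φ (sym (inc-⊕ w k l)))))

  ⟦_⟧ : (Fin n → ℕ → ℤ) → Vec ℕ n → ℤ
  ⟦ g ⟧ []       = 1ℤ
  ⟦ g ⟧ (k ∷ ks) = g zero k * ⟦ g ∘ suc ⟧ ks

  ⟦⟧-zero : ∀ (g : Fin n → ℕ → ℤ) u ks → g u (lookup ks u) ≡ 0ℤ → ⟦ g ⟧ ks ≡ 0ℤ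
  ⟦⟧-zero g zero    (k ∷ ks) eq = trans (cong (_* ⟦ g ∘ suc ⟧ ks) eq) (ℤₚ.*-zeroˡ (⟦ g ∘ suc ⟧ ks))
  ⟦⟧-zero g (suc u) (k ∷ ks) eq = trans (cong (g zero k *_) (⟦⟧-zero (g ∘ suc) u ks eq)) (ℤₚ.*-zeroʳ (g zero k))

  ∂ : (ℕ → ℤ) → ℕ → ℤ
  ∂ h k = h (suc k) - h k

  ⟦⟧-inc : ∀ (g : Fin n → ℕ → ℤ) u k → ⟦ g ⟧ (inc u k) ≡ ⟦ g ⟧ k + ⟦ updateAt g u ∂ ⟧ k
  ⟦⟧-inc g zero    (k ∷ ks) = lemma (g zero (suc k)) (g zero k) (⟦ g ∘ suc ⟧ ks)
    where
    lemma : ∀ a b c → a * c ≡ b * c + (a - b) * c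
    lemma = solve-∀
  ⟦⟧-inc g (suc u) (k ∷ ks) = trans (cong (g zero k *_) (⟦⟧-inc (g ∘ suc) u ks)) (ℤₚ.*-distribˡ-+ (g zero k) _ _)

  -- A polynomial of degree at most `d` is recorded through its constant `d`-th forward difference
  -- `c`, which is d! times its coefficient of degree `d`; this keeps everything integral.
  HasDegree : ℕ → ℤ → (ℕ → ℤ) → Set
  HasDegree zero    c h = ∀ k → h k ≡ c
  HasDegree (suc d) c h = HasDegree d c (∂ h)

  δ : ℕ → ℕ → ℤ
  δ d k = if d ≡ᵇ k then 1ℤ else 0ℤ

  ∏ : (Fin n → ℤ) → ℤ
  ∏ {zero}  c = 1ℤ
  ∏ {suc n} c = c zero * ∏ (c ∘ suc)

  ∏≢0 : (c : Fin n → ℤ) → (∀ v → c v ≢ 0ℤ) → ∏ c ≢ 0ℤ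
  ∏≢0 {zero}  c nz ()
  ∏≢0 {suc n} c nz eq with ℤₚ.i*j≡0⇒i≡0∨j≡0 (c zero) eq
  ... | inj₁ e = nz zero e
  ... | inj₂ e = ∏≢0 (c ∘ suc) (nz ∘ suc) e

  ⟦⟧-constant : ∀ (d : Fin n → ℕ) (c : Fin n → ℤ) g → sum d ≡ 0 → (∀ v → HasDegree (d v) (c v) (g v)) →
                ⟦ g ⟧ 0⃗ ≡ ⟦ δ ∘ d ⟧ 0⃗ * ∏ c
  ⟦⟧-constant {zero}  d c g eq hd = refl
  ⟦⟧-constant {suc n} d c g eq hd with d zero | hd zero | ℕₚ.m+n≡0⇒m≡0 (d zero) eq | ℕₚ.m+n≡0⇒n≡0 (d zero) eq
  ... | zero | h | refl | eq′ =
    trans (cong₂ _*_ (h 0) (⟦⟧-constant (d ∘ suc) (c ∘ suc) (g ∘ suc) eq′ (hd ∘ suc)))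
          (lemma (c zero) (⟦ δ ∘ d ∘ suc ⟧ 0⃗) (∏ (c ∘ suc)))
    where
    lemma : ∀ a b c → a * (b * c) ≡ (1ℤ * b) * (a * c)
    lemma = solve-∀

  sum-pred : ∀ (d : Fin n → ℕ) u {x} → d u ≡ suc x → suc (sum (updateAt d u pred)) ≡ sum d
  sum-pred {suc n} d zero    eq rewrite eq = refl
  sum-pred {suc n} d (suc u) eq = trans (sym (ℕₚ.+-suc (d zero) _)) (cong (d zero ℕ.+_) (sum-pred (d ∘ suc) u eq))

  ⟦δ⟧-inc : ∀ (d : Fin n → ℕ) u {x} → d u ≡ suc x → ∀ k → ⟦ δ ∘ d ⟧ (inc u k) ≡ ⟦ δ ∘ updateAt d u pred ⟧ k
  ⟦δ⟧-inc d zero    eq (k ∷ ks) rewrite eq = refl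
  ⟦δ⟧-inc d (suc u) eq (k ∷ ks) = cong (δ (d zero) k *_) (⟦δ⟧-inc (d ∘ suc) u eq ks)

  ∂-HasDegree : ∀ (d : Fin n → ℕ) (c : Fin n → ℤ) g u {x} → d u ≡ suc x → (∀ v → HasDegree (d v) (c v) (g v)) →
                ∀ v → HasDegree (updateAt d u pred v) (c v) (updateAt g u ∂ v)
  ∂-HasDegree d c g zero    eq hd zero    with d zero | hd zero | eq
  ... | suc x | h | refl = h
  ∂-HasDegree d c g zero    eq hd (suc v) = hd (suc v)
  ∂-HasDegree d c g (suc u) eq hd zero    = hd zero
  ∂-HasDegree d c g (suc u) eq hd (suc v) = ∂-HasDegree (d ∘ suc) (c ∘ suc) (g ∘ suc) u eq (hd ∘ suc) v

  -- Each edge acts as the difference of two partial finite differences, so exactly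
  -- the top-degree part of the product survives |es| of them.
  alt-leading : ∀ (es : Edges n) d c g → sum d ≡ length es → (∀ v → HasDegree (d v) (c v) (g v)) →
                alt es ⟦ g ⟧ ≡ alt es ⟦ δ ∘ d ⟧ * ∏ c
  alt-leading []             d c g eq hd = ⟦⟧-constant d c g eq hd
  alt-leading ((u , v) ∷ es) d c g eq hd = begin
    alt es (⟦ g ⟧ ∘ inc u) - alt es (⟦ g ⟧ ∘ inc v)
      ≡⟨ cong₂ _-_ (split u) (split v) ⟩
    (alt es ⟦ g ⟧ + alt es ⟦ updateAt g u ∂ ⟧) - (alt es ⟦ g ⟧ + alt es ⟦ updateAt g v ∂ ⟧)
      ≡⟨ lemma (alt es ⟦ g ⟧) _ _ ⟩
    alt es ⟦ updateAt g u ∂ ⟧ - alt es ⟦ updateAt g v ∂ ⟧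
      ≡⟨ cong₂ _-_ (step u) (step v) ⟩
    alt es (⟦ δ ∘ d ⟧ ∘ inc u) * ∏ c - alt es (⟦ δ ∘ d ⟧ ∘ inc v) * ∏ c
      ≡⟨ lemma′ (alt es (⟦ δ ∘ d ⟧ ∘ inc u)) _ _ ⟩
    (alt es (⟦ δ ∘ d ⟧ ∘ inc u) - alt es (⟦ δ ∘ d ⟧ ∘ inc v)) * ∏ c ∎
    where
    lemma : ∀ a b c → (a + b) - (a + c) ≡ b - c
    lemma = solve-∀
    lemma′ : ∀ a b c → a * c - b * c ≡ (a - b) * c
    lemma′ = solve-∀
    split : ∀ w → alt es (⟦ g ⟧ ∘ inc w) ≡ alt es ⟦ g ⟧ + alt es ⟦ updateAt g w ∂ ⟧
    split w = trans (alt-cong es (⟦⟧-inc g w)) (alt-+ es _ _)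
    step : ∀ w → alt es ⟦ updateAt g w ∂ ⟧ ≡ alt es (⟦ δ ∘ d ⟧ ∘ inc w) * ∏ c
    step w with d w in dw
    ... | suc x = begin
      alt es ⟦ updateAt g w ∂ ⟧
        ≡⟨ alt-leading es (updateAt d w pred) c (updateAt g w ∂)
             (ℕₚ.suc-injective (trans (sum-pred d w dw) eq)) (∂-HasDegree d c g w dw hd) ⟩
      alt es ⟦ δ ∘ updateAt d w pred ⟧ * ∏ c
        ≡⟨ cong (_* ∏ c) (alt-cong es (λ k → sym (⟦δ⟧-inc d w dw k))) ⟩
      alt es (⟦ δ ∘ d ⟧ ∘ inc w) * ∏ c ∎
    -- A factor of degree 0 at `w` is constant, so `∂` kills it; on the other side `δ 0` vanishes at
    -- every successor. Both sides are 0.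
    ... | zero = begin
      alt es ⟦ updateAt g w ∂ ⟧            ≡⟨ alt-cong es (λ k → ⟦⟧-zero (updateAt g w ∂) w k (∂≡0 (lookup k w))) ⟩
      alt es (const 0ℤ)                    ≡⟨ alt-0 es ⟩
      0ℤ                                   ≡⟨ sym (ℤₚ.*-zeroˡ (∏ c)) ⟩
      0ℤ * ∏ c                             ≡⟨ cong (_* ∏ c) (sym (alt-0 es)) ⟩
      alt es (const 0ℤ) * ∏ c              ≡⟨ cong (_* ∏ c) (alt-cong es (λ k → sym (⟦⟧-zero (δ ∘ d) w (inc w k) (δ≡0 k)))) ⟩
      alt es (⟦ δ ∘ d ⟧ ∘ inc w) * ∏ c     ∎
      where
      hdw : HasDegree 0 (c w) (g w)
      hdw = subst (λ x → HasDegree x (c w) (g w)) dw (hd w)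
      ∂≡0 : ∀ k → updateAt g w ∂ w k ≡ 0ℤ
      ∂≡0 k = trans (cong (λ h → h k) (VFₚ.updateAt-updates w g))
                    (trans (cong₂ _-_ (hdw (suc k)) (hdw k)) (ℤₚ.+-inverseʳ (c w)))
      δ≡0 : ∀ k → δ (d w) (lookup (inc w k) w) ≡ 0ℤ
      δ≡0 k = cong₂ δ dw (Vecₚ.lookup∘updateAt w k)

  -- Discrete Leibniz rule: ∂ ((k + a) h) = (k + a) ∂h + h (k + 1). For `h` of degree d with
  -- constant c, the summands contribute d c and c.
  linear-factor : ∀ d c h a → HasDegree d c h → HasDegree (suc d) (+ suc d * c) (λ k → (+ k + a) * h k)
  shift-degree : ∀ d c h → HasDegree d c h → HasDegree d c (h ∘ suc)
  shift-degree zero    c h hd k = hd (suc k)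
  shift-degree (suc d) c h hd   = shift-degree d c (∂ h) hd

  HasDegree-cong : ∀ d {c c′ h h′} → c ≡ c′ → (∀ k → h k ≡ h′ k) → HasDegree d c h → HasDegree d c′ h′
  HasDegree-cong zero    eq eq′ hd k = trans (sym (eq′ k)) (trans (hd k) eq)
  HasDegree-cong (suc d) eq eq′ hd   = HasDegree-cong d eq (λ k → cong₂ _-_ (eq′ (suc k)) (eq′ k)) hd

  HasDegree-+ : ∀ d {c c′} h h′ → HasDegree d c h → HasDegree d c′ h′ → HasDegree d (c + c′) (λ k → h k + h′ k)
  HasDegree-+ zero    h h′ hd hd′ k = cong₂ _+_ (hd k) (hd′ k)
  HasDegree-+ (suc d) h h′ hd hd′ =
    HasDegree-cong d refl (λ k → lemma (h (suc k)) (h k) (h′ (suc k)) (h′ k)) (HasDegree-+ d (∂ h) (∂ h′) hd hd′)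
    where
    lemma : ∀ a b c d → (a - b) + (c - d) ≡ (a + c) - (b + d)
    lemma = solve-∀

  linear-factor zero c h a hd k = begin
    (+ suc k + a) * h (suc k) - (+ k + a) * h k  ≡⟨ cong₂ (λ x y → (+ suc k + a) * x - (+ k + a) * y) (hd (suc k)) (hd k) ⟩
    (+ suc k + a) * c - (+ k + a) * c            ≡⟨ lemma (+ k) a c ⟩
    1ℤ * c                                       ∎
    where
    lemma : ∀ k a c → ((1ℤ + k) + a) * c - (k + a) * c ≡ 1ℤ * c
    lemma = solve-∀
  linear-factor (suc d) c h a hd =
    HasDegree-cong (suc d) (lemma₁ (+ suc d) c) (λ k → lemma₂ (+ k) a (h (suc k)) (h k))
      (HasDegree-+ (suc d) (λ k → (+ k + a) * ∂ h k) (h ∘ suc) (linear-factor d c (∂ h) a hd) (shift-degree (suc d) c h hd))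
    where
    lemma₁ : ∀ x c → x * c + c ≡ (1ℤ + x) * c
    lemma₁ = solve-∀
    lemma₂ : ∀ k a h′ h → (k + a) * (h′ - h) + h′ ≡ ((1ℤ + k) + a) * h′ - (k + a) * h
    lemma₂ = solve-∀

  -- Both out- and in-degree vectors are exposed: they are exchanged by reversing an orientation.
  alt₂ : Edges n → (Vec ℕ n → Vec ℕ n → ℤ) → ℤ
  alt₂ []             ψ = ψ 0⃗ 0⃗
  alt₂ ((u , v) ∷ es) ψ = alt₂ es (λ k l → ψ (inc u k) (inc v l)) - alt₂ es (λ k l → ψ (inc v k) (inc u l))

  degrees : Edges n → Vec ℕ n
  degrees []             = 0⃗
  degrees ((u , v) ∷ es) = inc u (inc v (degrees es))

  alt₂-cong : ∀ (es : Edges n) {φ ψ} → (∀ k l → k ⊕ l ≡ degrees es → φ k l ≡ ψ k l) → alt₂ es φ ≡ alt₂ es ψ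
  alt₂-cong []             eq = eq _ _ (0⃗-⊕ 0⃗)
  alt₂-cong ((u , v) ∷ es) eq = cong₂ _-_
    (alt₂-cong es (λ k l kl → eq _ _ (trans (inc-⊕ u k (inc v l)) (cong (inc u) (trans (⊕-inc v k l) (cong (inc v) kl))))))
    (alt₂-cong es (λ k l kl → eq _ _ (trans (⊕-inc u (inc v k) l) (cong (inc u) (trans (inc-⊕ v k l) (cong (inc v) kl))))))

  alt₂-out : ∀ (es : Edges n) φ → alt₂ es (λ k _ → φ k) ≡ alt es φ
  alt₂-out []             φ = refl
  alt₂-out ((u , v) ∷ es) φ = cong₂ _-_ (alt₂-out es _) (alt₂-out es _)

  sign : Edges n → ℤ
  sign []       = 1ℤ
  sign (_ ∷ es) = - sign es

  sign≢0 : (es : Edges n) → sign es ≢ 0ℤ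
  sign≢0 [] ()
  sign≢0 (_ ∷ es) eq = sign≢0 es (ℤₚ.neg-injective eq)

  -- Reading in-degrees as out-degrees reverses every edge, and each reversal costs one sign.
  alt₂-in : ∀ (es : Edges n) φ → alt₂ es (λ _ l → φ l) ≡ sign es * alt es φ
  alt₂-in []             φ = sym (ℤₚ.*-identityˡ _)
  alt₂-in ((u , v) ∷ es) φ = trans (cong₂ _-_ (alt₂-in es _) (alt₂-in es _)) (lemma (sign es) _ _)
    where
    lemma : ∀ s a b → s * a - s * b ≡ - s * (b - a)
    lemma = solve-∀

  -- If an orientation has out-degrees `k` and in-degrees `l`, a second one with out-degrees `m`
  -- completes `k` to the full degrees only for `m` equal to `l`. This is how in-degrees enter the
  -- central coefficient.
  ⟦δ⟧-⊕ : ∀ (d : Fin n → ℕ) k l m → (∀ v → lookup (k ⊕ l) v ≡ d v) → ⟦ δ ∘ d ⟧ (k ⊕ m) ≡ ⟦ δ ∘ lookup l ⟧ m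
  ⟦δ⟧-⊕ d []      []      []      eq = refl
  ⟦δ⟧-⊕ d (x ∷ k) (y ∷ l) (z ∷ m) eq =
    cong₂ _*_ (trans (cong (λ t → δ t (x ℕ.+ z)) (sym (eq zero))) (cancel x)) (⟦δ⟧-⊕ (d ∘ suc) k l m (eq ∘ suc))
    where
    cancel : ∀ x → δ (x ℕ.+ y) (x ℕ.+ z) ≡ δ y z
    cancel zero    = refl
    cancel (suc x) = cancel x

  δ-refl : ∀ d → δ d d ≡ 1ℤ
  δ-refl zero    = refl
  δ-refl (suc d) = δ-refl d

  δ-≢ : ∀ {d k} → d ≢ k → δ d k ≡ 0ℤ
  δ-≢ {zero}  {zero}  ne = contradiction refl ne
  δ-≢ {zero}  {suc k} ne = refl
  δ-≢ {suc d} {zero}  ne = refl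
  δ-≢ {suc d} {suc k} ne = δ-≢ (ne ∘ cong suc)

  eqv : Vec ℕ n → Vec ℕ n → ℤ
  eqv l = ⟦ δ ∘ lookup l ⟧

  eqv-refl : (k : Vec ℕ n) → eqv k k ≡ 1ℤ
  eqv-refl []      = refl
  eqv-refl (x ∷ k) = cong₂ _*_ (δ-refl x) (eqv-refl k)

  eqv-≢ : {k l : Vec ℕ n} → k ≢ l → eqv k l ≡ 0ℤ
  eqv-≢ {k = []}    {[]}    ne = contradiction refl ne
  eqv-≢ {k = x ∷ k} {y ∷ l} ne with x ℕₚ.≟ y
  ... | no x≢y = trans (cong (_* eqv k l) (δ-≢ x≢y)) (ℤₚ.*-zeroˡ (eqv k l))
  ... | yes refl = trans (cong (δ x x *_) (eqv-≢ (ne ∘ cong (x ∷_)))) (ℤₚ.*-zeroʳ (δ x x))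

  coefficient : Edges n → Vec ℕ n → ℤ
  coefficient es l = alt es (eqv l)

  -- The expansion of ∏ (z_u - z_v) before like monomials are collected: one signed exponent vector
  -- for each choice of directions.
  terms : Edges n → List (ℤ × Vec ℕ n)
  terms []             = (1ℤ , 0⃗) ∷ []
  terms ((u , v) ∷ es) = map (map₂ (inc u)) (terms es) ++ map (λ (s , k) → - s , inc v k) (terms es)

  Σt : List (ℤ × Vec ℕ n) → (Vec ℕ n → ℤ) → ℤ
  Σt []             φ = 0ℤ
  Σt ((s , k) ∷ ts) φ = s * φ k + Σt ts φ

  Σt-++ : ∀ (xs ys : List (ℤ × Vec ℕ n)) φ → Σt (xs ++ ys) φ ≡ Σt xs φ + Σt ys φ
  Σt-++ []             ys φ = sym (ℤₚ.+-identityˡ _)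
  Σt-++ ((s , k) ∷ xs) ys φ = trans (cong (λ x → s * φ k + x) (Σt-++ xs ys φ)) (sym (ℤₚ.+-assoc (s * φ k) _ _))

  Σt-map : ∀ (ts : List (ℤ × Vec ℕ n)) (f : Vec ℕ n → Vec ℕ n) φ → Σt (map (map₂ f) ts) φ ≡ Σt ts (φ ∘ f)
  Σt-map []             f φ = refl
  Σt-map ((s , k) ∷ ts) f φ = cong (λ x → s * φ (f k) + x) (Σt-map ts f φ)

  Σt-neg : ∀ (ts : List (ℤ × Vec ℕ n)) (f : Vec ℕ n → Vec ℕ n) φ → Σt (map (λ (s , k) → - s , f k) ts) φ ≡ - Σt ts (φ ∘ f)
  Σt-neg []             f φ = refl
  Σt-neg ((s , k) ∷ ts) f φ = trans (cong (λ x → - s * φ (f k) + x) (Σt-neg ts f φ)) (lemma s (φ (f k)) _)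
    where
    lemma : ∀ s a b → - s * a + - b ≡ - (s * a + b)
    lemma = solve-∀

  alt-terms : ∀ (es : Edges n) φ → alt es φ ≡ Σt (terms es) φ
  alt-terms []             φ = sym (trans (ℤₚ.+-identityʳ (1ℤ * φ 0⃗)) (ℤₚ.*-identityˡ _))
  alt-terms ((u , v) ∷ es) φ = sym (trans (Σt-++ (map (map₂ (inc u)) (terms es)) _ φ) (cong₂ _+_
    (trans (Σt-map (terms es) (inc u) φ) (sym (alt-terms es _)))
    (trans (Σt-neg (terms es) (inc v) φ) (cong -_ (sym (alt-terms es _))))))

  Σl : List (Vec ℕ n) → (Vec ℕ n → ℤ) → ℤ
  Σl []       φ = 0ℤ
  Σl (κ ∷ κs) φ = φ κ + Σl κs φ

  Σl-cong : ∀ (κs : List (Vec ℕ n)) {φ ψ} → (∀ k → φ k ≡ ψ k) → Σl κs φ ≡ Σl κs ψ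
  Σl-cong []       eq = refl
  Σl-cong (κ ∷ κs) eq = cong₂ _+_ (eq κ) (Σl-cong κs eq)

  Σl-+ : ∀ (κs : List (Vec ℕ n)) φ ψ → Σl κs (λ k → φ k + ψ k) ≡ Σl κs φ + Σl κs ψ
  Σl-+ []       φ ψ = refl
  Σl-+ (κ ∷ κs) φ ψ = trans (cong (λ x → φ κ + ψ κ + x) (Σl-+ κs φ ψ)) (lemma (φ κ) _ _ _)
    where
    lemma : ∀ a b c d → (a + b) + (c + d) ≡ (a + c) + (b + d)
    lemma = solve-∀

  Σl-0 : ∀ (κs : List (Vec ℕ n)) {φ} → (∀ {k} → k ∈ κs → φ k ≡ 0ℤ) → Σl κs φ ≡ 0ℤ
  Σl-0 []       eq = refl
  Σl-0 (κ ∷ κs) eq = cong₂ _+_ (eq (here refl)) (Σl-0 κs (eq ∘ there))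

  Σl-pick : ∀ {κs : List (Vec ℕ n)} {k} s (φ : Vec ℕ n → ℤ) → Unique κs → k ∈ κs → Σl κs (λ κ → (s * eqv κ k) * φ κ) ≡ s * φ k
  Σl-pick {κs = κ ∷ κs} {k} s φ (κ∉ ∷ un) (here refl) = begin
    (s * eqv k k) * φ k + Σl κs (λ κ → (s * eqv κ k) * φ κ)
      ≡⟨ cong₂ _+_ (cong (λ x → (s * x) * φ k) (eqv-refl k)) (Σl-0 κs (λ {κ′} κ∈ →
           trans (cong (λ x → (s * x) * φ κ′) (eqv-≢ (All.lookup κ∉ κ∈ ∘ sym))) (vanish s (φ κ′)))) ⟩
    (s * 1ℤ) * φ k + 0ℤ  ≡⟨ lemma s (φ k) ⟩
    s * φ k              ∎
    where
    vanish : ∀ s a → (s * 0ℤ) * a ≡ 0ℤ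
    vanish = solve-∀
    lemma : ∀ s a → (s * 1ℤ) * a + 0ℤ ≡ s * a
    lemma = solve-∀
  Σl-pick {κs = κ ∷ κs} {k} s φ (κ∉ ∷ un) (there k∈) =
    trans (cong₂ _+_ (trans (cong (λ x → (s * x) * φ κ) (eqv-≢ (All.lookup κ∉ k∈))) (vanish s (φ κ))) (Σl-pick s φ un k∈))
          (ℤₚ.+-identityˡ _)
    where
    vanish : ∀ s a → (s * 0ℤ) * a ≡ 0ℤ
    vanish = solve-∀

  Σt-group : ∀ {κs : List (Vec ℕ n)} ts (φ : Vec ℕ n → ℤ) → Unique κs → All (λ t → proj₂ t ∈ κs) ts →
             Σt ts φ ≡ Σl κs (λ κ → Σt ts (eqv κ) * φ κ)
  Σt-group {κs = κs} []             φ un []          = sym (Σl-0 κs (λ {κ} _ → ℤₚ.*-zeroˡ (φ κ)))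
  Σt-group {κs = κs} ((s , k) ∷ ts) φ un (k∈ ∷ ts∈) = begin
    s * φ k + Σt ts φ
      ≡⟨ cong₂ _+_ (sym (Σl-pick s φ un k∈)) (Σt-group ts φ un ts∈) ⟩
    Σl κs (λ κ → (s * eqv κ k) * φ κ) + Σl κs (λ κ → Σt ts (eqv κ) * φ κ)
      ≡⟨ sym (Σl-+ κs _ _) ⟩
    Σl κs (λ κ → (s * eqv κ k) * φ κ + Σt ts (eqv κ) * φ κ)
      ≡⟨ Σl-cong κs (λ κ → sym (ℤₚ.*-distribʳ-+ (φ κ) (s * eqv κ k) _)) ⟩
    Σl κs (λ κ → (s * eqv κ k + Σt ts (eqv κ)) * φ κ) ∎

  Σl-squares : ∀ (κs : List (Vec ℕ n)) (φ : Vec ℕ n → ℤ) → Σl κs (λ κ → φ κ * φ κ) ≡ 0ℤ → ∀ {k} → k ∈ κs → φ k ≡ 0ℤ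
  Σl-squares {n} κs φ eq k∈ = go κs (ℤₚ.+-injective (trans (sym (norm κs)) eq)) k∈
    where
    ‖_‖ : List (Vec ℕ n) → ℕ
    ‖ [] ‖     = 0
    ‖ κ ∷ κs ‖ = ∣ φ κ ∣ ℕ.* ∣ φ κ ∣ ℕ.+ ‖ κs ‖
    square : ∀ i → i * i ≡ + (∣ i ∣ ℕ.* ∣ i ∣)
    square (+ m)      = sym (ℤₚ.pos-* m m)
    square ℤ.-[1+ m ] = refl
    norm : ∀ κs → Σl κs (λ κ → φ κ * φ κ) ≡ + ‖ κs ‖
    norm []       = refl
    norm (κ ∷ κs) = trans (cong₂ _+_ (square (φ κ)) (norm κs)) (sym (ℤₚ.pos-+ (∣ φ κ ∣ ℕ.* ∣ φ κ ∣) ‖ κs ‖))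
    root : ∀ m → m ℕ.* m ≡ 0 → m ≡ 0
    root zero _ = refl
    go : ∀ κs → ‖ κs ‖ ≡ 0 → ∀ {k} → k ∈ κs → φ k ≡ 0ℤ
    go (κ ∷ κs) z (here refl) = ℤₚ.∣i∣≡0⇒i≡0 (root _ (ℕₚ.m+n≡0⇒m≡0 _ z))
    go (κ ∷ κs) z (there k∈)  = go κs (ℕₚ.m+n≡0⇒n≡0 (∣ φ κ ∣ ℕ.* ∣ φ κ ∣) z) k∈

  powers : Fin n → ℕ → ℤ
  powers v k = (+ suc (toℕ v)) ℤ.^ k

  ⟦powers⟧-inc : ∀ (h : Fin n → ℤ) u k → ⟦ (λ v → h v ℤ.^_) ⟧ (inc u k) ≡ h u * ⟦ (λ v → h v ℤ.^_) ⟧ k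
  ⟦powers⟧-inc h zero    (k ∷ ks) = ℤₚ.*-assoc (h zero) _ _
  ⟦powers⟧-inc h (suc u) (k ∷ ks) =
    trans (cong (h zero ℤ.^ k *_) (⟦powers⟧-inc (h ∘ suc) u ks)) (lemma (h zero ℤ.^ k) (h (suc u)) _)
    where
    lemma : ∀ a b c → a * (b * c) ≡ b * (a * c)
    lemma = solve-∀

  -- Evaluating the edge product ∏ (z_u - z_v) at distinct integers shows that it is not the zero polynomial.
  alt-powers≢0 : ∀ (es : Edges n) → All (λ (u , v) → u ≢ v) es → alt es ⟦ powers ⟧ ≢ 0ℤ
  alt-powers≢0 {n} [] [] eq = ones n eq
    where
    ones : ∀ n → ⟦ powers {n} ⟧ 0⃗ ≢ 0ℤ
    ones n eq = 1≢0 (trans (sym (one {n} (λ v → + suc (toℕ v)))) eq)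
      where
      1≢0 : 1ℤ ≢ 0ℤ
      1≢0 ()
      one : ∀ {n} (h : Fin n → ℤ) → ⟦ (λ v → h v ℤ.^_) ⟧ 0⃗ ≡ 1ℤ
      one {zero}  h = refl
      one {suc n} h = cong (1ℤ *_) (one (h ∘ suc))
  alt-powers≢0 ((u , v) ∷ es) (u≢v ∷ ne) eq
    with ℤₚ.i*j≡0⇒i≡0∨j≡0 (+ suc (toℕ u) - + suc (toℕ v)) (trans (sym factor) eq)
    where
    lemma : ∀ a b c → a * c - b * c ≡ (a - b) * c
    lemma = solve-∀
    step : ∀ w → alt es (⟦ powers ⟧ ∘ inc w) ≡ + suc (toℕ w) * alt es ⟦ powers ⟧
    step w = trans (alt-cong es (⟦powers⟧-inc (λ v → + suc (toℕ v)) w)) (alt-*ˡ es (+ suc (toℕ w)) ⟦ powers ⟧)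
    factor : alt ((u , v) ∷ es) ⟦ powers ⟧ ≡ (+ suc (toℕ u) - + suc (toℕ v)) * alt es ⟦ powers ⟧
    factor = trans (cong₂ _-_ (step u) (step v)) (lemma (+ suc (toℕ u)) (+ suc (toℕ v)) (alt es ⟦ powers ⟧))
  ... | inj₁ e = u≢v (Finₚ.toℕ-injective (ℕₚ.suc-injective (ℤₚ.+-injective (ℤₚ.i-j≡0⇒i≡j _ _ e))))
  ... | inj₂ e = alt-powers≢0 es ne e

  -- Grouped by monomial, the sum is Σ coefficient². Were it 0, every coefficient would vanish, and
  -- so would the evaluation at `powers`.
  Σcoefficient²≢0 : ∀ (es : Edges n) → All (λ (u , v) → u ≢ v) es → alt es (coefficient es) ≢ 0ℤ
  Σcoefficient²≢0 {n} es ne eq = alt-powers≢0 es ne (trans (grouped ⟦ powers ⟧) (Σl-0 κs (λ {κ} κ∈ →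
      trans (cong (_* ⟦ powers ⟧ κ) (Σl-squares κs (coefficient es) squares κ∈)) (ℤₚ.*-zeroˡ (⟦ powers ⟧ κ)))))
    where
    κs : List (Vec ℕ n)
    κs = deduplicate (Vecₚ.≡-dec ℕₚ._≟_) (map proj₂ (terms es))
    un : Unique κs
    un = Uniqueₚ.deduplicate-! (Vecₚ.≡-dec ℕₚ._≟_) (map proj₂ (terms es))
    keys∈ : All (λ t → proj₂ t ∈ κs) (terms es)
    keys∈ = All.tabulate (λ t∈ → ∈ₚ.∈-deduplicate⁺ (Vecₚ.≡-dec ℕₚ._≟_) (∈ₚ.∈-map⁺ proj₂ t∈))
    grouped : ∀ φ → alt es φ ≡ Σl κs (λ κ → coefficient es κ * φ κ)
    grouped φ = trans (alt-terms es φ) (trans (Σt-group (terms es) φ un keys∈)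
                  (Σl-cong κs (λ κ → cong (_* φ κ) (sym (alt-terms es (eqv κ))))))
    squares : Σl κs (λ κ → coefficient es κ * coefficient es κ) ≡ 0ℤ
    squares = trans (sym (grouped (coefficient es))) eq

  -- The coefficient of ∏ z_v^{deg v} in ∏ (z_u - z_v)² is, up to sign, a sum of squares.
  alt-doubled≢0 : ∀ (es : Edges n) → All (λ (u , v) → u ≢ v) es → alt (es ++ es) ⟦ δ ∘ lookup (degrees es) ⟧ ≢ 0ℤ
  alt-doubled≢0 es ne eq with ℤₚ.i*j≡0⇒i≡0∨j≡0 (sign es) (trans (sym expand) eq)
    where
    expand : alt (es ++ es) ⟦ δ ∘ lookup (degrees es) ⟧ ≡ sign es * alt es (coefficient es)
    expand = begin
      alt (es ++ es) ⟦ δ ∘ lookup (degrees es) ⟧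
        ≡⟨ alt-++ es es _ ⟩
      alt es (λ k → alt es (λ m → ⟦ δ ∘ lookup (degrees es) ⟧ (k ⊕ m)))
        ≡⟨ sym (alt₂-out es _) ⟩
      alt₂ es (λ k _ → alt es (λ m → ⟦ δ ∘ lookup (degrees es) ⟧ (k ⊕ m)))
        ≡⟨ alt₂-cong es (λ k l kl → alt-cong es (λ m →
             ⟦δ⟧-⊕ (lookup (degrees es)) k l m (λ v → cong (λ t → lookup t v) kl))) ⟩
      alt₂ es (λ _ l → coefficient es l)
        ≡⟨ alt₂-in es (coefficient es) ⟩
      sign es * alt es (coefficient es) ∎
  ... | inj₁ e = sign≢0 es e
  ... | inj₂ e = Σcoefficient²≢0 es ne e

  -- Orientations from nonvanishing alternating sums

  _≟ᵉ_ : (e f : Fin n × Fin n) → Dec (e ≡ f)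
  _≟ᵉ_ = Prodₚ.≡-dec Finₚ._≟_ Finₚ._≟_

  Direction : ℕ → Set
  Direction n = Fin n → Fin n → Bool

  assign : Fin n × Fin n → Bool → Direction n → Direction n
  assign e b χ x y = if does ((x , y) ≟ᵉ e) then b else χ x y

  assign-same : ∀ (e : Fin n × Fin n) b χ → assign e b χ (proj₁ e) (proj₂ e) ≡ b
  assign-same e b χ = cong (if_then b else _) (dec-true (e ≟ᵉ e) refl)

  assign-other : ∀ (e : Fin n × Fin n) b χ {f} → f ≢ e → assign e b χ (proj₁ f) (proj₂ f) ≡ χ (proj₁ f) (proj₂ f)
  assign-other e b χ {f} ne = cong (if_then b else _) (dec-false (f ≟ᵉ e) ne)

  source : Direction n → Fin n × Fin n → Fin n
  source χ (u , v) = if χ u v then u else v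

  outs : Edges n → Direction n → Vec ℕ n
  outs []       χ = 0⃗
  outs (e ∷ es) χ = inc (source χ e) (outs es χ)

  outs-assign : ∀ {e : Fin n × Fin n} {es} b χ → All (e ≢_) es → outs es (assign e b χ) ≡ outs es χ
  outs-assign {es = []}           b χ []         = refl
  outs-assign {e = e} {es = f ∷ es} b χ (e≢f ∷ ne) =
    cong₂ inc (cong (if_then _ else _) (assign-other e b χ (e≢f ∘ sym))) (outs-assign b χ ne)

  -- A nonzero difference has a nonzero term, which fixes the direction of the first edge.
  -- Uniqueness of the edges ensures that this assignment does not disturb the later ones.
  alt≢0⇒orientation : ∀ (es : Edges n) φ → Unique es → alt es φ ≢ 0ℤ → ∃ λ χ → φ (outs es χ) ≢ 0ℤ
  alt≢0⇒orientation []             φ un ne = (λ _ _ → true) , ne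
  alt≢0⇒orientation ((u , v) ∷ es) φ (e∉ ∷ un) ne with alt es (φ ∘ inc u) ℤₚ.≟ 0ℤ
  ... | no ≢0 with alt≢0⇒orientation es (φ ∘ inc u) un ≢0
  ...   | χ , p = assign (u , v) true χ , subst (λ k → φ k ≢ 0ℤ)
            (cong₂ inc (cong (if_then u else v) (sym (assign-same (u , v) true χ))) (sym (outs-assign true χ e∉))) p
  alt≢0⇒orientation ((u , v) ∷ es) φ (e∉ ∷ un) ne | yes ≡0 with alt≢0⇒orientation es (φ ∘ inc v) un ≢0
    where
    ≢0 : alt es (φ ∘ inc v) ≢ 0ℤ
    ≢0 z = ne (cong₂ _-_ ≡0 z)
  ... | χ , p = assign (u , v) false χ , subst (λ k → φ k ≢ 0ℤ)
            (cong₂ inc (cong (if_then u else v) (sym (assign-same (u , v) false χ))) (sym (outs-assign false χ e∉))) p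

  -- Nearly balanced orientations of multigraphs

  data Orients : Fin n × Fin n → Fin n × Fin n → Set where
    keep : ∀ {u v : Fin n} → Orients (u , v) (u , v)
    flip : ∀ {u v : Fin n} → Orients (u , v) (v , u)

  𝟙 : Fin n → Fin n → ℤ
  𝟙 v w = if does (w Finₚ.≟ v) then 1ℤ else 0ℤ

  excess : Edges n → Fin n → ℤ
  excess []             w = 0ℤ
  excess ((u , v) ∷ as) w = (𝟙 w u - 𝟙 w v) + excess as w

  excess-↭ : ∀ {as bs : Edges n} → as ↭ bs → ∀ w → excess as w ≡ excess bs w
  excess-↭ refl                      w = refl
  excess-↭ (prep (u , v) p)          w = cong (λ t → (𝟙 w u - 𝟙 w v) + t) (excess-↭ p w)
  excess-↭ (swap {as} {bs} (u , v) (x , y) p) w =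
    trans (lemma (𝟙 w u - 𝟙 w v) (𝟙 w x - 𝟙 w y) (excess as w))
          (cong (λ t → (𝟙 w x - 𝟙 w y) + ((𝟙 w u - 𝟙 w v) + t)) (excess-↭ p w))
    where
    lemma : ∀ a b c → a + (b + c) ≡ b + (a + c)
    lemma = solve-∀
  excess-↭ (↭.trans p q)               w = trans (excess-↭ p w) (excess-↭ q w)

  orients-↭ : ∀ {es fs bs : Edges n} → es ↭ fs → Pointwise Orients fs bs → ∃ λ as → Pointwise Orients es as × as ↭ bs
  orients-↭ refl       os            = _ , os , refl
  orients-↭ (prep e p) (o ∷ os)      with orients-↭ p os
  ... | as , os′ , q = _ , o ∷ os′ , prep _ q
  orients-↭ (swap e f p) (o ∷ o′ ∷ os) with orients-↭ p os
  ... | as , os′ , q = _ , o′ ∷ o ∷ os′ , swap _ _ q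
  orients-↭ (↭.trans p q) os with orients-↭ q os
  ... | as , os′ , r with orients-↭ p os′
  ...   | as′ , os″ , r′ = as′ , os″ , ↭.trans r′ r

  -- The list is a multigraph: splicing can create parallel edges and loops. A loop adds 0 to every
  -- excess, so it does no harm.
  Balanced : Edges n → Set
  Balanced es = ∃ λ as → Pointwise Orients es as × (∀ w → ∣ excess as w ∣ ≤ 1)

  balanced-↭ : ∀ {es fs : Edges n} → es ↭ fs → Balanced fs → Balanced es
  balanced-↭ p (bs , os , bal) with orients-↭ p os
  ... | as , os′ , q = as , os′ , λ w → subst (λ t → ∣ t ∣ ≤ 1) (sym (excess-↭ q w)) (bal w)

  balanced-flip : ∀ {u v : Fin n} {es} → Balanced ((u , v) ∷ es) → Balanced ((v , u) ∷ es)
  balanced-flip (_ , keep ∷ os , bal) = _ , flip ∷ os , bal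
  balanced-flip (_ , flip ∷ os , bal) = _ , keep ∷ os , bal

  Incident : Fin n → Fin n × Fin n → Set
  Incident w (u , v) = u ≡ w ⊎ v ≡ w

  incident? : ∀ (w : Fin n) e → Dec (Incident w e)
  incident? w (u , v) = (u Finₚ.≟ w) ⊎-dec (v Finₚ.≟ w)

  extract : ∀ {P : Fin n × Fin n → Set} {es} → Any P es → ∃ λ e → ∃ λ fs → P e × es ↭ e ∷ fs
  extract (here p)  = _ , _ , p , refl
  extract (there q) with extract q
  ... | e , fs , p , r = e , _ , p , ↭.trans (prep _ r) (swap _ _ refl)

  𝟙-≢ : ∀ {v w : Fin n} → w ≢ v → 𝟙 v w ≡ 0ℤ
  𝟙-≢ {v = v} {w} ne = cong (if_then _ else _) (dec-false (w Finₚ.≟ v) ne)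

  excess-unincident : ∀ {es as : Edges n} {w} → Pointwise Orients es as → ¬ Any (Incident w) es → excess as w ≡ 0ℤ
  excess-unincident []          ni = refl
  excess-unincident (keep ∷ os) ni =
    cong₂ _+_ (cong₂ _-_ (𝟙-≢ (ni ∘ here ∘ inj₁)) (𝟙-≢ (ni ∘ here ∘ inj₂))) (excess-unincident os (ni ∘ there))
  excess-unincident (flip ∷ os) ni =
    cong₂ _+_ (cong₂ _-_ (𝟙-≢ (ni ∘ here ∘ inj₂)) (𝟙-≢ (ni ∘ here ∘ inj₁))) (excess-unincident os (ni ∘ there))

  -- Two edges meeting at b are replaced by one edge between their other ends; the balance at b does not change.
  splice : ∀ {a b d : Fin n} {fs} → Balanced ((a , d) ∷ fs) → Balanced ((a , b) ∷ (b , d) ∷ fs)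
  splice {a = a} {b} {d} ((_ ∷ as) , keep ∷ os , bal) = _ , keep ∷ keep ∷ os ,
    λ w → subst (λ t → ∣ t ∣ ≤ 1) (lemma (𝟙 w a) (𝟙 w b) (𝟙 w d) (excess as w)) (bal w)
    where
    lemma : ∀ x y z e → (x - z) + e ≡ (x - y) + ((y - z) + e)
    lemma = solve-∀
  splice {a = a} {b} {d} ((_ ∷ as) , flip ∷ os , bal) = _ , flip ∷ flip ∷ os ,
    λ w → subst (λ t → ∣ t ∣ ≤ 1) (lemma (𝟙 w a) (𝟙 w b) (𝟙 w d) (excess as w)) (bal w)
    where
    lemma : ∀ x y z e → (z - x) + e ≡ (y - x) + ((z - y) + e)
    lemma = solve-∀

  ∣𝟙-𝟙∣≤1 : ∀ (u v w : Fin n) → ∣ 𝟙 w u - 𝟙 w v ∣ ≤ 1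
  ∣𝟙-𝟙∣≤1 u v w with does (u Finₚ.≟ w) | does (v Finₚ.≟ w)
  ... | true  | true  = z≤n
  ... | true  | false = s≤s z≤n
  ... | false | true  = s≤s z≤n
  ... | false | false = z≤n

  balanced-isolated : ∀ {a b : Fin n} {es} → ¬ Any (Incident a) es → ¬ Any (Incident b) es →
                      Balanced es → Balanced ((a , b) ∷ es)
  balanced-isolated {a = a} {b} na nb (as , os , bal) = _ , keep ∷ os , bound
    where
    bound : ∀ w → ∣ (𝟙 w a - 𝟙 w b) + excess as w ∣ ≤ 1
    bound w = go (a Finₚ.≟ w) (b Finₚ.≟ w)
      where
      unmet : excess as w ≡ 0ℤ → ∣ (𝟙 w a - 𝟙 w b) + excess as w ∣ ≤ 1
      unmet eq = subst (λ t → ∣ t ∣ ≤ 1) (sym (trans (cong (λ t → (𝟙 w a - 𝟙 w b) + t) eq) (ℤₚ.+-identityʳ (𝟙 w a - 𝟙 w b)))) (∣𝟙-𝟙∣≤1 a b w)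
      go : Dec (a ≡ w) → Dec (b ≡ w) → ∣ (𝟙 w a - 𝟙 w b) + excess as w ∣ ≤ 1
      go (yes refl) _          = unmet (excess-unincident os na)
      go (no _)     (yes refl) = unmet (excess-unincident os nb)
      go (no a≢w)   (no b≢w)   = subst (λ t → ∣ t ∣ ≤ 1)
        (sym (trans (cong (_+ excess as w) (cong₂ _-_ (𝟙-≢ a≢w) (𝟙-≢ b≢w))) (ℤₚ.+-identityˡ (excess as w)))) (bal w)

  splice′ : ∀ {a b d : Fin n} {fs} → Balanced ((a , d) ∷ fs) → Balanced ((a , b) ∷ (d , b) ∷ fs)
  splice′ bal = balanced-↭ (swap _ _ refl) (balanced-flip (balanced-↭ (swap _ _ refl) (splice bal)))

  -- An edge that meets another one is spliced with it, which lowers the number of edges by one; an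
  -- edge meeting no other can point either way. The bound `m` carries the recursion, since a
  -- spliced list is not a sublist.
  balanced-orientation : ∀ m (es : Edges n) → length es ≤ m → Balanced es
  balanced-meeting : ∀ m {a b : Fin n} {es} → length es ≤ m → Any (Incident b) es → Balanced ((a , b) ∷ es)

  balanced-orientation m       []             le = [] , [] , λ _ → z≤n
  balanced-orientation (suc m) ((a , b) ∷ es) (s≤s le) with any? (incident? b) es | any? (incident? a) es
  ... | yes q | _     = balanced-meeting m le q
  ... | no nb | yes q = balanced-flip (balanced-meeting m le q)
  ... | no nb | no na = balanced-isolated na nb (balanced-orientation m es le)

  balanced-meeting m le q with extract q
  ... | _ , fs , inj₁ refl , r = balanced-↭ (prep _ r) (splice (balanced-orientation m _ (subst (_≤ m) (↭-length r) le)))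
  ... | _ , fs , inj₂ refl , r = balanced-↭ (prep _ r) (splice′ (balanced-orientation m _ (subst (_≤ m) (↭-length r) le)))

  arc-of : Direction n → Fin n × Fin n → Fin n × Fin n
  arc-of χ (u , v) = if χ u v then (u , v) else (v , u)

  arcs : Edges n → Direction n → Edges n
  arcs es χ = map (arc-of χ) es

  arcs-assign : ∀ {e : Fin n × Fin n} {es} b χ → All (e ≢_) es → arcs es (assign e b χ) ≡ arcs es χ
  arcs-assign {es = []}             b χ []         = refl
  arcs-assign {e = e} {es = f ∷ es} b χ (e≢f ∷ ne) =
    cong₂ _∷_ (cong (if_then _ else _) (assign-other e b χ (e≢f ∘ sym))) (arcs-assign b χ ne)

  orients⇒direction : ∀ {es as : Edges n} → Unique es → Pointwise Orients es as → ∃ λ χ → arcs es χ ≡ as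
  orients⇒direction un [] = (λ _ _ → true) , refl
  orients⇒direction {es = e ∷ _} (e∉ ∷ un) (keep ∷ os) with orients⇒direction un os
  ... | χ , eq = assign e true χ ,
    cong₂ _∷_ (cong (if_then _ else _) (assign-same e true χ)) (trans (arcs-assign true χ e∉) eq)
  orients⇒direction {es = e ∷ _} (e∉ ∷ un) (flip ∷ os) with orients⇒direction un os
  ... | χ , eq = assign e false χ ,
    cong₂ _∷_ (cong (if_then _ else _) (assign-same e false χ)) (trans (arcs-assign false χ e∉) eq)

  balanced-direction : ∀ (es : Edges n) → Unique es → ∃ λ χ → ∀ w → ∣ excess (arcs es χ) w ∣ ≤ 1
  balanced-direction es un with balanced-orientation (length es) es ℕₚ.≤-refl
  ... | as , os , bal with orients⇒direction un os
  ...   | χ , eq = χ , λ w → subst (λ as → ∣ excess as w ∣ ≤ 1) (sym eq) (bal w)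

  lookup-inc : ∀ (k : Vec ℕ n) u w → + lookup (inc u k) w ≡ 𝟙 w u + + lookup k w
  lookup-inc k u w with u Finₚ.≟ w
  ... | yes refl = cong +_ (Vecₚ.lookup∘updateAt u k)
  ... | no  u≢w  = trans (cong +_ (Vecₚ.lookup∘updateAt′ w u (u≢w ∘ sym) k)) (sym (ℤₚ.+-identityˡ _))

  Disagree : Direction n → Direction n → Fin n × Fin n → Set
  Disagree χ₁ χ₂ (u , v) = χ₁ u v ≢ χ₂ u v

  disagree? : (χ₁ χ₂ : Direction n) (e : Fin n × Fin n) → Dec (Disagree χ₁ χ₂ e)
  disagree? χ₁ χ₂ (u , v) with χ₁ u v Boolₚ.≟ χ₂ u v
  ... | yes eq = no (λ ne → ne eq)
  ... | no  ne = yes ne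

  merge : Direction n → Direction n → Direction n → Direction n
  merge χ₁ χ₂ χ₃ u v = if does (disagree? χ₁ χ₂ (u , v)) then χ₃ u v else χ₁ u v

  -- Where the two directions agree, the edge counts twice at the same end. Where they disagree, it
  -- counts once at each end, and twice the chosen source is the sum of both ends plus source minus
  -- target, which is the contribution of the edge to the excess.
  excess-filter : ∀ (es : Edges n) e χ₁ χ₂ χ₃ w →
    + 2 * 𝟙 w (source (merge χ₁ χ₂ χ₃) e) + excess (arcs (filter (disagree? χ₁ χ₂) es) χ₃) w ≡
    (𝟙 w (source χ₁ e) + 𝟙 w (source χ₂ e)) + excess (arcs (filter (disagree? χ₁ χ₂) (e ∷ es)) χ₃) w
  excess-filter es (u , v) χ₁ χ₂ χ₃ w with disagree? χ₁ χ₂ (u , v)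
  ... | no ¬ne with χ₁ u v | χ₂ u v
  ...   | true  | true  = cong (_+ _) (lemma (𝟙 w u))
    where
    lemma : ∀ a → + 2 * a ≡ a + a
    lemma = solve-∀
  ...   | false | false = cong (_+ _) (lemma (𝟙 w v))
    where
    lemma : ∀ a → + 2 * a ≡ a + a
    lemma = solve-∀
  ...   | true  | false = contradiction (λ ()) ¬ne
  ...   | false | true  = contradiction (λ ()) ¬ne
  excess-filter es (u , v) χ₁ χ₂ χ₃ w | yes ne with χ₁ u v | χ₂ u v | χ₃ u v
  ...   | true  | true  | _     = contradiction refl ne
  ...   | false | false | _     = contradiction refl ne
  ...   | true  | false | true  = lemma (𝟙 w u) (𝟙 w v) _
    where
    lemma : ∀ a b e → + 2 * a + e ≡ (a + b) + ((a - b) + e)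
    lemma = solve-∀
  ...   | false | true  | true  = lemma (𝟙 w u) (𝟙 w v) _
    where
    lemma : ∀ a b e → + 2 * a + e ≡ (b + a) + ((a - b) + e)
    lemma = solve-∀
  ...   | true  | false | false = lemma (𝟙 w u) (𝟙 w v) _
    where
    lemma : ∀ a b e → + 2 * b + e ≡ (a + b) + ((b - a) + e)
    lemma = solve-∀
  ...   | false | true  | false = lemma (𝟙 w u) (𝟙 w v) _
    where
    lemma : ∀ a b e → + 2 * b + e ≡ (b + a) + ((b - a) + e)
    lemma = solve-∀

  merge-outs : ∀ (es : Edges n) χ₁ χ₂ χ₃ w →
    + 2 * + lookup (outs es (merge χ₁ χ₂ χ₃)) w ≡
    (+ lookup (outs es χ₁) w + + lookup (outs es χ₂) w) + excess (arcs (filter (disagree? χ₁ χ₂) es) χ₃) w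
  merge-outs {n} [] χ₁ χ₂ χ₃ w =
    subst (λ t → + 2 * + t ≡ (+ t + + t) + 0ℤ) (sym (Vecₚ.lookup-replicate {n = n} w 0)) refl
  merge-outs (e ∷ es) χ₁ χ₂ χ₃ w = begin
    + 2 * + lookup (outs (e ∷ es) (merge χ₁ χ₂ χ₃)) w
      ≡⟨ cong (+ 2 *_) (lookup-inc (outs es (merge χ₁ χ₂ χ₃)) (source (merge χ₁ χ₂ χ₃) e) w) ⟩
    + 2 * (a + + lookup (outs es (merge χ₁ χ₂ χ₃)) w)
      ≡⟨ ℤₚ.*-distribˡ-+ (+ 2) a _ ⟩
    + 2 * a + + 2 * + lookup (outs es (merge χ₁ χ₂ χ₃)) w
      ≡⟨ cong (λ t → + 2 * a + t) (merge-outs es χ₁ χ₂ χ₃ w) ⟩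
    + 2 * a + ((o₁ + o₂) + excess (arcs (filter (disagree? χ₁ χ₂) es) χ₃) w)
      ≡⟨ lemma (+ 2 * a) (o₁ + o₂) _ ⟩
    (o₁ + o₂) + (+ 2 * a + excess (arcs (filter (disagree? χ₁ χ₂) es) χ₃) w)
      ≡⟨ cong (λ t → (o₁ + o₂) + t) (excess-filter es e χ₁ χ₂ χ₃ w) ⟩
    (o₁ + o₂) + ((b + c) + E)
      ≡⟨ lemma′ o₁ o₂ b c E ⟩
    ((b + o₁) + (c + o₂)) + E
      ≡⟨ cong (_+ E) (cong₂ _+_ (sym (lookup-inc (outs es χ₁) (source χ₁ e) w)) (sym (lookup-inc (outs es χ₂) (source χ₂ e) w))) ⟩
    (+ lookup (outs (e ∷ es) χ₁) w + + lookup (outs (e ∷ es) χ₂) w) + E ∎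
    where
    open ≡-Reasoning
    a = 𝟙 w (source (merge χ₁ χ₂ χ₃) e)
    b = 𝟙 w (source χ₁ e)
    c = 𝟙 w (source χ₂ e)
    o₁ = + lookup (outs es χ₁) w
    o₂ = + lookup (outs es χ₂) w
    E = excess (arcs (filter (disagree? χ₁ χ₂) (e ∷ es)) χ₃) w
    lemma : ∀ x y z → x + (y + z) ≡ y + (x + z)
    lemma = solve-∀
    lemma′ : ∀ a b c d e → (a + b) + ((c + d) + e) ≡ ((c + a) + (d + b)) + e
    lemma′ = solve-∀

  -- Passing between edge lists and graphs

  𝟚 : Bool → ℕ
  𝟚 b = if b then 1 else 0

  count≡sum : (p : Fin n → Bool) → count p ≡ sum (𝟚 ∘ p)
  count≡sum {zero}  p = refl
  count≡sum {suc n} p = cong (𝟚 (p zero) ℕ.+_) (count≡sum (p ∘ suc))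

  sum-0 : ∀ {f : Fin n → ℕ} → (∀ i → f i ≡ 0) → sum f ≡ 0
  sum-0 {n} eq = trans (sum-cong-≗ eq) (sum-replicate-zero n)

  sum-pick : ∀ (v : Fin n) (f : Fin n → ℕ) → sum (λ i → if does (i Finₚ.≟ v) then f i else 0) ≡ f v
  sum-pick {suc n} zero    f = trans (cong (f zero ℕ.+_) (sum-0 {n} (λ _ → refl))) (ℕₚ.+-identityʳ _)
  sum-pick {suc n} (suc v) f = sum-pick v (f ∘ suc)

  Σe : {A : Set} → List A → (A → ℕ) → ℕ
  Σe []       f = 0
  Σe (x ∷ xs) f = f x ℕ.+ Σe xs f

  Σe-++ : ∀ {A : Set} (xs ys : List A) f → Σe (xs ++ ys) f ≡ Σe xs f ℕ.+ Σe ys f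
  Σe-++ []       ys f = refl
  Σe-++ (x ∷ xs) ys f = trans (cong (f x ℕ.+_) (Σe-++ xs ys f)) (sym (ℕₚ.+-assoc (f x) _ _))

  Σe-map : ∀ {A B : Set} (g : A → B) (xs : List A) f → Σe (map g xs) f ≡ Σe xs (f ∘ g)
  Σe-map g []       f = refl
  Σe-map g (x ∷ xs) f = cong (f (g x) ℕ.+_) (Σe-map g xs f)

  Σe-tabulate : ∀ {A : Set} (g : Fin n → A) f → Σe (List.tabulate g) f ≡ sum (f ∘ g)
  Σe-tabulate {zero}  g f = refl
  Σe-tabulate {suc n} g f = cong (f (g zero) ℕ.+_) (Σe-tabulate (g ∘ suc) f)

  Σe-filter : ∀ {A : Set} {P : A → Set} (P? : ∀ x → Dec (P x)) (xs : List A) f →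
              Σe (filter P? xs) f ≡ Σe xs (λ x → if does (P? x) then f x else 0)
  Σe-filter P? []       f = refl
  Σe-filter P? (x ∷ xs) f with does (P? x)
  ... | true  = cong (f x ℕ.+_) (Σe-filter P? xs f)
  ... | false = Σe-filter P? xs f

  Σe-cartesian : ∀ {A B : Set} (xs : List A) (ys : List B) f →
                 Σe (cartesianProduct xs ys) f ≡ Σe xs (λ x → Σe ys (λ y → f (x , y)))
  Σe-cartesian []       ys f = refl
  Σe-cartesian (x ∷ xs) ys f = trans (Σe-++ (map (x ,_) ys) _ f) (cong₂ ℕ._+_ (Σe-map (x ,_) ys f) (Σe-cartesian xs ys f))

  true≢false : ∀ {b} → b ≡ false → b ≢ true
  true≢false refl ()

  xor-not : ∀ b → (b xor not b) ≡ true
  xor-not true  = refl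
  xor-not false = refl

  not-xor : ∀ b → (not b xor b) ≡ true
  not-xor true  = refl
  not-xor false = refl

  module _ {n} (G : Graph n) where

    Edge : Fin n × Fin n → Set
    Edge (i , j) = i Fin.< j × adj G i j ≡ true

    edge? : ∀ e → Dec (Edge e)
    edge? (i , j) = (i Finₚ.<? j) ×-dec (adj G i j Boolₚ.≟ true)

    edges : Edges n
    edges = filter edge? (cartesianProduct (allFin n) (allFin n))

    edges-unique : Unique edges
    edges-unique = Uniqₚ.filter⁺ edge? (Uniqₚ.cartesianProduct⁺ (Uniqₚ.allFin⁺ n) (Uniqₚ.allFin⁺ n))

    edges-loopless : All (λ (u , v) → u ≢ v) edges
    edges-loopless = All.map (λ { (i<j , _) refl → Finₚ.<-irrefl refl i<j }) (Allₚ.all-filter edge? (cartesianProduct (allFin n) (allFin n)))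

    Σ-edges : ∀ f → Σe edges f ≡ sum (λ i → sum (λ j → if does (edge? (i , j)) then f (i , j) else 0))
    Σ-edges f = trans (Σe-filter edge? (cartesianProduct (allFin n) (allFin n)) f) (trans (Σe-cartesian (allFin n) (allFin n) _)
      (trans (Σe-tabulate (λ i → i) (λ i → Σe (allFin n) (λ j → if does (edge? (i , j)) then f (i , j) else 0)))
        (sum-cong-≗ (λ i → Σe-tabulate (λ j → j) (λ j → if does (edge? (i , j)) then f (i , j) else 0)))))

    Σ-ends : ∀ (a b : Fin n × Fin n → ℕ) w →
      Σe edges (λ (i , j) → (if does (i Finₚ.≟ w) then a (i , j) else 0) ℕ.+ (if does (j Finₚ.≟ w) then b (i , j) else 0)) ≡
      sum (λ x → (if does (edge? (w , x)) then a (w , x) else 0) ℕ.+ (if does (edge? (x , w)) then b (x , w) else 0))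
    Σ-ends a b w = begin
      Σe edges (λ (i , j) → ends i j)
        ≡⟨ Σ-edges (λ (i , j) → ends i j) ⟩
      sum (λ i → sum (λ j → if does (edge? (i , j)) then ends i j else 0))
        ≡⟨ sum-cong-≗ (λ i → trans (sum-cong-≗ (λ j → split (does (edge? (i , j))) (does (i Finₚ.≟ w)) (does (j Finₚ.≟ w)))) (∑-distrib-+ (A i) (B i))) ⟩
      sum (λ i → sum (A i) ℕ.+ sum (B i))
        ≡⟨ ∑-distrib-+ (sum ∘ A) (sum ∘ B) ⟩
      sum (λ i → sum (A i)) ℕ.+ sum (λ i → sum (B i))
        ≡⟨ cong₂ ℕ._+_ (trans (sum-cong-≗ row) (sum-pick w (λ i → sum (λ j → if does (edge? (i , j)) then a (i , j) else 0))))
                      (sum-cong-≗ (λ i → sum-pick w (λ j → if does (edge? (i , j)) then b (i , j) else 0))) ⟩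
      sum (λ x → if does (edge? (w , x)) then a (w , x) else 0) ℕ.+ sum (λ x → if does (edge? (x , w)) then b (x , w) else 0)
        ≡⟨ sym (∑-distrib-+ (λ x → if does (edge? (w , x)) then a (w , x) else 0) (λ x → if does (edge? (x , w)) then b (x , w) else 0)) ⟩
      sum (λ x → (if does (edge? (w , x)) then a (w , x) else 0) ℕ.+ (if does (edge? (x , w)) then b (x , w) else 0)) ∎
      where
      open ≡-Reasoning
      ends : Fin n → Fin n → ℕ
      ends i j = (if does (i Finₚ.≟ w) then a (i , j) else 0) ℕ.+ (if does (j Finₚ.≟ w) then b (i , j) else 0)
      A B : Fin n → Fin n → ℕ
      A i j = if does (i Finₚ.≟ w) then (if does (edge? (i , j)) then a (i , j) else 0) else 0
      B i j = if does (j Finₚ.≟ w) then (if does (edge? (i , j)) then b (i , j) else 0) else 0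
      split : ∀ c p q {x y} → (if c then (if p then x else 0) ℕ.+ (if q then y else 0) else 0) ≡
              (if p then (if c then x else 0) else 0) ℕ.+ (if q then (if c then y else 0) else 0)
      split true  p     q     = refl
      split false true  true  = refl
      split false true  false = refl
      split false false true  = refl
      split false false false = refl
      row : ∀ i → sum (A i) ≡ (if does (i Finₚ.≟ w) then sum (λ j → if does (edge? (i , j)) then a (i , j) else 0) else 0)
      row i with does (i Finₚ.≟ w)
      ... | true  = refl
      ... | false = sum-0 {n} (λ _ → refl)

    lookup-incₙ : ∀ (k : Vec ℕ n) u w → lookup (inc u k) w ≡ (if does (u Finₚ.≟ w) then 1 else 0) ℕ.+ lookup k w
    lookup-incₙ k u w with u Finₚ.≟ w
    ... | yes refl = Vecₚ.lookup∘updateAt u k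
    ... | no  u≢w  = Vecₚ.lookup∘updateAt′ w u (u≢w ∘ sym) k

    lookup-degrees : ∀ (es : Edges n) w → lookup (degrees es) w ≡
      Σe es (λ (i , j) → (if does (i Finₚ.≟ w) then 1 else 0) ℕ.+ (if does (j Finₚ.≟ w) then 1 else 0))
    lookup-degrees []             w = Vecₚ.lookup-replicate w 0
    lookup-degrees ((u , v) ∷ es) w = trans (lookup-incₙ (inc v (degrees es)) u w) (trans (cong ((if does (u Finₚ.≟ w) then 1 else 0) ℕ.+_)
      (trans (lookup-incₙ (degrees es) v w) (cong ((if does (v Finₚ.≟ w) then 1 else 0) ℕ.+_) (lookup-degrees es w)))) (sym (ℕₚ.+-assoc (if does (u Finₚ.≟ w) then 1 else 0) _ _)))

    lookup-outs : ∀ (es : Edges n) χ w → lookup (outs es χ) w ≡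
      Σe es (λ (i , j) → (if does (i Finₚ.≟ w) then 𝟚 (χ i j) else 0) ℕ.+ (if does (j Finₚ.≟ w) then 𝟚 (not (χ i j)) else 0))
    lookup-outs []             χ w = Vecₚ.lookup-replicate w 0
    lookup-outs ((u , v) ∷ es) χ w = trans (lookup-incₙ (outs es χ) (source χ (u , v)) w) (cong₂ ℕ._+_ end (lookup-outs es χ w))
      where
      zeroʳ : ∀ b → b ≡ b ℕ.+ 0
      zeroʳ b = sym (ℕₚ.+-identityʳ b)
      none : ∀ b → (if b then 0 else 0) ≡ 0
      none true  = refl
      none false = refl
      end : (if does (source χ (u , v) Finₚ.≟ w) then 1 else 0) ≡
            (if does (u Finₚ.≟ w) then 𝟚 (χ u v) else 0) ℕ.+ (if does (v Finₚ.≟ w) then 𝟚 (not (χ u v)) else 0)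
      end with χ u v
      ... | true  = trans (zeroʳ _) (cong (_ ℕ.+_) (sym (none (does (v Finₚ.≟ w)))))
      ... | false = cong (ℕ._+ _) (sym (none (does (u Finₚ.≟ w))))

    edge-yes : ∀ {i j} → i Fin.< j → adj G i j ≡ true → does (edge? (i , j)) ≡ true
    edge-yes {i} {j} i<j e = dec-true (edge? (i , j)) (i<j , e)

    edge-no : ∀ {i j} → ¬ (i Fin.< j × adj G i j ≡ true) → does (edge? (i , j)) ≡ false
    edge-no {i} {j} ne = dec-false (edge? (i , j)) ne

    -- Only the values of `χ` at pairs in increasing order are read, as in `edges`; the opposite
    -- pair takes the complement, so every `χ` yields an orientation.
    arc-from : Direction n → Fin n → Fin n → Bool
    arc-from χ u v = adj G u v ∧ (if does (u Finₚ.<? v) then χ u v else not (χ v u))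

    split-ends : ∀ w x a b → (if does (edge? (w , x)) then a else 0) ℕ.+ (if does (edge? (x , w)) then b else 0)
                 ≡ (if adj G w x then (if does (w Finₚ.<? x) then a else b) else 0)
    split-ends w x a b = go (adj G w x) refl (Finₚ.<-cmp w x)
      where
      by : ∀ {p q r s} → does (edge? (w , x)) ≡ p → does (edge? (x , w)) ≡ q → adj G w x ≡ r → does (w Finₚ.<? x) ≡ s →
           (if p then a else 0) ℕ.+ (if q then b else 0) ≡ (if r then (if s then a else b) else 0) →
           (if does (edge? (w , x)) then a else 0) ℕ.+ (if does (edge? (x , w)) then b else 0)
           ≡ (if adj G w x then (if does (w Finₚ.<? x) then a else b) else 0)
      by refl refl refl refl eq = eq
      go : ∀ c → adj G w x ≡ c → Tri (w Fin.< x) (w ≡ x) (x Fin.< w) →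
           (if does (edge? (w , x)) then a else 0) ℕ.+ (if does (edge? (x , w)) then b else 0)
           ≡ (if adj G w x then (if does (w Finₚ.<? x) then a else b) else 0)
      go false wx _ = by (edge-no (true≢false wx ∘ proj₂)) (edge-no (true≢false (trans (Graph.sym G x w) wx) ∘ proj₂)) wx refl refl
      go true wx (tri< w<x _ x≮w) = by (edge-yes w<x wx) (edge-no (x≮w ∘ proj₁)) wx (dec-true (w Finₚ.<? x) w<x) (ℕₚ.+-identityʳ _)
      go true wx (tri≈ _ refl _)  = contradiction wx (true≢false (irrefl G w))
      go true wx (tri> w≮x _ x<w) = by (edge-no (w≮x ∘ proj₁)) (edge-yes x<w (trans (Graph.sym G x w) wx)) wx (dec-false (w Finₚ.<? x) w≮x) refl

    arc-split : ∀ χ w x → (if does (edge? (w , x)) then 𝟚 (χ w x) else 0) ℕ.+ (if does (edge? (x , w)) then 𝟚 (not (χ x w)) else 0)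
                ≡ 𝟚 (arc-from χ w x)
    arc-split χ w x = trans (split-ends w x (𝟚 (χ w x)) (𝟚 (not (χ x w)))) (distribute (adj G w x) (does (w Finₚ.<? x)))
      where
      distribute : ∀ a b {c d} → (if a then (if b then 𝟚 c else 𝟚 d) else 0) ≡ 𝟚 (a ∧ (if b then c else d))
      distribute true  true  = refl
      distribute true  false = refl
      distribute false b     = refl

    adj-split : ∀ w x → (if does (edge? (w , x)) then 1 else 0) ℕ.+ (if does (edge? (x , w)) then 1 else 0) ≡ 𝟚 (adj G w x)
    adj-split w x = trans (split-ends w x 1 1) (cong (if adj G w x then_else 0) (Boolₚ.if-eta (does (w Finₚ.<? x))))

    degrees-edges : ∀ w → lookup (degrees edges) w ≡ deg G w
    degrees-edges w = trans (lookup-degrees edges w) (trans (Σ-ends (const 1) (const 1) w)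
      (trans (sum-cong-≗ (adj-split w)) (sym (count≡sum (adj G w)))))

    outs-edges : ∀ χ w → lookup (outs edges χ) w ≡ count (arc-from χ w)
    outs-edges χ w = trans (lookup-outs edges χ w) (trans (Σ-ends (λ (i , j) → 𝟚 (χ i j)) (λ (i , j) → 𝟚 (not (χ i j))) w)
      (trans (sum-cong-≗ (arc-split χ w)) (sym (count≡sum (arc-from χ w)))))

    orientation-from : Direction n → Orientation G
    orientation-from χ = record
      { arc      = arc-from χ
      ; arc⊆adj  = λ u v → ∧-left (adj G u v)
      ; oriented = opposite
      }
      where
      ∧-left : ∀ a {b} → a ∧ b ≡ true → a ≡ true
      ∧-left true eq = refl
      opposite : ∀ u v → adj G u v ≡ true → (arc-from χ u v xor arc-from χ v u) ≡ true
      opposite u v uv = go (Finₚ.<-cmp u v)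
        where
        by : ∀ {p q} → does (u Finₚ.<? v) ≡ p → does (v Finₚ.<? u) ≡ q →
             ((if p then χ u v else not (χ v u)) xor (if q then χ v u else not (χ u v))) ≡ true →
             (arc-from χ u v xor arc-from χ v u) ≡ true
        by refl refl eq = trans (cong₂ (λ a b → (a ∧ _) xor (b ∧ _)) uv (trans (Graph.sym G v u) uv)) eq
        go : Tri (u Fin.< v) (u ≡ v) (v Fin.< u) → (arc-from χ u v xor arc-from χ v u) ≡ true
        go (tri< u<v _ v≮u) = by (dec-true (u Finₚ.<? v) u<v) (dec-false (v Finₚ.<? u) v≮u) (xor-not (χ u v))
        go (tri≈ _ refl _)  = contradiction uv (true≢false (irrefl G u))
        go (tri> u≮v _ v<u) = by (dec-false (u Finₚ.<? v) u≮v) (dec-true (v Finₚ.<? u) v<u) (not-xor (χ v u))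

  sum-degrees : (es : Edges n) → sum (lookup (degrees es)) ≡ length (es ++ es)
  sum-degrees es = trans (go es) (sym (Listₚ.length-++ es))
    where
    sum-inc : ∀ {n} (u : Fin n) (k : Vec ℕ n) → sum (lookup (inc u k)) ≡ suc (sum (lookup k))
    sum-inc zero    (x Vec.∷ k) = refl
    sum-inc (suc u) (x Vec.∷ k) = trans (cong (x ℕ.+_) (sum-inc u k)) (ℕₚ.+-suc x _)
    sum-0⃗ : ∀ n → sum (lookup (0⃗ {n})) ≡ 0
    sum-0⃗ n = sum-0 {n} (λ i → Vecₚ.lookup-replicate i 0)
    go : ∀ {n} (es : Edges n) → sum (lookup (degrees es)) ≡ length es ℕ.+ length es
    go {n} []             = sum-0⃗ n
    go     ((u , v) ∷ es) = trans (sum-inc u (inc v (degrees es))) (cong suc (trans (sum-inc v (degrees es)) (trans (cong suc (go es)) (sym (ℕₚ.+-suc (length es) _)))))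

  -- Excluded values for sums of two orientations

  poly : List ℤ → ℕ → ℤ
  poly []       k = 1ℤ
  poly (a ∷ as) k = (+ k + a) * poly as k

  poly-degree : ∀ as → ∃ λ c → c ≢ 0ℤ × HasDegree (length as) c (poly as)
  poly-degree []       = 1ℤ , (λ ()) , (λ _ → refl)
  poly-degree (a ∷ as) with poly-degree as
  ... | c , c≢0 , hd = + suc (length as) * c , ≢0 , linear-factor (length as) c (poly as) a hd
    where
    ≢0 : + suc (length as) * c ≢ 0ℤ
    ≢0 eq with ℤₚ.i*j≡0⇒i≡0∨j≡0 (+ suc (length as)) eq
    ... | inj₂ c≡0 = c≢0 c≡0

  poly≢0 : ∀ {as a k} → poly as k ≢ 0ℤ → a ∈ as → + k + a ≢ 0ℤ
  poly≢0 {a ∷ as} {k = k} ne (here refl) eq = ne (trans (cong (_* poly as k) eq) (ℤₚ.*-zeroˡ (poly as k)))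
  poly≢0 {b ∷ as} {k = k} ne (there a∈)  eq = poly≢0 {as} (λ z → ne (trans (cong ((+ k + b) *_) z) (ℤₚ.*-zeroʳ (+ k + b)))) a∈ eq

  -- The excluded values become linear factors at each vertex. The degrees add up to 2|E|, the
  -- length of the doubled edge list, so `alt-leading` gives the nonzero central coefficient times
  -- nonzero constants. A nonvanishing choice on the first copy of the edges, followed by one on the
  -- second, yields the two orientations.
  two-orientations : ∀ (G : Graph n) (as : Fin n → List ℤ) → (∀ v → length (as v) ≤ deg G v) →
    ∃ λ χ₁ → ∃ λ χ₂ → ∀ v a → a ∈ as v →
      + (lookup (outs (edges G) χ₁) v ℕ.+ lookup (outs (edges G) χ₂) v) + a ≢ 0ℤ
  two-orientations {n} G as short = χ₁ , χ₂ , λ v a a∈ → poly≢0 {as⁺ v} (factor v) (∈ₚ.∈-++⁺ˡ a∈)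
    where
    es : Edges n
    es = edges G
    -- Extra factors with root 0 raise the degree at `v` to exactly `deg G v`, the exponent in the
    -- coefficient known to be nonzero; they only exclude more.
    pad : Fin n → ℕ
    pad v = deg G v ℕ.∸ length (as v)
    as⁺ : Fin n → List ℤ
    as⁺ v = as v ++ List.replicate (pad v) 0ℤ
    length⁺ : ∀ v → length (as⁺ v) ≡ lookup (degrees es) v
    length⁺ v = trans (Listₚ.length-++ (as v)) (trans (cong (length (as v) ℕ.+_) (Listₚ.length-replicate (pad v)))
                  (trans (ℕₚ.m+[n∸m]≡n (short v)) (sym (degrees-edges G v))))
    c : Fin n → ℤ
    c v = proj₁ (poly-degree (as⁺ v))
    degree : ∀ v → HasDegree (lookup (degrees es) v) (c v) (poly (as⁺ v))
    degree v = subst (λ d → HasDegree d (c v) (poly (as⁺ v))) (length⁺ v) (proj₂ (proj₂ (poly-degree (as⁺ v))))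
    alt≢0 : alt (es ++ es) ⟦ poly ∘ as⁺ ⟧ ≢ 0ℤ
    alt≢0 eq with ℤₚ.i*j≡0⇒i≡0∨j≡0 (alt (es ++ es) ⟦ δ ∘ lookup (degrees es) ⟧)
                    (trans (sym (alt-leading (es ++ es) (lookup (degrees es)) c (poly ∘ as⁺) (sum-degrees es) degree)) eq)
    ... | inj₁ e = alt-doubled≢0 es (edges-loopless G) e
    ... | inj₂ e = ∏≢0 c (λ v → proj₁ (proj₂ (poly-degree (as⁺ v)))) e
    first = alt≢0⇒orientation es (λ k → alt es (λ l → ⟦ poly ∘ as⁺ ⟧ (k ⊕ l))) (edges-unique G)
              (λ z → alt≢0 (trans (alt-++ es es _) z))
    χ₁ = proj₁ first
    second = alt≢0⇒orientation es (λ l → ⟦ poly ∘ as⁺ ⟧ (outs es χ₁ ⊕ l)) (edges-unique G) (proj₂ first)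
    χ₂ = proj₁ second
    factor : ∀ v → poly (as⁺ v) (lookup (outs es χ₁) v ℕ.+ lookup (outs es χ₂) v) ≢ 0ℤ
    factor v z = proj₂ second (⟦⟧-zero (poly ∘ as⁺) v (outs es χ₁ ⊕ outs es χ₂)
      (trans (cong (poly (as⁺ v)) (Vecₚ.lookup-zipWith ℕ._+_ v (outs es χ₁) (outs es χ₂))) z))

  -- The values n of a sum of two orientations for which ⌈n / 2⌉ + p ∈ F, as roots of linear factors.
  forbidden : ℕ → List ℕ → List ℤ
  forbidden p F = map (λ f → + 2 * + p - + 2 * + f) F ++ map (λ f → 1ℤ + (+ 2 * + p - + 2 * + f)) F

  length-forbidden : ∀ p F → length (forbidden p F) ≡ 2 ℕ.* length F
  length-forbidden p F = trans (Listₚ.length-++ (map (λ f → + 2 * + p - + 2 * + f) F))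
    (cong₂ ℕ._+_ (Listₚ.length-map _ F) (trans (Listₚ.length-map _ F) (sym (ℕₚ.+-identityʳ (length F)))))

  ∣i∣≤1 : ∀ i → ∣ i ∣ ≤ 1 → i ≡ 0ℤ ⊎ i ≡ 1ℤ ⊎ i ≡ - 1ℤ
  ∣i∣≤1 (+ 0)           _ = inj₁ refl
  ∣i∣≤1 (+ 1)           _ = inj₂ (inj₁ refl)
  ∣i∣≤1 ℤ.-[1+ 0 ]      _ = inj₂ (inj₂ refl)
  ∣i∣≤1 (+ suc (suc _)) (s≤s ())
  ∣i∣≤1 ℤ.-[1+ suc _ ]  (s≤s ())

  -- Whichever way half of n is rounded, the rounded value y or y + 1 is ⌈n / 2⌉.
  rounding : ∀ n y p F ε → ∣ ε ∣ ≤ 1 → + 2 * + y ≡ + n + ε → y ℕ.+ p ∈ F → suc (y ℕ.+ p) ∈ F →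
             ∃ λ a → a ∈ forbidden p F × + n + a ≡ 0ℤ
  rounding n y p F ε small eq y∈ y+1∈ with ∣i∣≤1 ε small
  ... | inj₁ refl = _ , ∈ₚ.∈-++⁺ˡ (∈ₚ.∈-map⁺ _ y∈) , trans (lemma (+ n) (+ y) (+ p)) (ℤₚ.i≡j⇒i-j≡0 (sym eq))
    where
    lemma : ∀ n y p → n + (+ 2 * p - + 2 * (y + p)) ≡ (n + 0ℤ) - + 2 * y
    lemma = solve-∀
  ... | inj₂ (inj₁ refl) = _ , ∈ₚ.∈-++⁺ʳ _ (∈ₚ.∈-map⁺ _ y∈) , trans (lemma (+ n) (+ y) (+ p)) (ℤₚ.i≡j⇒i-j≡0 (sym eq))
    where
    lemma : ∀ n y p → n + (1ℤ + (+ 2 * p - + 2 * (y + p))) ≡ (n + 1ℤ) - + 2 * y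
    lemma = solve-∀
  ... | inj₂ (inj₂ refl) = _ , ∈ₚ.∈-++⁺ʳ _ (∈ₚ.∈-map⁺ _ y+1∈) , trans (lemma (+ n) (+ y) (+ p)) (ℤₚ.i≡j⇒i-j≡0 (sym eq))
    where
    lemma : ∀ n y p → n + (1ℤ + (+ 2 * p - + 2 * (1ℤ + (y + p)))) ≡ (n + - 1ℤ) - + 2 * y
    lemma = solve-∀

  -- Each forbidden value gives two roots, whence the factor 2. The offset `p` allows for out-edges
  -- that are added later in a known number. At least one of two consecutive totals is allowed, and
  -- one optional out-edge will select it.
  coarse-orientation : ∀ (G : Graph n) (p : Fin n → ℕ) (F : Fin n → List ℕ) → (∀ v → 2 ℕ.* length (F v) ≤ deg G v) →
    ∃ λ (D : Orientation G) → ∀ v → ¬ (outdeg D v ℕ.+ p v ∈ F v × suc (outdeg D v ℕ.+ p v) ∈ F v)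
  coarse-orientation {n} G p F short
    with two-orientations G (λ v → forbidden (p v) (F v)) (λ v → subst (_≤ deg G v) (sym (length-forbidden (p v) (F v))) (short v))
  ... | χ₁ , χ₂ , nonzero
    with balanced-direction (filter (disagree? χ₁ χ₂) (edges G)) (Uniqₚ.filter⁺ (disagree? χ₁ χ₂) (edges-unique G))
  ... | χ₃ , balanced = orientation-from G (merge χ₁ χ₂ χ₃) , avoid
    where
    avoid : ∀ v → ¬ (count (arc-from G (merge χ₁ χ₂ χ₃) v) ℕ.+ p v ∈ F v × suc (count (arc-from G (merge χ₁ χ₂ χ₃) v) ℕ.+ p v) ∈ F v)
    avoid v (y∈ , y+1∈)
      with rounding (lookup (outs (edges G) χ₁) v ℕ.+ lookup (outs (edges G) χ₂) v) (count (arc-from G (merge χ₁ χ₂ χ₃) v)) (p v) (F v)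
             (excess (arcs (filter (disagree? χ₁ χ₂) (edges G)) χ₃) v) (balanced v)
             (subst (λ y → + 2 * + y ≡ (+ lookup (outs (edges G) χ₁) v + + lookup (outs (edges G) χ₂) v) + excess (arcs (filter (disagree? χ₁ χ₂) (edges G)) χ₃) v)
                    (outs-edges G (merge χ₁ χ₂ χ₃) v) (merge-outs (edges G) χ₁ χ₂ χ₃ v))
             y∈ y+1∈
    ... | a , a∈ , eq = nonzero v a a∈ eq

open Signed

open import Data.Nat.Base using (_+_; _*_; _^_; _∸_; _⊔_; _/_; _%_)
import Data.Nat.DivMod as DM
open import Data.Nat.Tactic.RingSolver using (solve-∀)

-- Counting and switches

infix 4 _⊆_
_⊆_ : (Fin n → Bool) → (Fin n → Bool) → Set
p ⊆ q = ∀ i → p i ≡ true → q i ≡ true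

𝟚-mono : ∀ {b c} → (b ≡ true → c ≡ true) → 𝟚 b ≤ 𝟚 c
𝟚-mono {false}     imp = z≤n
𝟚-mono {true}  {c} imp rewrite imp refl = s≤s z≤n

count-mono : ∀ {p q : Fin n → Bool} → p ⊆ q → count p ≤ count q
count-mono {zero}  imp = z≤n
count-mono {suc n} imp = ℕₚ.+-mono-≤ (𝟚-mono (imp zero)) (count-mono (imp ∘ suc))

count-cong : ∀ {p q : Fin n → Bool} → (∀ i → p i ≡ q i) → count p ≡ count q
count-cong {zero}  eq = refl
count-cong {suc n} eq = cong₂ _+_ (cong 𝟚 (eq zero)) (count-cong (eq ∘ suc))

count-strict : ∀ {p q : Fin n → Bool} v → p ⊆ q → p v ≡ false → q v ≡ true → count p < count q
count-strict {suc n} {p} {q} zero    imp pv qv rewrite pv | qv = s≤s (count-mono (imp ∘ suc))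
count-strict {suc n} {p} {q} (suc v) imp pv qv =
  subst (_≤ count q) (ℕₚ.+-suc (𝟚 (p zero)) _) (ℕₚ.+-mono-≤ (𝟚-mono (imp zero)) (count-strict v (imp ∘ suc) pv qv))

count-except : ∀ {p q : Fin n → Bool} v → (∀ i → i ≢ v → p i ≡ true → q i ≡ true) → count p ≤ suc (count q)
count-except {suc n} {p} {q} zero    imp =
  ℕₚ.+-mono-≤ {𝟚 (p zero)} {1} (𝟚≤1 (p zero)) (ℕₚ.≤-trans (count-mono (λ i → imp (suc i) (λ ()))) (ℕₚ.m≤n+m _ (𝟚 (q zero))))
  where
  𝟚≤1 : ∀ b → 𝟚 b ≤ 1
  𝟚≤1 true  = s≤s z≤n
  𝟚≤1 false = z≤n
count-except {suc n} {p} {q} (suc v) imp =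
  subst (count p ≤_) (ℕₚ.+-suc (𝟚 (q zero)) _)
    (ℕₚ.+-mono-≤ (𝟚-mono (imp zero (λ ()))) (count-except v (λ i i≢v → imp (suc i) (i≢v ∘ Finₚ.suc-injective))))

count-witness : ∀ {p q : Fin n → Bool} → count p < count q → ∃ λ i → q i ≡ true × p i ≡ false
count-witness {suc n} {p} {q} lt with p zero in p0 | q zero in q0
... | false | true  = zero , q0 , p0
... | true  | true  with count-witness (ℕₚ.≤-pred lt)
...   | i , qi , pi = suc i , qi , pi
count-witness {suc n} {p} {q} lt | false | false with count-witness lt
...   | i , qi , pi = suc i , qi , pi
count-witness {suc n} {p} {q} lt | true  | false with count-witness (ℕₚ.≤-trans (ℕₚ.n≤1+n _) lt)
...   | i , qi , pi = suc i , qi , pi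

sum-mono : ∀ {f g : Fin n → ℕ} → (∀ i → f i ≤ g i) → sum f ≤ sum g
sum-mono {zero}  le = z≤n
sum-mono {suc n} le = ℕₚ.+-mono-≤ (le zero) (sum-mono (le ∘ suc))

sum-strict : ∀ {f g : Fin n → ℕ} v → (∀ i → f i ≤ g i) → f v < g v → sum f < sum g
sum-strict {suc n} {f} {g} zero    le lt = ℕₚ.+-mono-≤ lt (sum-mono (le ∘ suc))
sum-strict {suc n} {f} {g} (suc v) le lt =
  subst (_≤ sum g) (ℕₚ.+-suc (f zero) _) (ℕₚ.+-mono-≤ (le zero) (sum-strict v (le ∘ suc) lt))

above : ℕ → List ℕ → ℕ
above m L = Σe L (λ x → 𝟚 (m ℕ.≤ᵇ x))

≤ᵇ-true : ∀ {m x} → m ≤ x → (m ℕ.≤ᵇ x) ≡ true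
≤ᵇ-true {m} {x} le = dec-true (m ℕₚ.≤? x) le

≤ᵇ-mono : ∀ {m m′ x} → m ≤ m′ → (m′ ℕ.≤ᵇ x) ≡ true → (m ℕ.≤ᵇ x) ≡ true
≤ᵇ-mono {m} {m′} {x} le eq = ≤ᵇ-true (ℕₚ.≤-trans le (ℕₚ.≤ᵇ⇒≤ m′ x (subst Bool.T (sym eq) _)))

above-mono : ∀ {m m′} L → m ≤ m′ → above m′ L ≤ above m L
above-mono []      le = z≤n
above-mono (x ∷ L) le = ℕₚ.+-mono-≤ (𝟚-mono (≤ᵇ-mono {x = x} le)) (above-mono L le)

above-strict : ∀ {m m′ L} → m < m′ → m ∈ L → above m′ L < above m L
above-strict {m} {m′} {x ∷ L} lt (here refl)
  rewrite dec-false (m′ ℕₚ.≤? m) (ℕₚ.<⇒≱ lt) | ≤ᵇ-true (ℕₚ.≤-refl {m}) = s≤s (above-mono L (ℕₚ.<⇒≤ lt))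
above-strict {m} {m′} {x ∷ L} lt (there m∈) =
  subst (_≤ above m (x ∷ L)) (ℕₚ.+-suc (𝟚 (m′ ℕ.≤ᵇ x)) _)
    (ℕₚ.+-mono-≤ (𝟚-mono (≤ᵇ-mono {x = x} (ℕₚ.<⇒≤ lt))) (above-strict lt m∈))

above≤length : ∀ m L → above m L ≤ length L
above≤length m []      = z≤n
above≤length m (x ∷ L) = ℕₚ.+-mono-≤ (𝟚-mono {m ℕ.≤ᵇ x} {true} (λ _ → refl)) (above≤length m L)

-- Switches (v , k) are shared by the counters s with k ≡ key v s. All switches start off; a counter with
-- a forbidden value turns on a switch that it owns. Counters never decrease, so each of them does this at
-- most once per forbidden value.
module Switches {n} (inc own : Fin n → Fin n → Bool) (key : Fin n → Fin n → Fin n) (fixed : Fin n → Fin n → Bool)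
  (L : Fin n → List ℕ) (own⊆inc : ∀ v → own v ⊆ inc v)
  (own-unique : ∀ v {s s′} → own v s ≡ true → own v s′ ≡ true → key v s ≡ key v s′ → s ≡ s′) where

  Setting : Set
  Setting = Fin n → Fin n → Bool

  counter : Setting → Fin n → ℕ
  counter sel s = count (λ v → if inc v s then sel v (key v s) else fixed v s)

  remaining free : Setting → Fin n → ℕ
  remaining sel s = above (counter sel s) (L s)
  free sel s = count (λ v → own v s ∧ not (sel v (key v s)))

  turn-on : Fin n → Fin n → Setting → Setting
  turn-on v k sel x y = sel x y ∨ (does (x Finₚ.≟ v) ∧ does (y Finₚ.≟ k))

  turn-on-⊆ : ∀ v k sel x → sel x ⊆ turn-on v k sel x
  turn-on-⊆ v k sel x y eq rewrite eq = refl

  turn-on-same : ∀ v k sel → turn-on v k sel v k ≡ true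
  turn-on-same v k sel rewrite dec-true (v Finₚ.≟ v) refl | dec-true (k Finₚ.≟ k) refl = Boolₚ.∨-zeroʳ (sel v k)

  turn-on-other : ∀ v k sel x y → ¬ (x ≡ v × y ≡ k) → turn-on v k sel x y ≡ sel x y
  turn-on-other v k sel x y ne with x Finₚ.≟ v | y Finₚ.≟ k
  ... | yes x≡v | yes y≡k = contradiction (x≡v , y≡k) ne
  ... | yes _   | no _    = Boolₚ.∨-identityʳ (sel x y)
  ... | no _    | _       = Boolₚ.∨-identityʳ (sel x y)

  counter-⊆ : ∀ sel v k s → (λ x → if inc x s then sel x (key x s) else fixed x s) ⊆
                            (λ x → if inc x s then turn-on v k sel x (key x s) else fixed x s)
  counter-⊆ sel v k s x eq with inc x s
  ... | true  = turn-on-⊆ v k sel x (key x s) eq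
  ... | false = eq

  settle : ∀ N sel → sum (remaining sel) < N → (∀ s → remaining sel s ≤ free sel s) → ∃ λ sel′ → ∀ s → counter sel′ s ∉ L s
  settle (suc N) sel (s≤s bound) inv with Finₚ.any? (λ s → counter sel s ∈? L s)
  ... | no  none    = sel , λ s s∈ → none (s , s∈)
  ... | yes (s , s∈) with count-witness {p = const false} {q = λ v → own v s ∧ not (sel v (key v s))}
                          (ℕₚ.<-≤-trans (subst (_< remaining sel s) (sym (count-false n)) (ℕₚ.≤-trans (s≤s z≤n) (above-strict (ℕₚ.n<1+n _) s∈))) (inv s))
    where
    count-false : ∀ n → count {n} (const false) ≡ 0
    count-false zero    = refl
    count-false (suc n) = count-false n
  ...   | v , free-v , _ = settle N sel′ (ℕₚ.<-≤-trans (sum-strict s remaining≤ remaining<) bound) inv′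
    where
    k = key v s
    sel′ = turn-on v k sel
    own-vs : own v s ≡ true
    own-vs = Boolₚ.∧-conicalˡ _ _ free-v
    off : sel v k ≡ false
    off = Boolₚ.not-injective (Boolₚ.∧-conicalʳ (own v s) _ free-v)
    remaining≤ : ∀ t → remaining sel′ t ≤ remaining sel t
    remaining≤ t = above-mono (L t) (count-mono (counter-⊆ sel v k t))
    increased : counter sel s < counter sel′ s
    increased = count-strict v (counter-⊆ sel v k s) (trans (cong (if_then sel v k else fixed v s) (own⊆inc v s own-vs)) off)
                  (trans (cong (if_then sel′ v k else fixed v s) (own⊆inc v s own-vs)) (turn-on-same v k sel))
    remaining< : remaining sel′ s < remaining sel s
    remaining< = above-strict increased s∈
    inv′ : ∀ t → remaining sel′ t ≤ free sel′ t
    inv′ t with t Finₚ.≟ s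
    ... | yes refl = ℕₚ.≤-pred (ℕₚ.≤-trans remaining< (ℕₚ.≤-trans (inv s)
                       (count-except v (λ x x≢v → subst (λ b → own x s ∧ not b ≡ true) (sym (turn-on-other v k sel x _ (x≢v ∘ proj₁)))))))
    ... | no  t≢s  = ℕₚ.≤-trans (remaining≤ t) (ℕₚ.≤-trans (inv t) (count-mono keeps))
      where
      keeps : (λ x → own x t ∧ not (sel x (key x t))) ⊆ (λ x → own x t ∧ not (sel′ x (key x t)))
      keeps x eq = subst (λ b → own x t ∧ not b ≡ true) (sym (turn-on-other v k sel x _
        (λ { (refl , kx) → t≢s (own-unique v (Boolₚ.∧-conicalˡ _ _ eq) own-vs kx) }))) eq

  switches : (∀ s → length (L s) ≤ count (λ v → own v s)) → ∃ λ sel → ∀ s → counter sel s ∉ L s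
  switches short = settle _ (λ _ _ → false) (ℕₚ.n<1+n _) (λ s → ℕₚ.≤-trans (above≤length (counter (λ _ _ → false) s) (L s))
    (subst (length (L s) ≤_) (count-cong (λ v → sym (Boolₚ.∧-identityʳ (own v s)))) (short s)))

between : ∀ {p q : Fin n → Bool} m → p ⊆ q → count p ≤ m → m ≤ count q → ∃ λ r → p ⊆ r × r ⊆ q × count r ≡ m
between {zero}  m imp p≤m z≤n = (λ ()) , (λ ()) , (λ ()) , refl
between {suc n} {p} {q} m imp p≤m m≤q with p zero in p0 | q zero in q0
... | true | false = contradiction (trans (sym q0) (imp zero p0)) λ ()
between {suc n} {p} {q} (suc m) imp (s≤s p≤m) (s≤s m≤q) | true | true with between m (imp ∘ suc) p≤m m≤q
... | r , p⊆r , r⊆q , eq = (λ { zero → true ; (suc i) → r i }) , (λ { zero _ → refl ; (suc i) → p⊆r i }) ,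
                           (λ { zero _ → q0 ; (suc i) → r⊆q i }) , cong suc eq
between {suc n} {p} {q} m imp p≤m m≤q | false | false with between m (imp ∘ suc) p≤m m≤q
... | r , p⊆r , r⊆q , eq = (λ { zero → false ; (suc i) → r i }) , (λ { zero e → contradiction (trans (sym p0) e) (λ ()) ; (suc i) → p⊆r i }) ,
                           (λ { zero () ; (suc i) → r⊆q i }) , eq
between {suc n} {p} {q} m imp p≤m m≤q | false | true with m ℕₚ.≤? count (q ∘ suc)
... | yes le with between m (imp ∘ suc) p≤m le
...   | r , p⊆r , r⊆q , eq = (λ { zero → false ; (suc i) → r i }) , (λ { zero e → contradiction (trans (sym p0) e) (λ ()) ; (suc i) → p⊆r i }) ,
                             (λ { zero () ; (suc i) → r⊆q i }) , eq
between {suc n} {p} {q} m imp p≤m m≤q | false | true | no ¬le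
  with between (count (q ∘ suc)) (imp ∘ suc) (count-mono (imp ∘ suc)) ℕₚ.≤-refl
...   | r , p⊆r , r⊆q , eq = (λ { zero → true ; (suc i) → r i }) , (λ { zero _ → refl ; (suc i) → p⊆r i }) ,
                             (λ { zero _ → q0 ; (suc i) → r⊆q i }) , trans (cong suc eq) (ℕₚ.≤-antisym (ℕₚ.≰⇒> ¬le) m≤q)

Σe-cong-∈ : ∀ {A : Set} (xs : List A) {f g : A → ℕ} → (∀ {x} → x ∈ xs → f x ≡ g x) → Σe xs f ≡ Σe xs g
Σe-cong-∈ []       eq = refl
Σe-cong-∈ (x ∷ xs) eq = cong₂ _+_ (eq (here refl)) (Σe-cong-∈ xs (eq ∘ there))

-- One involution serves both lists, so that the partner can be found from either end of a pair;
-- `reindex` moves sums across it.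
record Matching (as bs : List (Fin n)) : Set where
  field
    mate      : Fin n → Fin n
    mate-as   : ∀ {x} → x ∈ as → mate x ∈ bs × mate (mate x) ≡ x
    mate-bs   : ∀ {x} → x ∈ bs → mate x ∈ as × mate (mate x) ≡ x
    reindex   : ∀ φ → Σe bs (φ ∘ mate) ≡ Σe as φ

matching : ∀ (as bs : List (Fin n)) → length as ≡ length bs → Unique as → Unique bs → (∀ {x} → x ∈ as → x ∉ bs) → Matching as bs
matching [] [] eq _ _ _ = record { mate = id ; mate-as = λ () ; mate-bs = λ () ; reindex = λ _ → refl }
matching {n} (a ∷ as) (b ∷ bs) eq (a∉ ∷ ua) (b∉ ∷ ub) disj = record
  { mate    = mate
  ; mate-as = λ { (here refl) → subst (_∈ b ∷ bs) (sym at-a) (here refl) , trans (cong mate at-a) at-b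
                ; (there x∈)  → let y∈ , back = M.mate-as x∈ in
                                subst (_∈ b ∷ bs) (sym (on-as x∈)) (there y∈) , trans (cong mate (on-as x∈)) (trans (on-bs y∈) back) }
  ; mate-bs = λ { (here refl) → subst (_∈ a ∷ as) (sym at-b) (here refl) , trans (cong mate at-b) at-a
                ; (there x∈)  → let y∈ , back = M.mate-bs x∈ in
                                subst (_∈ a ∷ as) (sym (on-bs x∈)) (there y∈) , trans (cong mate (on-bs x∈)) (trans (on-as y∈) back) }
  ; reindex = λ φ → cong₂ _+_ (cong φ at-b) (trans (Σe-cong-∈ bs (λ x∈ → cong φ (on-bs x∈))) (M.reindex φ))
  }
  where
  module M = Matching (matching as bs (ℕₚ.suc-injective eq) ua ub (λ x∈ y∈ → disj (there x∈) (there y∈)))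
  mate : Fin n → Fin n
  mate x = if does (x Finₚ.≟ a) then b else if does (x Finₚ.≟ b) then a else M.mate x
  at-a : mate a ≡ b
  at-a rewrite dec-true (a Finₚ.≟ a) refl = refl
  a≢b : a ≢ b
  a≢b a≡b = disj (here refl) (here a≡b)
  at-b : mate b ≡ a
  at-b rewrite dec-false (b Finₚ.≟ a) (a≢b ∘ sym) | dec-true (b Finₚ.≟ b) refl = refl
  elsewhere : ∀ {x} → x ≢ a → x ≢ b → mate x ≡ M.mate x
  elsewhere {x} x≢a x≢b rewrite dec-false (x Finₚ.≟ a) x≢a | dec-false (x Finₚ.≟ b) x≢b = refl
  on-as : ∀ {x} → x ∈ as → mate x ≡ M.mate x
  on-as x∈ = elsewhere (λ { refl → All.lookup a∉ x∈ refl }) (λ { refl → disj (there x∈) (here refl) })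
  on-bs : ∀ {x} → x ∈ bs → mate x ≡ M.mate x
  on-bs x∈ = elsewhere (λ { refl → disj (here refl) (there x∈) }) (λ { refl → All.lookup b∉ x∈ refl })

-- Assembling the orientation from a reservoir

members : (Fin n → Bool) → List (Fin n)
members {n} p = filter (λ x → p x Boolₚ.≟ true) (allFin n)

does-≟-true : ∀ b → does (b Boolₚ.≟ true) ≡ b
does-≟-true true  = refl
does-≟-true false = refl

Σe-members : ∀ (p : Fin n → Bool) f → Σe (members p) f ≡ sum (λ x → if p x then f x else 0)
Σe-members {n} p f = trans (Σe-filter (λ x → p x Boolₚ.≟ true) (allFin n) f)
  (trans (Σe-tabulate (λ x → x) (λ x → if does (p x Boolₚ.≟ true) then f x else 0))
         (sum-cong-≗ (λ x → cong (if_then f x else 0) (does-≟-true (p x)))))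

length≡Σe : ∀ {A : Set} (xs : List A) → length xs ≡ Σe xs (const 1)
length≡Σe []       = refl
length≡Σe (x ∷ xs) = cong suc (length≡Σe xs)

length-members : ∀ (p : Fin n → Bool) → length (members p) ≡ count p
length-members p = trans (length≡Σe (members p)) (trans (Σe-members p (const 1)) (sym (count≡sum p)))

members-unique : ∀ (p : Fin n → Bool) → Unique (members p)
members-unique {n} p = Uniqₚ.filter⁺ (λ x → p x Boolₚ.≟ true) (Uniqₚ.allFin⁺ n)

∈-members : ∀ (p : Fin n → Bool) {x} → p x ≡ true → x ∈ members p
∈-members p {x} px = ∈ₚ.∈-filter⁺ (λ x → p x Boolₚ.≟ true) (∈ₚ.∈-allFin x) px

members-∈ : ∀ (p : Fin n → Bool) {x} → x ∈ members p → p x ≡ true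
members-∈ {n} p x∈ = proj₂ (∈ₚ.∈-filter⁻ (λ x → p x Boolₚ.≟ true) {xs = allFin n} x∈)

-- The edges from a vertex to α ∪ β are used in pairs {s , mate s}, exactly one of which is outgoing whatever
-- the switches are, and the edge to the spare neighbour is outgoing iff i is true.
record Gadget {n} (α⁻ α⁺ β⁻ β⁺ : Fin n → Bool) : Set where
  field
    α β    : Fin n → Bool
    mate   : Fin n → Fin n
    spare  : Fin n
    pairs  : ℕ
    α⁻⊆α   : α⁻ ⊆ α
    α⊆α⁺   : α ⊆ α⁺
    β⁻⊆β   : β⁻ ⊆ β
    β⊆β⁺   : β ⊆ β⁺
    α⁺-spare : α⁺ spare ≡ true
    mate-injective : ∀ {s t} → β s ≡ true → β t ≡ true → mate s ≡ mate t → s ≡ t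

  -- A pair is named by its end in `α`, so both of its ends consult the same switch.
  key : Fin n → Fin n
  key s = if α s then s else mate s

  out : (Fin n → Bool) → Bool → Fin n → Bool
  out sel i s = if α s then not (sel s) else (if β s then sel (mate s) else does (s Finₚ.≟ spare) ∧ i)

  field
    count-out : ∀ sel i → count (out sel i) ≡ pairs + 𝟚 i

-- Both obligatory sets are enlarged to the larger of their two sizes. The inequalities say that
-- this fits on each side, and strictness on the side of `α⁺` leaves a neighbour over to be the
-- spare one.
gadget : ∀ (α⁻ α⁺ β⁻ β⁺ : Fin n → Bool) → α⁻ ⊆ α⁺ → β⁻ ⊆ β⁺ → (∀ s → α⁺ s ≡ true → β⁺ s ≡ false) →
         count α⁻ < count α⁺ → count α⁻ < count β⁺ → count β⁻ < count α⁺ → count β⁻ < count β⁺ → Gadget α⁻ α⁺ β⁻ β⁺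
gadget {n} α⁻ α⁺ β⁻ β⁺ α⁻⊆α⁺ β⁻⊆β⁺ disj αα αβ βα ββ
  with between (count α⁻ ⊔ count β⁻) α⁻⊆α⁺ (ℕₚ.m≤m⊔n _ _) (ℕₚ.<⇒≤ (ℕₚ.⊔-pres-<m αα βα))
     | between (count α⁻ ⊔ count β⁻) β⁻⊆β⁺ (ℕₚ.m≤n⊔m (count α⁻) _) (ℕₚ.<⇒≤ (ℕₚ.⊔-pres-<m αβ ββ))
... | α , α⁻⊆α , α⊆α⁺ , count-α | β , β⁻⊆β , β⊆β⁺ , count-β
  with count-witness {p = α} {q = α⁺} (subst (_< count α⁺) (sym count-α) (ℕₚ.⊔-pres-<m αα βα))
... | spare , α⁺-spare , ¬α-spare = record
  { α = α ; β = β ; mate = M.mate ; spare = spare ; pairs = count α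
  ; α⁻⊆α = α⁻⊆α ; α⊆α⁺ = α⊆α⁺ ; β⁻⊆β = β⁻⊆β ; β⊆β⁺ = β⊆β⁺ ; α⁺-spare = α⁺-spare
  ; mate-injective = λ βs βt eq → trans (sym (proj₂ (M.mate-bs (∈-members β βs)))) (trans (cong M.mate eq) (proj₂ (M.mate-bs (∈-members β βt))))
  ; count-out = count-out
  }
  where
  β⇒¬α : ∀ s → β s ≡ true → α s ≡ false
  β⇒¬α s βs with α s in αs
  ... | false = refl
  ... | true  = trans (sym (β⊆β⁺ s βs)) (disj s (α⊆α⁺ s αs))
  module M = Matching (matching (members α) (members β)
    (trans (length-members α) (trans (trans count-α (sym count-β)) (sym (length-members β))))
    (members-unique α) (members-unique β)
    (λ {x} x∈α x∈β → case trans (sym (members-∈ α x∈α)) (β⇒¬α x (members-∈ β x∈β)) of λ ()))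
  out : (Fin n → Bool) → Bool → Fin n → Bool
  out sel i s = if α s then not (sel s) else (if β s then sel (M.mate s) else does (s Finₚ.≟ spare) ∧ i)
  ¬β-spare : β spare ≡ false
  ¬β-spare with β spare in eq
  ... | false = refl
  ... | true  = trans (sym (β⊆β⁺ spare eq)) (disj spare α⁺-spare)
  count-out : ∀ sel i → count (out sel i) ≡ count α + 𝟚 i
  count-out sel i = begin
    count (out sel i)
      ≡⟨ count≡sum (out sel i) ⟩
    sum (𝟚 ∘ out sel i)
      ≡⟨ sum-cong-≗ split ⟩
    sum (λ s → (a s + b s) + c s)
      ≡⟨ ∑-distrib-+ (λ s → a s + b s) c ⟩
    sum (λ s → a s + b s) + sum c
      ≡⟨ cong₂ _+_ (∑-distrib-+ a b) (sum-pick spare (λ _ → 𝟚 i)) ⟩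
    (sum a + sum b) + 𝟚 i
      ≡⟨ cong (λ t → (sum a + t) + 𝟚 i) (trans (sym (Σe-members β (𝟚 ∘ sel ∘ M.mate))) (trans (M.reindex (𝟚 ∘ sel)) (Σe-members α (𝟚 ∘ sel)))) ⟩
    (sum a + sum a′) + 𝟚 i
      ≡⟨ cong (_+ 𝟚 i) (trans (sym (∑-distrib-+ a a′)) (trans (sum-cong-≗ both) (sym (count≡sum α)))) ⟩
    count α + 𝟚 i ∎
    where
    open ≡-Reasoning
    a b c a′ : Fin n → ℕ
    a s = if α s then 𝟚 (not (sel s)) else 0
    a′ s = if α s then 𝟚 (sel s) else 0
    b s = if β s then 𝟚 (sel (M.mate s)) else 0
    c s = if does (s Finₚ.≟ spare) then 𝟚 i else 0
    both : ∀ s → a s + a′ s ≡ 𝟚 (α s)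
    both s with α s | sel s
    ... | true  | true  = refl
    ... | true  | false = refl
    ... | false | _     = refl
    split : ∀ s → 𝟚 (out sel i s) ≡ (a s + b s) + c s
    split s = go (α s) (β s) (s Finₚ.≟ spare) refl refl
      where
      pieces : Bool → Bool → Bool → ℕ
      pieces x y z = ((if x then 𝟚 (not (sel s)) else 0) + (if y then 𝟚 (sel (M.mate s)) else 0)) + (if z then 𝟚 i else 0)
      out′ : Bool → Bool → Bool → Bool
      out′ x y z = if x then not (sel s) else (if y then sel (M.mate s) else z ∧ i)
      go : ∀ x y (z : Dec (s ≡ spare)) → α s ≡ x → β s ≡ y → 𝟚 (out′ x y (does z)) ≡ pieces x y (does z)
      go x     y     (yes refl) αs βs with trans (sym αs) ¬α-spare | trans (sym βs) ¬β-spare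
      ... | refl | refl = refl
      go true  true  (no _)     αs βs = contradiction (trans (sym αs) (β⇒¬α s βs)) λ ()
      go true  false (no _)     αs βs = sym (trans (ℕₚ.+-identityʳ (𝟚 (not (sel s)) + 0)) (ℕₚ.+-identityʳ (𝟚 (not (sel s)))))
      go false true  (no _)     αs βs = sym (ℕₚ.+-identityʳ (𝟚 (sel (M.mate s))))
      go false false (no _)     αs βs = refl

∧-intro : ∀ {a b} → a ≡ true → b ≡ true → a ∧ b ≡ true
∧-intro refl refl = refl

∧-fst : ∀ {a b} → a ∧ b ≡ true → a ≡ true
∧-fst {a} {b} = Boolₚ.∧-conicalˡ a b

∧-snd : ∀ {a b} → a ∧ b ≡ true → b ≡ true
∧-snd {a} {b} = Boolₚ.∧-conicalʳ a b

not-true : ∀ {b} → not b ≡ true → b ≡ false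
not-true {false} _ = refl

outdeg+indeg : ∀ {G : Graph n} (D : Orientation G) v → outdeg D v + count (λ u → arc D u v) ≡ deg G v
outdeg+indeg {n} {G} D v = begin
  count (arc D v) + count (λ u → arc D u v)
    ≡⟨ cong₂ _+_ (count≡sum (arc D v)) (count≡sum (λ u → arc D u v)) ⟩
  sum (𝟚 ∘ arc D v) + sum (λ u → 𝟚 (arc D u v))
    ≡⟨ sym (∑-distrib-+ (𝟚 ∘ arc D v) (λ u → 𝟚 (arc D u v))) ⟩
  sum (λ u → 𝟚 (arc D v u) + 𝟚 (arc D u v))
    ≡⟨ sum-cong-≗ one ⟩
  sum (𝟚 ∘ adj G v)
    ≡⟨ sym (count≡sum (adj G v)) ⟩
  deg G v ∎
  where
  open ≡-Reasoning
  one : ∀ u → 𝟚 (arc D v u) + 𝟚 (arc D u v) ≡ 𝟚 (adj G v u)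
  one u with arc D v u in vu | arc D u v in uv | adj G v u in e
  ... | true  | true  | true  with trans (sym (cong₂ _xor_ vu uv)) (oriented D v u e)
  ...   | ()
  one u | true  | false | true  = refl
  one u | false | true  | true  = refl
  one u | false | false | false = refl
  one u | false | false | true  with trans (sym (cong₂ _xor_ vu uv)) (oriented D v u e)
  ...   | ()
  one u | true  | _     | false = contradiction (trans (sym e) (arc⊆adj D v u vu)) λ ()
  one u | false | true  | false = contradiction (trans (sym e) (trans (Graph.sym G v u) (arc⊆adj D u v uv))) λ ()

≟-true : ∀ {a b} → does (a Boolₚ.≟ b) ≡ true → a ≡ b
≟-true {true}  {true}  _ = refl
≟-true {false} {false} _ = refl

does-≟-sym : ∀ {K} (x y : Fin K) → does (x Finₚ.≟ y) ≡ does (y Finₚ.≟ x)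
does-≟-sym x y with x Finₚ.≟ y
... | yes refl = sym (dec-true (x Finₚ.≟ x) refl)
... | no  x≢y  = sym (dec-false (y Finₚ.≟ x) (x≢y ∘ sym))

-- S is the reservoir, split into two sides; the side of a vertex outside S says which side owns its pairs.
module Reservoir {n K : ℕ} (G : Graph n) (S side : Fin n → Bool) (κ : Fin n → Fin K) where

  rest : Fin n → Bool
  rest u = not (S u)

  differ same : Fin n → Fin n → Bool
  differ v u = not (does (κ u Finₚ.≟ κ v))
  same v u = does (side u Boolₚ.≟ side v)

  -- Reservoir neighbours in another group than `v` must be paired; those in the group of `v` are
  -- available for equalising the two sides. A choice made freely at each `v` might discard the same
  -- reservoir vertex everywhere, which a criterion on labels rules out.
  α⁺ β⁺ α⁻ β⁻ : Fin n → Fin n → Bool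
  α⁺ v u = adj G v u ∧ (S u ∧ side u)
  β⁺ v u = adj G v u ∧ (S u ∧ not (side u))
  α⁻ v u = α⁺ v u ∧ differ v u
  β⁻ v u = β⁺ v u ∧ differ v u

  H : Graph n
  H = record
    { adj    = λ u v → adj G u v ∧ (rest u ∧ rest v)
    ; sym    = λ u v → cong₂ _∧_ (Graph.sym G u v) (Boolₚ.∧-comm (rest u) (rest v))
    ; irrefl = λ v → cong (_∧ (rest v ∧ rest v)) (irrefl G v)
    }

  module Build
    (F : Fin n → List ℕ) (gadgets : ∀ v → Gadget (α⁻ v) (α⁺ v) (β⁻ v) (β⁺ v)) (DH : Orientation H)
    (coarse : ∀ v → S v ≡ false → ¬ (outdeg DH v + Gadget.pairs (gadgets v) ∈ F v × suc (outdeg DH v + Gadget.pairs (gadgets v)) ∈ F v))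
    (few-S : ∀ s → S s ≡ true → length (F s) ≤ count (λ v → adj G s v ∧ (rest v ∧ (same s v ∧ differ s v))))
    where

    module Gd v = Gadget (gadgets v)

    -- The spare edge leaves `v` precisely when the total without it is forbidden; by `coarse`, the
    -- next value is then allowed.
    bit : Fin n → Bool
    bit v = does ((outdeg DH v + Gd.pairs v) ∈? F v)

    Setting : Set
    Setting = Fin n → Fin n → Bool

    out : Setting → Fin n → Fin n → Bool
    out sel v = Gd.out v (sel v) (bit v)

    -- Edges inside the reservoir only shift the starting values of the counters, so any fixed rule
    -- will do for them; here it is the order of indices.
    dir : Setting → Fin n → Fin n → Bool
    dir sel u v = if S u then (if S v then does (u Finₚ.<? v) else not (out sel v u))
                         else (if S v then out sel u v else arc DH u v)

    full : Setting → Orientation G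
    full sel = record { arc = λ u v → adj G u v ∧ dir sel u v ; arc⊆adj = λ u v → ∧-fst ; oriented = opposite }
      where
      opposite : ∀ u v → adj G u v ≡ true → ((adj G u v ∧ dir sel u v) xor (adj G v u ∧ dir sel v u)) ≡ true
      opposite u v uv = trans (cong₂ (λ a b → (a ∧ dir sel u v) xor (b ∧ dir sel v u)) uv (trans (Graph.sym G v u) uv)) cases
        where
        cases : (dir sel u v xor dir sel v u) ≡ true
        cases with S u in Su | S v in Sv
        ... | true  | false = not-xor (out sel v u)
        ... | false | true  = xor-not (out sel u v)
        ... | false | false = oriented DH u v (∧-intro uv (∧-intro (cong not Su) (cong not Sv)))
        ... | true  | true  with Finₚ.<-cmp u v
        ...   | tri< u<v _ v≮u = cong₂ _xor_ (dec-true (u Finₚ.<? v) u<v) (dec-false (v Finₚ.<? u) v≮u)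
        ...   | tri≈ _ refl _  = contradiction uv (true≢false (irrefl G u))
        ...   | tri> u≮v _ v<u = cong₂ _xor_ (dec-false (u Finₚ.<? v) u≮v) (dec-true (v Finₚ.<? u) v<u)

    out⇒S : ∀ sel v u → out sel v u ≡ true → adj G v u ≡ true × S u ≡ true
    out⇒S sel v u e with Gd.α v u in αu | Gd.β v u in βu
    ... | true  | _    = ∧-fst (Gd.α⊆α⁺ v u αu) , ∧-fst (∧-snd {adj G v u} (Gd.α⊆α⁺ v u αu))
    ... | false | true = ∧-fst (Gd.β⊆β⁺ v u βu) , ∧-fst (∧-snd {adj G v u} (Gd.β⊆β⁺ v u βu))
    ... | false | false with u Finₚ.≟ Gd.spare v
    ...   | yes refl = ∧-fst (Gd.α⁺-spare v) , ∧-fst (∧-snd {adj G v u} (Gd.α⁺-spare v))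

    outdeg-rest : ∀ sel v → S v ≡ false → outdeg (full sel) v ≡ (outdeg DH v + Gd.pairs v) + 𝟚 (bit v)
    outdeg-rest sel v Sv = begin
      outdeg (full sel) v
        ≡⟨ count≡sum (arc (full sel) v) ⟩
      sum (𝟚 ∘ arc (full sel) v)
        ≡⟨ sum-cong-≗ split ⟩
      sum (λ u → 𝟚 (arc DH v u) + 𝟚 (out sel v u))
        ≡⟨ ∑-distrib-+ (𝟚 ∘ arc DH v) (𝟚 ∘ out sel v) ⟩
      sum (𝟚 ∘ arc DH v) + sum (𝟚 ∘ out sel v)
        ≡⟨ cong₂ _+_ (sym (count≡sum (arc DH v))) (trans (sym (count≡sum (out sel v))) (Gd.count-out v (sel v) (bit v))) ⟩
      outdeg DH v + (Gd.pairs v + 𝟚 (bit v))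
        ≡⟨ sym (ℕₚ.+-assoc (outdeg DH v) _ _) ⟩
      (outdeg DH v + Gd.pairs v) + 𝟚 (bit v) ∎
      where
      open ≡-Reasoning
      implied : ∀ {a b} → (b ≡ true → a ≡ true) → a ∧ b ≡ b
      implied {a} {true}  f rewrite f refl = refl
      implied {a} {false} f = Boolₚ.∧-zeroʳ a
      absurd : ∀ {b} → ¬ (b ≡ true) → b ≡ false
      absurd {true}  ne = contradiction refl ne
      absurd {false} ne = refl
      split : ∀ u → 𝟚 (adj G v u ∧ dir sel v u) ≡ 𝟚 (arc DH v u) + 𝟚 (out sel v u)
      split u = go (S u) refl
        where
        arc⇒rest : arc DH v u ≡ true → adj G v u ≡ true × rest u ≡ true
        arc⇒rest e = ∧-fst (arc⊆adj DH v u e) , ∧-snd {rest v} (∧-snd {adj G v u} (arc⊆adj DH v u e))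
        to : ∀ {b c} → S u ≡ b → (if b then out sel v u else arc DH v u) ≡ c → dir sel v u ≡ c
        to refl eq = trans (cong (if_then (if S u then does (v Finₚ.<? u) else not (out sel u v)) else (if S u then out sel v u else arc DH v u)) Sv) eq
        go : ∀ b → S u ≡ b → 𝟚 (adj G v u ∧ dir sel v u) ≡ 𝟚 (arc DH v u) + 𝟚 (out sel v u)
        go true Su = trans (cong 𝟚 (trans (cong (adj G v u ∧_) (to Su refl)) (implied (proj₁ ∘ out⇒S sel v u))))
          (cong (λ b → 𝟚 b + 𝟚 (out sel v u)) (sym (absurd (λ e → contradiction (trans (sym (not-true (proj₂ (arc⇒rest e)))) Su) λ ()))))
        go false Su = trans (cong 𝟚 (trans (cong (adj G v u ∧_) (to Su refl)) (implied (proj₁ ∘ arc⇒rest))))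
          (sym (trans (cong (λ b → 𝟚 (arc DH v u) + 𝟚 b) (absurd (λ e → contradiction (trans (sym Su) (proj₂ (out⇒S sel v u e))) λ ()))) (ℕₚ.+-identityʳ _)))

    avoid-rest : ∀ sel v → S v ≡ false → outdeg (full sel) v ∉ F v
    avoid-rest sel v Sv y∈ with (outdeg DH v + Gd.pairs v) ∈? F v | subst (_∈ F v) (outdeg-rest sel v Sv) y∈
    ... | no  y∉  | z∈ = y∉ (subst (_∈ F v) (ℕₚ.+-identityʳ _) z∈)
    ... | yes y∈′ | z∈ = coarse v Sv (y∈′ , subst (_∈ F v) (ℕₚ.+-comm _ 1) z∈)

    linked own : Fin n → Fin n → Bool
    linked v s = S s ∧ (rest v ∧ (Gd.α v s ∨ Gd.β v s))
    own v s = linked v s ∧ same s v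

    off : Setting
    off _ _ = false

    -- Turning a switch on changes b → v → a into a → v → b, which raises the out-degree of a and
    -- the in-degree of b. Counting outgoing arcs on one side and incoming arcs on the other
    -- therefore makes all counters monotone in the switches.
    oriented-arc : Setting → Fin n → Fin n → Bool
    oriented-arc sel v s = if side s then arc (full sel) s v else arc (full sel) v s

    -- Where in-degrees are counted, the forbidden values are reflected in the degree. Truncation
    -- can only introduce a spurious target 0, and the number of targets stays the length of `F s`.
    targets : Fin n → List ℕ
    targets s = if S s then (if side s then F s else map (deg G s ∸_) (F s)) else []

    α⇒side : ∀ {v s} → Gd.α v s ≡ true → side s ≡ true
    α⇒side {v} {s} e = ∧-snd {S s} (∧-snd {adj G v s} (Gd.α⊆α⁺ v s e))

    β⇒side : ∀ {v s} → Gd.β v s ≡ true → side s ≡ false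
    β⇒side {v} {s} e = not-true (∧-snd {S s} (∧-snd {adj G v s} (Gd.β⊆β⁺ v s e)))

    sides-agree : ∀ v {s t} → own v s ≡ true → own v t ≡ true → side s ≡ side t
    sides-agree v {s} {t} os ot = trans (sym (≟-true {side v} (∧-snd {linked v s} os))) (≟-true {side v} (∧-snd {linked v t} ot))

    -- All owners of pairs at `v` lie on the side given by the label of `v`. Within one side the
    -- switch determines the end: ends in `α` are their own keys, and `mate` is injective on `β`.
    own-unique : ∀ v {s t} → own v s ≡ true → own v t ≡ true → Gd.key v s ≡ Gd.key v t → s ≡ t
    own-unique v {s} {t} os ot eq
      with Gd.α v s in αs | Gd.β v s in βs | Gd.α v t in αt | Gd.β v t in βt
         | ∧-snd {rest v} (∧-snd {S s} (∧-fst os)) | ∧-snd {rest v} (∧-snd {S t} (∧-fst ot)) | sides-agree v os ot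
    ... | true  | _    | true  | _    | _ | _ | _     = eq
    ... | false | true | false | true | _ | _ | _     = Gd.mate-injective v βs βt eq
    ... | true  | _    | false | true | _ | _ | sides = contradiction (trans (sym (α⇒side {v} αs)) (trans sides (β⇒side {v} βt))) λ ()
    ... | false | true | true  | _    | _ | _ | sides = contradiction (trans (sym (α⇒side {v} αt)) (trans (sym sides) (β⇒side {v} βs))) λ ()

    module Sw = Switches linked own (λ v → Gd.key v) (oriented-arc off) targets (λ v s → ∧-fst) own-unique

    dir-SS : ∀ sel s v → S s ≡ true → S v ≡ true → dir sel s v ≡ does (s Finₚ.<? v)
    dir-SS sel s v Ss Sv rewrite Ss | Sv = refl

    dir-Sr : ∀ sel s v → S s ≡ true → S v ≡ false → dir sel s v ≡ not (out sel v s)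
    dir-Sr sel s v Ss Sv rewrite Ss | Sv = refl

    dir-rS : ∀ sel s v → S s ≡ true → S v ≡ false → dir sel v s ≡ out sel v s
    dir-rS sel s v Ss Sv rewrite Sv | Ss = refl

    oriented-arc-cong : ∀ sel s v → dir sel s v ≡ dir off s v → dir sel v s ≡ dir off v s → oriented-arc sel v s ≡ oriented-arc off v s
    oriented-arc-cong sel s v eq eq′ with side s
    ... | true  = cong (adj G s v ∧_) eq
    ... | false = cong (adj G v s ∧_) eq′

    -- A setting is seen only at the ends of pairs. Edges inside the reservoir, spare edges and
    -- unpaired edges are directed as when all switches are off, which supplies the fixed part of a
    -- counter.
    switched : ∀ sel s v → S s ≡ true → oriented-arc sel v s ≡ (if linked v s then sel v (Gd.key v s) else oriented-arc off v s)
    switched sel s v Ss = go (S v) refl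
      where
      unpaired : linked v s ≡ false → dir sel s v ≡ dir off s v → dir sel v s ≡ dir off v s →
                 oriented-arc sel v s ≡ (if linked v s then sel v (Gd.key v s) else oriented-arc off v s)
      unpaired ni eq eq′ = trans (oriented-arc-cong sel s v eq eq′) (sym (cong (if_then sel v (Gd.key v s) else oriented-arc off v s) ni))
      go : ∀ b → S v ≡ b → oriented-arc sel v s ≡ (if linked v s then sel v (Gd.key v s) else oriented-arc off v s)
      go true Sv = unpaired (trans (cong (λ b → S s ∧ (not b ∧ _)) Sv) (Boolₚ.∧-zeroʳ (S s)))
        (trans (dir-SS sel s v Ss Sv) (sym (dir-SS off s v Ss Sv))) (trans (dir-SS sel v s Sv Ss) (sym (dir-SS off v s Sv Ss)))
      go false Sv = pairing (Gd.α v s) (Gd.β v s) refl refl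
        where
        linked≡ : linked v s ≡ Gd.α v s ∨ Gd.β v s
        linked≡ = cong₂ (λ a b → a ∧ (not b ∧ (Gd.α v s ∨ Gd.β v s))) Ss Sv
        outα : ∀ sel → Gd.α v s ≡ true → out sel v s ≡ not (sel v s)
        outα sel e = cong (if_then not (sel v s) else (if Gd.β v s then sel v (Gd.mate v s) else does (s Finₚ.≟ Gd.spare v) ∧ bit v)) e
        outβ : ∀ sel → Gd.α v s ≡ false → Gd.β v s ≡ true → out sel v s ≡ sel v (Gd.mate v s)
        outβ sel e e′ rewrite e | e′ = refl
        outγ : ∀ sel → Gd.α v s ≡ false → Gd.β v s ≡ false → out sel v s ≡ does (s Finₚ.≟ Gd.spare v) ∧ bit v
        outγ sel e e′ rewrite e | e′ = refl
        paired : ∀ {k} → linked v s ≡ true → Gd.key v s ≡ k → oriented-arc sel v s ≡ sel v k →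
                 oriented-arc sel v s ≡ (if linked v s then sel v (Gd.key v s) else oriented-arc off v s)
        paired i refl eq = trans eq (sym (cong (if_then sel v (Gd.key v s) else oriented-arc off v s) i))
        pairing : ∀ a b → Gd.α v s ≡ a → Gd.β v s ≡ b →
                  oriented-arc sel v s ≡ (if linked v s then sel v (Gd.key v s) else oriented-arc off v s)
        pairing true b αs βs = paired (trans linked≡ (cong (_∨ Gd.β v s) αs)) (cong (if_then s else Gd.mate v s) αs)
          (trans (cong (if_then arc (full sel) s v else arc (full sel) v s) (α⇒side {v} αs))
            (cong₂ _∧_ (trans (Graph.sym G s v) (∧-fst (Gd.α⊆α⁺ v s αs)))
                       (trans (dir-Sr sel s v Ss Sv) (trans (cong not (outα sel αs)) (Boolₚ.not-involutive _)))))
        pairing false true αs βs = paired (trans linked≡ (cong₂ _∨_ αs βs)) (cong (if_then s else Gd.mate v s) αs)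
          (trans (cong (if_then arc (full sel) s v else arc (full sel) v s) (β⇒side {v} βs))
            (cong₂ _∧_ (∧-fst (Gd.β⊆β⁺ v s βs)) (trans (dir-rS sel s v Ss Sv) (outβ sel αs βs))))
        pairing false false αs βs = unpaired (trans linked≡ (cong₂ _∨_ αs βs))
          (trans (dir-Sr sel s v Ss Sv) (trans (cong not (trans (outγ sel αs βs) (sym (outγ off αs βs)))) (sym (dir-Sr off s v Ss Sv))))
          (trans (dir-rS sel s v Ss Sv) (trans (trans (outγ sel αs βs) (sym (outγ off αs βs))) (sym (dir-rS off s v Ss Sv))))

    enough : ∀ s → length (targets s) ≤ count (λ v → own v s)
    enough s = go (S s) refl
      where
      length-L : ∀ b → length (if b then F s else map (deg G s ∸_) (F s)) ≡ length (F s)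
      length-L true  = refl
      length-L false = Listₚ.length-map (deg G s ∸_) (F s)
      covered : S s ≡ true → (λ v → adj G s v ∧ (rest v ∧ (same s v ∧ differ s v))) ⊆ (λ v → own v s)
      covered Ss v e = ∧-intro (∧-intro Ss (∧-intro rest-v (on-side (side s) refl))) (∧-fst both)
        where
        vs : adj G v s ≡ true
        vs = trans (Graph.sym G v s) (∧-fst e)
        rest-v : rest v ≡ true
        rest-v = ∧-fst (∧-snd {adj G s v} e)
        both : same s v ∧ differ s v ≡ true
        both = ∧-snd {rest v} (∧-snd {adj G s v} e)
        differ-vs : differ v s ≡ true
        differ-vs = trans (cong not (does-≟-sym (κ s) (κ v))) (∧-snd {same s v} both)
        on-side : ∀ b → side s ≡ b → Gd.α v s ∨ Gd.β v s ≡ true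
        on-side true  ss = cong (_∨ Gd.β v s) (Gd.α⁻⊆α v s (∧-intro (∧-intro vs (∧-intro Ss ss)) differ-vs))
        on-side false ss = trans (cong (Gd.α v s ∨_) (Gd.β⁻⊆β v s (∧-intro (∧-intro vs (∧-intro Ss (cong not ss))) differ-vs))) (Boolₚ.∨-zeroʳ _)

      go : ∀ b → S s ≡ b → length (targets s) ≤ count (λ v → own v s)
      go false Ss = subst (λ b → length (if b then (if side s then F s else map (deg G s ∸_) (F s)) else []) ≤ count (λ v → own v s)) (sym Ss) z≤n
      go true  Ss = subst (λ b → length (if b then (if side s then F s else map (deg G s ∸_) (F s)) else []) ≤ count (λ v → own v s)) (sym Ss)
                      (subst (_≤ count (λ v → own v s)) (sym (length-L (side s))) (ℕₚ.≤-trans (few-S s Ss) (count-mono (covered Ss))))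

    final : ∃ λ (D : Orientation G) → ∀ v → outdeg D v ∉ F v
    final = full sel , avoid
      where
      sel : Setting
      sel = proj₁ (Sw.switches enough)
      settled : ∀ s → Sw.counter sel s ∉ targets s
      settled = proj₂ (Sw.switches enough)
      counted : ∀ s → S s ≡ true → Sw.counter sel s ≡ count (λ v → oriented-arc sel v s)
      counted s Ss = count-cong (λ v → sym (switched sel s v Ss))
      avoid-S : ∀ s b → S s ≡ true → side s ≡ b → outdeg (full sel) s ∉ F s
      avoid-S s true Ss ss y∈ = settled s (subst (_∈ targets s)
        (sym (trans (counted s Ss) (count-cong (λ v → cong (if_then arc (full sel) s v else arc (full sel) v s) ss))))
        (subst (outdeg (full sel) s ∈_) (sym (cong₂ (λ a b → if a then (if b then F s else map (deg G s ∸_) (F s)) else []) Ss ss)) y∈))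
      avoid-S s false Ss ss y∈ = settled s (subst (_∈ targets s)
        (sym (trans (counted s Ss) (trans (count-cong (λ v → cong (if_then arc (full sel) s v else arc (full sel) v s) ss)) indeg)))
        (subst (deg G s ∸ outdeg (full sel) s ∈_) (sym (cong₂ (λ a b → if a then (if b then F s else map (deg G s ∸_) (F s)) else []) Ss ss))
          (∈ₚ.∈-map⁺ (deg G s ∸_) y∈)))
        where
        indeg : count (λ v → arc (full sel) v s) ≡ deg G s ∸ outdeg (full sel) s
        indeg = trans (sym (ℕₚ.m+n∸m≡n (outdeg (full sel) s) _)) (cong (_∸ outdeg (full sel) s) (outdeg+indeg (full sel) s))
      avoid : ∀ v → outdeg (full sel) v ∉ F v
      avoid v = go (S v) refl
        where
        go : ∀ b → S v ≡ b → outdeg (full sel) v ∉ F v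
        go true  Sv = avoid-S v (side v) Sv refl
        go false Sv = avoid-rest sel v Sv

  -- The interface to the random choice: every condition bounds numbers of neighbours of a single
  -- vertex selected by their labels, so it can be read off one neighbourhood.
  reservoir-orientation : (F : Fin n → List ℕ) →
    (∀ v → S v ≡ false → 2 * length (F v) ≤ count (λ u → adj G v u ∧ rest u)) →
    (∀ v → count (α⁻ v) < count (α⁺ v)) → (∀ v → count (α⁻ v) < count (β⁺ v)) →
    (∀ v → count (β⁻ v) < count (α⁺ v)) → (∀ v → count (β⁻ v) < count (β⁺ v)) →
    (∀ s → S s ≡ true → length (F s) ≤ count (λ v → adj G s v ∧ (rest v ∧ (same s v ∧ differ s v)))) →
    ∃ λ (D : Orientation G) → ∀ v → outdeg D v ∉ F v
  reservoir-orientation F few-rest αα αβ βα ββ few-S = Build.final F gadgets (proj₁ coarse)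
    (λ v Sv (y∈ , y+1∈) → proj₂ coarse v (subst (λ Fv → outdeg (proj₁ coarse) v + Gadget.pairs (gadgets v) ∈ Fv) (sym (outside v Sv)) y∈ ,
                        subst (λ Fv → suc (outdeg (proj₁ coarse) v + Gadget.pairs (gadgets v)) ∈ Fv) (sym (outside v Sv)) y+1∈)) few-S
    where
    gadgets : ∀ v → Gadget (α⁻ v) (α⁺ v) (β⁻ v) (β⁺ v)
    gadgets v = gadget (α⁻ v) (α⁺ v) (β⁻ v) (β⁺ v) (λ u → ∧-fst) (λ u → ∧-fst)
      (λ u e → trans (cong (λ b → adj G v u ∧ (S u ∧ not b)) (∧-snd {S u} (∧-snd {adj G v u} e)))
                     (trans (cong (adj G v u ∧_) (Boolₚ.∧-zeroʳ (S u))) (Boolₚ.∧-zeroʳ (adj G v u))))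
      (αα v) (αβ v) (βα v) (ββ v)
    -- Reservoir vertices are isolated in `H`, so the degree condition there forces an empty list.
    F₀ : Fin n → List ℕ
    F₀ v = if S v then [] else F v
    outside : ∀ v → S v ≡ false → F₀ v ≡ F v
    outside v Sv = cong (if_then [] else F v) Sv
    short : ∀ v b → S v ≡ b → 2 * length (if b then [] else F v) ≤ count (λ u → adj G v u ∧ (not b ∧ rest u))
    short v true  Sv = z≤n
    short v false Sv = few-rest v Sv
    coarse : ∃ λ (D : Orientation H) → ∀ v → ¬ (outdeg D v + Gadget.pairs (gadgets v) ∈ F₀ v × suc (outdeg D v + Gadget.pairs (gadgets v)) ∈ F₀ v)
    coarse = coarse-orientation H (λ v → Gadget.pairs (gadgets v)) F₀ (λ v → short v (S v) refl)

-- The local lemma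

-- Expectations over uniform labellings are kept as unnormalised sums; the inequalities below are
-- homogeneous, so probabilities never have to be divided out.
ΣΩ : ∀ n → (Vec (Fin L) n → ℕ) → ℕ
ΣΩ zero    φ = φ []
ΣΩ (suc n) φ = sum (λ ℓ → ΣΩ n (λ ω → φ (ℓ ∷ ω)))

ΣΩ-cong : ∀ n {φ ψ : Vec (Fin L) n → ℕ} → (∀ ω → φ ω ≡ ψ ω) → ΣΩ n φ ≡ ΣΩ n ψ
ΣΩ-cong zero    eq = eq []
ΣΩ-cong (suc n) eq = sum-cong-≗ (λ ℓ → ΣΩ-cong n (λ ω → eq (ℓ ∷ ω)))

ΣΩ-mono : ∀ n {φ ψ : Vec (Fin L) n → ℕ} → (∀ ω → φ ω ≤ ψ ω) → ΣΩ n φ ≤ ΣΩ n ψ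
ΣΩ-mono zero    le = le []
ΣΩ-mono (suc n) le = sum-mono (λ ℓ → ΣΩ-mono n (λ ω → le (ℓ ∷ ω)))

ΣΩ-+ : ∀ n (φ ψ : Vec (Fin L) n → ℕ) → ΣΩ n (λ ω → φ ω + ψ ω) ≡ ΣΩ n φ + ΣΩ n ψ
ΣΩ-+ zero    φ ψ = refl
ΣΩ-+ (suc n) φ ψ = trans (sum-cong-≗ (λ ℓ → ΣΩ-+ n (λ ω → φ (ℓ ∷ ω)) (λ ω → ψ (ℓ ∷ ω))))
  (∑-distrib-+ (λ ℓ → ΣΩ n (λ ω → φ (ℓ ∷ ω))) (λ ℓ → ΣΩ n (λ ω → ψ (ℓ ∷ ω))))

ΣΩ-* : ∀ n c (φ : Vec (Fin L) n → ℕ) → ΣΩ n (λ ω → c * φ ω) ≡ c * ΣΩ n φ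
ΣΩ-* zero    c φ = refl
ΣΩ-* (suc n) c φ = trans (sum-cong-≗ (λ ℓ → ΣΩ-* n c (λ ω → φ (ℓ ∷ ω))))
  (sym (*-distribˡ-sum c (λ ℓ → ΣΩ n (λ ω → φ (ℓ ∷ ω)))))

ΣΩ-sum : ∀ n {m} (φ : Fin m → Vec (Fin L) n → ℕ) → ΣΩ n (λ ω → sum (λ i → φ i ω)) ≡ sum (λ i → ΣΩ n (φ i))
ΣΩ-sum zero    φ = refl
ΣΩ-sum (suc n) φ = trans (sum-cong-≗ (λ ℓ → ΣΩ-sum n (λ i ω → φ i (ℓ ∷ ω)))) (∑-comm (λ ℓ i → ΣΩ n (λ ω → φ i (ℓ ∷ ω))))

sum-witness : ∀ (f : Fin n → ℕ) → sum f ≢ 0 → ∃ λ i → f i ≢ 0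
sum-witness {zero}  f ne = contradiction refl ne
sum-witness {suc n} f ne with f zero in f0
... | suc x = zero , λ z → contradiction (trans (sym f0) z) λ ()
... | zero with sum-witness (f ∘ suc) ne
...   | i , p = suc i , p

ΣΩ-witness : ∀ n (φ : Vec (Fin L) n → ℕ) → ΣΩ n φ ≢ 0 → ∃ λ ω → φ ω ≢ 0
ΣΩ-witness zero    φ ne = [] , ne
ΣΩ-witness (suc n) φ ne with sum-witness (λ ℓ → ΣΩ n (λ ω → φ (ℓ ∷ ω))) ne
... | ℓ , p with ΣΩ-witness n (λ ω → φ (ℓ ∷ ω)) p
...   | ω , q = ℓ ∷ ω , q

ΣΩ-1≢0 : ∀ n → ΣΩ {suc L} n (const 1) ≢ 0
ΣΩ-1≢0 zero    ()
ΣΩ-1≢0 {L} (suc n) eq = ΣΩ-1≢0 {L} n (ℕₚ.m+n≡0⇒m≡0 _ eq)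

Independent : Fin n → (Vec (Fin L) n → ℕ) → Set
Independent u φ = ∀ ω ℓ → φ (ω [ u ]≔ ℓ) ≡ φ ω

weight : (Fin n → Bool) → (Fin L → ℕ) → Vec (Fin L) n → ℕ
weight mask w []      = 1
weight mask w (ℓ ∷ ω) = (if mask zero then w ℓ else 1) * weight (mask ∘ suc) w ω

sum-const : ∀ n c → sum {n} (λ _ → c) ≡ n * c
sum-const zero    c = refl
sum-const (suc n) c = cong (c +_) (sum-const n c)

sum-average : ∀ (w f : Fin L → ℕ) M → sum w ≡ L * M → (∀ i j → f i ≡ f j) → sum (λ i → w i * f i) ≡ M * sum f
sum-average {zero}  w f M eq const-f = sym (ℕₚ.*-zeroʳ M)
sum-average {suc L} w f M eq const-f = begin
  sum (λ i → w i * f i)     ≡⟨ sum-cong-≗ (λ i → cong (w i *_) (const-f i zero)) ⟩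
  sum (λ i → w i * f zero)  ≡⟨ sym (*-distribʳ-sum (f zero) w) ⟩
  sum w * f zero            ≡⟨ cong (_* f zero) eq ⟩
  (suc L * M) * f zero      ≡⟨ lemma (suc L) M (f zero) ⟩
  M * (suc L * f zero)      ≡⟨ cong (M *_) (sym (sum-const (suc L) (f zero))) ⟩
  M * sum (λ (_ : Fin (suc L)) → f zero) ≡⟨ cong (M *_) (sum-cong-≗ (λ i → const-f zero i)) ⟩
  M * sum f ∎
  where
  open ≡-Reasoning
  lemma : ∀ a b c → (a * b) * c ≡ b * (a * c)
  lemma = solve-∀

-- Independence in product form: as `φ` ignores the coordinates in `mask`, each of their weights can
-- be averaged separately and contributes its mean `M`.
weighted-sum : ∀ n (w : Fin L → ℕ) M → sum w ≡ L * M → ∀ (mask : Fin n → Bool) φ →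
  (∀ u → mask u ≡ true → Independent u φ) → ΣΩ n (λ ω → φ ω * weight mask w ω) ≡ M ^ count mask * ΣΩ n φ
weighted-sum zero    w M eq mask φ ind = trans (ℕₚ.*-identityʳ _) (sym (ℕₚ.+-identityʳ _))
weighted-sum {L} (suc n) w M eq mask φ ind with mask zero in m0
... | false = begin
  sum (λ ℓ → ΣΩ n (λ ω → φ (ℓ ∷ ω) * (1 * weight (mask ∘ suc) w ω)))
    ≡⟨ sum-cong-≗ (λ ℓ → trans (ΣΩ-cong n (λ ω → cong (φ (ℓ ∷ ω) *_) (ℕₚ.*-identityˡ _)))
         (weighted-sum n w M eq (mask ∘ suc) (λ ω → φ (ℓ ∷ ω)) (λ u m ω → ind (suc u) m (ℓ ∷ ω)))) ⟩
  sum (λ ℓ → M ^ count (mask ∘ suc) * ΣΩ n (λ ω → φ (ℓ ∷ ω)))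
    ≡⟨ sym (*-distribˡ-sum (M ^ count (mask ∘ suc)) (λ ℓ → ΣΩ n (λ ω → φ (ℓ ∷ ω)))) ⟩
  M ^ count (mask ∘ suc) * sum (λ ℓ → ΣΩ n (λ ω → φ (ℓ ∷ ω))) ∎
  where open ≡-Reasoning
... | true = begin
  sum (λ ℓ → ΣΩ n (λ ω → φ (ℓ ∷ ω) * (w ℓ * weight (mask ∘ suc) w ω)))
    ≡⟨ sum-cong-≗ (λ ℓ → trans (ΣΩ-cong n (λ ω → lemma (φ (ℓ ∷ ω)) (w ℓ) (weight (mask ∘ suc) w ω)))
         (trans (ΣΩ-* n (w ℓ) _) (cong (w ℓ *_)
           (weighted-sum n w M eq (mask ∘ suc) (λ ω → φ (ℓ ∷ ω)) (λ u m ω → ind (suc u) m (ℓ ∷ ω)))))) ⟩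
  sum (λ ℓ → w ℓ * (M ^ c * ΣΩ n (λ ω → φ (ℓ ∷ ω))))
    ≡⟨ sum-average w (λ ℓ → M ^ c * ΣΩ n (λ ω → φ (ℓ ∷ ω))) M eq
         (λ i j → cong (M ^ c *_) (ΣΩ-cong n (λ ω → ind zero m0 (j ∷ ω) i))) ⟩
  M * sum (λ ℓ → M ^ c * ΣΩ n (λ ω → φ (ℓ ∷ ω)))
    ≡⟨ cong (M *_) (sym (*-distribˡ-sum (M ^ c) (λ ℓ → ΣΩ n (λ ω → φ (ℓ ∷ ω))))) ⟩
  M * (M ^ c * sum (λ ℓ → ΣΩ n (λ ω → φ (ℓ ∷ ω))))
    ≡⟨ sym (ℕₚ.*-assoc M (M ^ c) _) ⟩
  M ^ suc c * sum (λ ℓ → ΣΩ n (λ ω → φ (ℓ ∷ ω))) ∎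
  where
  open ≡-Reasoning
  c = count (mask ∘ suc)
  lemma : ∀ a b c → a * (b * c) ≡ b * (a * c)
  lemma = solve-∀

module LocalLemma {L n : ℕ} (bad : Fin n → Vec (Fin (suc L)) n → Bool) (conflict : Fin n → Fin n → Bool) (D : ℕ)
  .{{_ : NonZero D}} (conflicts : ∀ v → count (conflict v) ≤ D) where

  Ω : Set
  Ω = Vec (Fin (suc L)) n

  𝔼 : (Ω → ℕ) → ℕ
  𝔼 = ΣΩ n

  good : List (Fin n) → Ω → ℕ
  good []      ω = 1
  good (w ∷ T) ω = 𝟚 (not (bad w ω)) * good T ω

  good≤1 : ∀ T ω → good T ω ≤ 1
  good≤1 []      ω = ℕₚ.≤-refl
  good≤1 (w ∷ T) ω with bad w ω
  ... | true  = z≤n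
  ... | false = subst (_≤ 1) (sym (ℕₚ.+-identityʳ _)) (good≤1 T ω)

  Near : Fin n → Fin n → Set
  Near v w = conflict v w ≡ true

  near? : ∀ v w → Dec (Near v w)
  near? v w = conflict v w Boolₚ.≟ true

  near far : Fin n → List (Fin n) → List (Fin n)
  near v = filter (near? v)
  far  v = filter (λ w → conflict v w Boolₚ.≟ false)

  good-split : ∀ v T ω → good T ω ≡ good (near v T) ω * good (far v T) ω
  good-split v []      ω = refl
  good-split v (w ∷ T) ω with conflict v w
  ... | true  = trans (cong (𝟚 (not (bad w ω)) *_) (good-split v T ω)) (sym (ℕₚ.*-assoc (𝟚 (not (bad w ω))) _ _))
  ... | false = trans (cong (𝟚 (not (bad w ω)) *_) (good-split v T ω)) (lemma (𝟚 (not (bad w ω))) (good (near v T) ω) _)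
    where
    lemma : ∀ a b c → a * (b * c) ≡ b * (a * c)
    lemma = solve-∀

  length-split : ∀ v T → length (near v T) + length (far v T) ≡ length T
  length-split v []      = refl
  length-split v (w ∷ T) with conflict v w
  ... | true  = cong suc (length-split v T)
  ... | false = trans (ℕₚ.+-suc _ _) (cong suc (length-split v T))

  near≤D : ∀ v T → Unique T → length (near v T) ≤ D
  near≤D v T un = ℕₚ.≤-trans (unique-length (near v T) (Uniqₚ.filter⁺ (near? v) un) (Allₚ.all-filter (near? v) T)) (conflicts v)
    where
    without : Fin n → (Fin n → Bool) → Fin n → Bool
    without w p x = if does (x Finₚ.≟ w) then false else p x
    unique-length : ∀ {p : Fin n → Bool} T → Unique T → All (λ w → p w ≡ true) T → length T ≤ count p
    unique-length []      _          _          = z≤n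
    unique-length {p} (w ∷ T) (w∉ ∷ un) (pw ∷ pT) = ℕₚ.≤-trans (s≤s (unique-length {without w p} T un
        (All.zipWith (λ { (w≢x , px) → trans (cong (if_then false else p _) (dec-false (_ Finₚ.≟ w) (w≢x ∘ sym))) px }) (w∉ , pT))))
      (count-strict w (λ x e → shrink x e) (cong (if_then false else p w) (dec-true (w Finₚ.≟ w) refl)) pw)
      where
      shrink : ∀ x → without w p x ≡ true → p x ≡ true
      shrink x e with x Finₚ.≟ w
      ... | no _ = e

  Σʷ : List (Fin n) → (Fin n → ℕ) → ℕ
  Σʷ []      f = 0
  Σʷ (w ∷ T) f = f w + Σʷ T f

  union-bound : ∀ T ω → 1 ≤ good T ω + Σʷ T (λ w → 𝟚 (bad w ω))
  union-bound []      ω = ℕₚ.≤-refl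
  union-bound (w ∷ T) ω with bad w ω
  ... | true  = s≤s z≤n
  ... | false = subst (λ x → 1 ≤ x + Σʷ T (λ w → 𝟚 (bad w ω))) (sym (ℕₚ.+-identityʳ _)) (union-bound T ω)

  𝔼-Σʷ : ∀ T (φ : Fin n → Ω → ℕ) → 𝔼 (λ ω → Σʷ T (λ w → φ w ω)) ≡ Σʷ T (λ w → 𝔼 (φ w))
  𝔼-Σʷ []      φ = trans (ΣΩ-* n 0 (const 0)) refl
  𝔼-Σʷ (w ∷ T) φ = trans (ΣΩ-+ n _ _) (cong (𝔼 (φ w) +_) (𝔼-Σʷ T φ))

  Σʷ-*ʳ : ∀ T (f : Fin n → ℕ) c → Σʷ T f * c ≡ Σʷ T (λ w → f w * c)
  Σʷ-*ʳ []      f c = refl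
  Σʷ-*ʳ (w ∷ T) f c = trans (ℕₚ.*-distribʳ-+ c (f w) _) (cong (f w * c +_) (Σʷ-*ʳ T f c))

  Σʷ-bound : ∀ T (f : Fin n → ℕ) c x → (∀ {w} → w ∈ T → c * f w ≤ x) → c * Σʷ T f ≤ length T * x
  Σʷ-bound []      f c x le = ℕₚ.≤-reflexive (ℕₚ.*-zeroʳ c)
  Σʷ-bound (w ∷ T) f c x le = subst (_≤ x + length T * x) (sym (ℕₚ.*-distribˡ-+ c (f w) _))
    (ℕₚ.+-mono-≤ (le (here refl)) (Σʷ-bound T f c x (le ∘ there)))

  module _ (rare : ∀ v T → All (λ w → conflict v w ≡ false) T → 4 * D * 𝔼 (λ ω → good T ω * 𝟚 (bad v ω)) ≤ 𝔼 (good T)) where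

    -- With denominators cleared, this bounds the probability of a bad `v` given `good T` by 1/(2D).
    -- Given that the far members are good, the at most D near ones have probability at most 1/(2D)
    -- each, so they remove at most half of the mass, while a bad `v` has probability at most
    -- 1/(4D).
    rare-step : ∀ T → Unique T → ∀ v →
      (∀ {w} → w ∈ near v T → 2 * D * 𝔼 (λ ω → good (far v T) ω * 𝟚 (bad w ω)) ≤ 𝔼 (good (far v T))) →
      2 * D * 𝔼 (λ ω → good T ω * 𝟚 (bad v ω)) ≤ 𝔼 (good T)
    rare-step T un v few-far = ℕₚ.*-cancelˡ-≤ 2 (begin
      2 * (2 * D * 𝔼 (λ ω → good T ω * 𝟚 (bad v ω)))  ≡⟨ lemma D _ ⟩
      4 * D * 𝔼 (λ ω → good T ω * 𝟚 (bad v ω))        ≤⟨ ℕₚ.*-monoʳ-≤ (4 * D) (ΣΩ-mono n drop) ⟩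
      4 * D * 𝔼 (λ ω → good T₂ ω * 𝟚 (bad v ω))       ≤⟨ rare v T₂ (Allₚ.all-filter (λ w → conflict v w Boolₚ.≟ false) T) ⟩
      𝔼 (good T₂)                                     ≤⟨ at-least-half ⟩
      2 * 𝔼 (good T)                                  ∎)
      where
      open ℕₚ.≤-Reasoning
      T₁ = near v T
      T₂ = far v T
      lemma : ∀ D x → 2 * (2 * D * x) ≡ 4 * D * x
      lemma = solve-∀
      drop : ∀ ω → good T ω * 𝟚 (bad v ω) ≤ good T₂ ω * 𝟚 (bad v ω)
      drop ω = ℕₚ.*-monoˡ-≤ (𝟚 (bad v ω)) (subst₂ _≤_ (sym (good-split v T ω)) (ℕₚ.*-identityˡ _) (ℕₚ.*-monoˡ-≤ (good T₂ ω) (good≤1 T₁ ω)))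
      X : ℕ
      X = Σʷ T₁ (λ w → 𝔼 (λ ω → good T₂ ω * 𝟚 (bad w ω)))
      cover : 𝔼 (good T₂) ≤ 𝔼 (good T) + X
      cover = begin
        𝔼 (good T₂)
          ≤⟨ ΣΩ-mono n (λ ω → subst₂ _≤_ (ℕₚ.*-identityˡ _) (trans (ℕₚ.*-distribʳ-+ (good T₂ ω) (good T₁ ω) _)
               (cong₂ _+_ (sym (good-split v T ω)) (Σʷ-*ʳ T₁ _ (good T₂ ω)))) (ℕₚ.*-monoˡ-≤ (good T₂ ω) (union-bound T₁ ω))) ⟩
        𝔼 (λ ω → good T ω + Σʷ T₁ (λ w → 𝟚 (bad w ω) * good T₂ ω))
          ≡⟨ trans (ΣΩ-+ n _ _) (cong (𝔼 (good T) +_) (𝔼-Σʷ T₁ (λ w ω → 𝟚 (bad w ω) * good T₂ ω))) ⟩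
        𝔼 (good T) + Σʷ T₁ (λ w → 𝔼 (λ ω → 𝟚 (bad w ω) * good T₂ ω))
          ≡⟨ cong (𝔼 (good T) +_) (Σʷ-cong T₁ (λ w → ΣΩ-cong n (λ ω → ℕₚ.*-comm (𝟚 (bad w ω)) _))) ⟩
        𝔼 (good T) + X ∎
        where
        Σʷ-cong : ∀ T {f g : Fin n → ℕ} → (∀ w → f w ≡ g w) → Σʷ T f ≡ Σʷ T g
        Σʷ-cong []      eq = refl
        Σʷ-cong (w ∷ T) eq = cong₂ _+_ (eq w) (Σʷ-cong T eq)
      few : 2 * D * X ≤ length T₁ * 𝔼 (good T₂)
      few = Σʷ-bound T₁ _ (2 * D) (𝔼 (good T₂)) few-far
      at-least-half : 𝔼 (good T₂) ≤ 2 * 𝔼 (good T)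
      at-least-half = ℕₚ.+-cancelʳ-≤ (𝔼 (good T₂)) _ _ (begin
        𝔼 (good T₂) + 𝔼 (good T₂)    ≡⟨ sym (cong (𝔼 (good T₂) +_) (ℕₚ.+-identityʳ _)) ⟩
        2 * 𝔼 (good T₂)              ≤⟨ ℕₚ.*-monoʳ-≤ 2 cover ⟩
        2 * (𝔼 (good T) + X)         ≡⟨ ℕₚ.*-distribˡ-+ 2 (𝔼 (good T)) X ⟩
        2 * 𝔼 (good T) + 2 * X       ≤⟨ ℕₚ.+-monoʳ-≤ (2 * 𝔼 (good T)) 2X≤ ⟩
        2 * 𝔼 (good T) + 𝔼 (good T₂) ∎)
        where
        2X≤ : 2 * X ≤ 𝔼 (good T₂)
        2X≤ = ℕₚ.*-cancelˡ-≤ D (ℕₚ.≤-trans (ℕₚ.≤-reflexive (lemma′ D X)) (ℕₚ.≤-trans few (ℕₚ.*-monoˡ-≤ (𝔼 (good T₂)) (near≤D v T un))))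
          where
          lemma′ : ∀ D X → D * (2 * X) ≡ 2 * D * X
          lemma′ = solve-∀

    -- The bound for smaller lists is called only for a member of `near v T`; its existence makes
    -- `far v T` strictly shorter than `T`.
    rare-given : ∀ m T → length T ≤ m → Unique T → ∀ v → 2 * D * 𝔼 (λ ω → good T ω * 𝟚 (bad v ω)) ≤ 𝔼 (good T)
    rare-given zero    []      le un v = rare-step [] un v (λ ())
    rare-given (suc m) T       le un v = rare-step T un v (λ {w} w∈ → rare-given m (far v T) (shorter w∈)
        (Uniqₚ.filter⁺ (λ w → conflict v w Boolₚ.≟ false) un) w)
      where
      nonempty : ∀ {A : Set} {x : A} {xs} → x ∈ xs → 1 ≤ length xs
      nonempty (here _)  = s≤s z≤n
      nonempty (there _) = s≤s z≤n
      shorter : ∀ {w} → w ∈ near v T → length (far v T) ≤ m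
      shorter w∈ = ℕₚ.≤-pred (ℕₚ.≤-trans (ℕₚ.+-monoˡ-≤ (length (far v T)) (nonempty w∈)) (subst (_≤ suc m) (sym (length-split v T)) le))

    good≢0 : ∀ T → Unique T → 𝔼 (good T) ≢ 0
    good≢0 []      un         = ΣΩ-1≢0 n
    -- If no mass survived the addition of `w`, all of the mass x of `good T` would be bad at `w`.
    -- At most half of it is, so 2 x ≤ x, and x would be 0.
    good≢0 (w ∷ T) (_ ∷ un) z = good≢0 T un (ℕₚ.n≤0⇒n≡0 (ℕₚ.+-cancelˡ-≤ x _ _ (begin
      x + x                          ≡⟨ cong (x +_) (sym (ℕₚ.+-identityʳ x)) ⟩
      2 * x                          ≤⟨ ℕₚ.*-monoʳ-≤ 2 all-bad ⟩
      2 * y                          ≤⟨ ℕₚ.*-monoˡ-≤ y (ℕₚ.m≤m*n 2 D) ⟩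
      2 * D * y                      ≤⟨ rare-given (length T) T ℕₚ.≤-refl un w ⟩
      x                              ≡⟨ sym (ℕₚ.+-identityʳ x) ⟩
      x + 0                          ∎)))
      where
      open ℕₚ.≤-Reasoning
      x = 𝔼 (good T)
      y = 𝔼 (λ ω → good T ω * 𝟚 (bad w ω))
      either : ∀ ω → good T ω ≡ good (w ∷ T) ω + good T ω * 𝟚 (bad w ω)
      either ω with bad w ω
      ... | true  = sym (ℕₚ.*-identityʳ _)
      ... | false = trans (sym (ℕₚ.+-identityʳ _)) (cong₂ _+_ (sym (ℕₚ.+-identityʳ _)) (sym (ℕₚ.*-zeroʳ (good T ω))))
      all-bad : x ≤ y
      all-bad = ℕₚ.≤-reflexive (trans (ΣΩ-cong n either) (trans (ΣΩ-+ n (good (w ∷ T)) _) (cong (_+ y) z)))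

    all-good : ∃ λ ω → ∀ v → bad v ω ≡ false
    all-good with ΣΩ-witness n (good (allFin n)) (good≢0 (allFin n) (Uniqₚ.allFin⁺ n))
    ... | ω , p = ω , λ v → avoid (allFin n) p (∈ₚ.∈-allFin v)
      where
      avoid : ∀ T → good T ω ≢ 0 → ∀ {v} → v ∈ T → bad v ω ≡ false
      avoid (w ∷ T) p (here refl) with bad w ω
      ... | true  = contradiction refl p
      ... | false = refl
      avoid (w ∷ T) p (there v∈) = avoid T (λ z → p (trans (cong (𝟚 (not (bad w ω)) *_) z) (ℕₚ.*-zeroʳ (𝟚 (not (bad w ω)))))) v∈

-- Tail bounds and labels

^-cancelʳ-≤ : ∀ {a b} k .{{_ : NonZero k}} → a ^ k ≤ b ^ k → a ≤ b
^-cancelʳ-≤ {a} {b} k le with a ℕₚ.≤? b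
... | yes a≤b = a≤b
... | no  a≰b = contradiction le (ℕₚ.<⇒≱ (ℕₚ.^-monoˡ-< k (ℕₚ.≰⇒> a≰b)))

-- Bernoulli's inequality for (1 - w / (B + w)) ^ m from above ...
bernoulli : ∀ B w m → B ^ m * ((B + w) + m * w) ≤ (B + w) ^ suc m
bernoulli B w zero    = ℕₚ.≤-reflexive (lemma B w)
  where
  lemma : ∀ B w → 1 * ((B + w) + 0 * w) ≡ (B + w) * 1
  lemma = solve-∀
bernoulli B w (suc m) = begin
  B * B ^ m * ((B + w) + suc m * w)           ≡⟨ lemma₁ B (B ^ m) w (m * w) ⟩
  B ^ m * (B * ((B + w) + m * w) + B * w)     ≤⟨ ℕₚ.*-monoʳ-≤ (B ^ m) (ℕₚ.+-monoʳ-≤ (B * ((B + w) + m * w)) (ℕₚ.*-monoˡ-≤ w B≤)) ⟩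
  B ^ m * (B * ((B + w) + m * w) + ((B + w) + m * w) * w) ≡⟨ lemma₂ (B ^ m) B w (m * w) ⟩
  (B + w) * (B ^ m * ((B + w) + m * w))       ≤⟨ ℕₚ.*-monoʳ-≤ (B + w) (bernoulli B w m) ⟩
  (B + w) * (B + w) ^ suc m ∎
  where
  open ℕₚ.≤-Reasoning
  B≤ : B ≤ (B + w) + m * w
  B≤ = ℕₚ.≤-trans (ℕₚ.m≤m+n B w) (ℕₚ.m≤m+n (B + w) (m * w))
  lemma₁ : ∀ B p w x → B * p * ((B + w) + (w + x)) ≡ p * (B * ((B + w) + x) + B * w)
  lemma₁ = solve-∀
  lemma₂ : ∀ p B w x → p * (B * ((B + w) + x) + ((B + w) + x) * w) ≡ (B + w) * (p * ((B + w) + x))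
  lemma₂ = solve-∀

-- ... and for (1 - v / (X + v)) ^ r from below, where z / (X + v) = 1 - r v / (X + v).
bernoulli′ : ∀ X v r z → z + r * v ≡ X + v → (X + v) ^ r * z ≤ X ^ r * (X + v)
bernoulli′ X v zero    z eq = ℕₚ.≤-reflexive (cong (1 *_) (trans (sym (ℕₚ.+-identityʳ z)) eq))
bernoulli′ X v (suc r) z eq = begin
  (X + v) * (X + v) ^ r * z                ≡⟨ lemma₁ (X + v) ((X + v) ^ r) z ⟩
  (X + v) ^ r * ((X + v) * z)              ≤⟨ ℕₚ.*-monoʳ-≤ ((X + v) ^ r) step ⟩
  (X + v) ^ r * (X * (z + v))              ≡⟨ lemma₂ ((X + v) ^ r) X (z + v) ⟩
  X * ((X + v) ^ r * (z + v))              ≤⟨ ℕₚ.*-monoʳ-≤ X (bernoulli′ X v r (z + v) (trans (ℕₚ.+-assoc z v (r * v)) eq)) ⟩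
  X * (X ^ r * (X + v))                    ≡⟨ sym (ℕₚ.*-assoc X (X ^ r) (X + v)) ⟩
  X * X ^ r * (X + v) ∎
  where
  open ℕₚ.≤-Reasoning
  lemma₁ : ∀ a b c → a * b * c ≡ b * (a * c)
  lemma₁ = solve-∀
  lemma₂ : ∀ a b c → a * (b * c) ≡ b * (a * c)
  lemma₂ = solve-∀
  lemma₃ : ∀ z v x → z + (v + x) ≡ (z + x) + v
  lemma₃ = solve-∀
  z≤X : z ≤ X
  z≤X = ℕₚ.+-cancelʳ-≤ v z X (ℕₚ.≤-trans (ℕₚ.+-monoˡ-≤ v (ℕₚ.m≤m+n z (r * v))) (ℕₚ.≤-reflexive (trans (sym (lemma₃ z v (r * v))) eq)))
  step : (X + v) * z ≤ X * (z + v)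
  step = subst₂ _≤_ (sym (ℕₚ.*-distribʳ-+ z X v)) (sym (ℕₚ.*-distribˡ-+ X z v))
           (ℕₚ.+-monoʳ-≤ (X * z) (subst (v * z ≤_) (ℕₚ.*-comm v X) (ℕₚ.*-monoʳ-≤ v z≤X)))

-- The weighted geometric mean of x (weight e) and Y (weight r) is at least B.
geometric-mean : ∀ {B w X v e r z Y} .{{_ : NonZero Y}} → B + w ≡ Y → X + v ≡ Y → z + e * v ≡ Y →
                 Y * Y ≤ (Y + (e + r) * w) * z → B ^ (e + r) ≤ X ^ e * Y ^ r
geometric-mean {B} {w} {X} {v} {e} {r} {z} {Y} refl Xv ze big = ℕₚ.*-cancelʳ-≤ _ _ (Y * Y) {{ℕₚ.m*n≢0 Y Y}} (begin
  B ^ T * (Y * Y)                    ≤⟨ ℕₚ.*-monoʳ-≤ (B ^ T) big ⟩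
  B ^ T * ((Y + T * w) * z)          ≡⟨ sym (ℕₚ.*-assoc (B ^ T) _ z) ⟩
  B ^ T * (Y + T * w) * z            ≤⟨ ℕₚ.*-monoˡ-≤ z (bernoulli B w T) ⟩
  Y * Y ^ T * z                      ≡⟨ cong (λ t → Y * t * z) (ℕₚ.^-distribˡ-+-* Y e r) ⟩
  Y * (Y ^ e * Y ^ r) * z            ≡⟨ lemma Y (Y ^ e) (Y ^ r) z ⟩
  Y * Y ^ r * (Y ^ e * z)            ≤⟨ ℕₚ.*-monoʳ-≤ (Y * Y ^ r) (subst (λ y → y ^ e * z ≤ X ^ e * y) Xv (bernoulli′ X v e z (trans ze (sym Xv)))) ⟩
  Y * Y ^ r * (X ^ e * Y)            ≡⟨ lemma′ Y (Y ^ r) (X ^ e) ⟩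
  X ^ e * Y ^ r * (Y * Y) ∎)
  where
  open ℕₚ.≤-Reasoning
  T = e + r
  lemma : ∀ a b c d → a * (b * c) * d ≡ a * c * (b * d)
  lemma = solve-∀
  lemma′ : ∀ a b c → a * b * (c * a) ≡ c * b * (a * a)
  lemma′ = solve-∀

^-distribʳ-* : ∀ k a b → (a * b) ^ k ≡ a ^ k * b ^ k
^-distribʳ-* zero    a b = refl
^-distribʳ-* (suc k) a b = trans (cong (a * b *_) (^-distribʳ-* k a b)) (lemma a b (a ^ k) (b ^ k))
  where
  lemma : ∀ a b c d → a * b * (c * d) ≡ a * c * (b * d)
  lemma = solve-∀

hits misses : (Fin n → Bool) → Fin L → Vec (Fin L) n → ℕ
hits   mask ℓ ω = count (λ u → mask u ∧ does (lookup ω u Finₚ.≟ ℓ))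
misses mask ℓ ω = count (λ u → mask u ∧ not (does (lookup ω u Finₚ.≟ ℓ)))

count-split : ∀ (p q : Fin n → Bool) → count (λ u → p u ∧ q u) + count (λ u → p u ∧ not (q u)) ≡ count p
count-split p q = trans (cong₂ _+_ (count≡sum (λ u → p u ∧ q u)) (count≡sum (λ u → p u ∧ not (q u))))
  (trans (sym (∑-distrib-+ (λ u → 𝟚 (p u ∧ q u)) (λ u → 𝟚 (p u ∧ not (q u))))) (trans (sum-cong-≗ (λ u → one (p u) (q u))) (sym (count≡sum p))))
  where
  one : ∀ a b → 𝟚 (a ∧ b) + 𝟚 (a ∧ not b) ≡ 𝟚 a
  one true  true  = refl
  one true  false = refl
  one false b     = refl

-- The tilted weight of the exponential moment method: with `X` below `Y`, a labelling in which `ℓ`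
-- is rare becomes heavy.
spike : Fin L → ℕ → ℕ → Fin L → ℕ
spike ℓ X Y i = if does (i Finₚ.≟ ℓ) then X else Y

sum-spike : ∀ (ℓ : Fin L) X Y → sum (spike ℓ X Y) + Y ≡ X + L * Y
sum-spike {suc L} zero    X Y = trans (cong (λ t → X + t + Y) (sum-const L Y)) (lemma X (L * Y) Y)
  where
  lemma : ∀ a b c → a + b + c ≡ a + (c + b)
  lemma = solve-∀
sum-spike {suc L} (suc ℓ) X Y = trans (ℕₚ.+-assoc Y _ Y) (trans (cong (Y +_) (sum-spike ℓ X Y)) (lemma X (L * Y) Y))
  where
  lemma : ∀ a b c → c + (a + b) ≡ a + (c + b)
  lemma = solve-∀

weight-spike : ∀ (mask : Fin n → Bool) (ℓ : Fin L) X Y ω →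
               weight mask (spike ℓ X Y) ω ≡ X ^ hits mask ℓ ω * Y ^ misses mask ℓ ω
weight-spike mask ℓ X Y []      = refl
weight-spike mask ℓ X Y (i ∷ ω) rewrite weight-spike (mask ∘ suc) ℓ X Y ω with mask zero | does (i Finₚ.≟ ℓ)
... | false | _     = ℕₚ.*-identityˡ _
... | true  | true  = sym (ℕₚ.*-assoc X (X ^ hits (mask ∘ suc) ℓ ω) _)
... | true  | false = lemma Y (X ^ hits (mask ∘ suc) ℓ ω) _
  where
  lemma : ∀ a b c → a * (b * c) ≡ b * (a * c)
  lemma = solve-∀

exchange : ∀ {X Y} a {a′ b b′} → X ≤ Y → a ≤ a′ → a + b ≡ a′ + b′ → X ^ a′ * Y ^ b′ ≤ X ^ a * Y ^ b
exchange {X} {Y} a {b = b} {b′} X≤Y a≤a′ eq with ℕₚ.m≤n⇒∃[o]m+o≡n a≤a′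
... | k , refl = begin
  X ^ (a + k) * Y ^ b′        ≡⟨ cong (_* Y ^ b′) (ℕₚ.^-distribˡ-+-* X a k) ⟩
  X ^ a * X ^ k * Y ^ b′      ≤⟨ ℕₚ.*-monoˡ-≤ (Y ^ b′) (ℕₚ.*-monoʳ-≤ (X ^ a) (ℕₚ.^-monoˡ-≤ k X≤Y)) ⟩
  X ^ a * Y ^ k * Y ^ b′      ≡⟨ trans (ℕₚ.*-assoc (X ^ a) (Y ^ k) _) (cong (X ^ a *_) (sym (ℕₚ.^-distribˡ-+-* Y k b′))) ⟩
  X ^ a * Y ^ (k + b′)        ≡⟨ cong (λ t → X ^ a * Y ^ t) (sym (ℕₚ.+-cancelˡ-≡ a b (k + b′) (trans eq (ℕₚ.+-assoc a k b′)))) ⟩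
  X ^ a * Y ^ b ∎
  where open ℕₚ.≤-Reasoning

-- Exponential moment bound: a label occurs less often than the fraction e / (e + r) with probability at most (M / B) ^ d.
module Tail {L : ℕ} {X Y M B e r : ℕ} (X≤Y : X ≤ Y) (mean : X + L * Y ≡ L * M + Y) .{{_ : NonZero (e + r)}}
  (geometric : B ^ (e + r) ≤ X ^ e * Y ^ r) where

  scarce : (Fin n → Bool) → Fin L → Vec (Fin L) n → Bool
  scarce mask ℓ ω = does ((e + r) * hits mask ℓ ω ℕₚ.<? e * count mask)

  -- Scarcity moves exponents from the smaller base `X` to the larger base `Y`. Comparing powers of
  -- order `e + r` avoids the fractional exponents of the weighted mean.
  scarce-weight : ∀ (mask : Fin n → Bool) ℓ ω → scarce mask ℓ ω ≡ true → B ^ count mask ≤ weight mask (spike ℓ X Y) ω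
  scarce-weight mask ℓ ω sc = subst (B ^ d ≤_) (sym (weight-spike mask ℓ X Y ω)) (^-cancelʳ-≤ (e + r) (begin
      (B ^ d) ^ (e + r)                       ≡⟨ trans (ℕₚ.^-*-assoc B d (e + r)) (trans (cong (B ^_) (ℕₚ.*-comm d (e + r))) (sym (ℕₚ.^-*-assoc B (e + r) d))) ⟩
      (B ^ (e + r)) ^ d                       ≤⟨ ℕₚ.^-monoˡ-≤ d geometric ⟩
      (X ^ e * Y ^ r) ^ d                     ≡⟨ ^-distribʳ-* d (X ^ e) (Y ^ r) ⟩
      (X ^ e) ^ d * (Y ^ r) ^ d               ≡⟨ cong₂ _*_ (ℕₚ.^-*-assoc X e d) (ℕₚ.^-*-assoc Y r d) ⟩
      X ^ (e * d) * Y ^ (r * d)               ≤⟨ exchange ((e + r) * h) X≤Y (ℕₚ.<⇒≤ lt)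
                                                   (trans (sym (ℕₚ.*-distribˡ-+ (e + r) h g)) (trans (cong ((e + r) *_) (count-split mask _)) (ℕₚ.*-distribʳ-+ d e r))) ⟩
      X ^ ((e + r) * h) * Y ^ ((e + r) * g)   ≡⟨ cong₂ _*_ (power X h) (power Y g) ⟩
      (X ^ h) ^ (e + r) * (Y ^ g) ^ (e + r)   ≡⟨ sym (^-distribʳ-* (e + r) (X ^ h) (Y ^ g)) ⟩
      (X ^ h * Y ^ g) ^ (e + r)               ∎))
    where
    open ℕₚ.≤-Reasoning
    d = count mask
    h = hits mask ℓ ω
    g = misses mask ℓ ω
    lt : (e + r) * h < e * d
    lt = ℕₚ.<ᵇ⇒< ((e + r) * h) (e * d) (subst Bool.T (sym sc) _)
    power : ∀ a k → a ^ ((e + r) * k) ≡ (a ^ k) ^ (e + r)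
    power a k = trans (cong (a ^_) (ℕₚ.*-comm (e + r) k)) (sym (ℕₚ.^-*-assoc a k (e + r)))

  tail-bound : ∀ (mask : Fin n → Bool) ℓ φ → (∀ u → mask u ≡ true → Independent u φ) →
         B ^ count mask * ΣΩ n (λ ω → φ ω * 𝟚 (scarce mask ℓ ω)) ≤ M ^ count mask * ΣΩ n φ
  tail-bound {n} mask ℓ φ ind = begin
    B ^ count mask * ΣΩ n (λ ω → φ ω * 𝟚 (scarce mask ℓ ω))
      ≡⟨ sym (ΣΩ-* n (B ^ count mask) _) ⟩
    ΣΩ n (λ ω → B ^ count mask * (φ ω * 𝟚 (scarce mask ℓ ω)))
      ≤⟨ ΣΩ-mono n pointwise ⟩
    ΣΩ n (λ ω → φ ω * weight mask (spike ℓ X Y) ω)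
      ≡⟨ weighted-sum n (spike ℓ X Y) M (ℕₚ.+-cancelʳ-≡ Y _ _ (trans (sum-spike ℓ X Y) mean)) mask φ ind ⟩
    M ^ count mask * ΣΩ n φ ∎
    where
    open ℕₚ.≤-Reasoning
    pointwise : ∀ ω → B ^ count mask * (φ ω * 𝟚 (scarce mask ℓ ω)) ≤ φ ω * weight mask (spike ℓ X Y) ω
    pointwise ω with scarce mask ℓ ω in sc
    ... | false = ℕₚ.≤-trans (ℕₚ.≤-reflexive (trans (cong (B ^ count mask *_) (ℕₚ.*-zeroʳ (φ ω))) (ℕₚ.*-zeroʳ (B ^ count mask)))) z≤n
    ... | true  = subst (_≤ φ ω * weight mask (spike ℓ X Y) ω)
                    (trans (ℕₚ.*-comm (φ ω) (B ^ count mask)) (cong (B ^ count mask *_) (sym (ℕₚ.*-identityʳ (φ ω)))))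
                    (ℕₚ.*-monoʳ-≤ (φ ω) (scarce-weight mask ℓ ω sc))

argmax : ∀ (f : Fin (suc n) → ℕ) → ∃ λ i → ∀ j → f j ≤ f i
argmax {zero}  f = zero , λ { zero → ℕₚ.≤-refl }
argmax {suc n} f with argmax (f ∘ suc)
... | i , max with f zero ℕₚ.≤? f (suc i)
...   | yes le = suc i , λ { zero → le ; (suc j) → max j }
...   | no ¬le = zero , λ { zero → ℕₚ.≤-refl ; (suc j) → ℕₚ.≤-trans (max j) (ℕₚ.<⇒≤ (ℕₚ.≰⇒> ¬le)) }

n≤2^n : ∀ n → n ≤ 2 ^ n
n≤2^n zero    = z≤n
n≤2^n (suc n) = ℕₚ.≤-trans (ℕₚ.+-mono-≤ (ℕₚ.m^n>0 2 n) (n≤2^n n)) (ℕₚ.≤-reflexive (cong (2 ^ n +_) (sym (ℕₚ.+-identityʳ (2 ^ n)))))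

doubling : ∀ M → 2 * M ^ suc M ≤ suc M ^ suc M
doubling M = ℕₚ.*-cancelʳ-≤ _ _ (suc M) (begin
  2 * M ^ suc M * suc M               ≡⟨ lemma (M ^ suc M) M ⟩
  M ^ suc M * ((M + 1) + suc M * 1)   ≤⟨ bernoulli M 1 (suc M) ⟩
  (M + 1) ^ suc (suc M)               ≡⟨ cong (_^ suc (suc M)) (ℕₚ.+-comm M 1) ⟩
  suc M * suc M ^ suc M               ≡⟨ ℕₚ.*-comm (suc M) _ ⟩
  suc M ^ suc M * suc M               ∎)
  where
  open ℕₚ.≤-Reasoning
  lemma : ∀ p M → 2 * p * (1 + M) ≡ p * ((M + 1) + (1 + M) * 1)
  lemma = solve-∀

-- By `doubling`, each block of M + 1 factors (M + 1) / M gains at least 2, in total 2^q with q the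
-- quotient of d by M + 1. The hypotheses give Δ⁴ ≤ 2^(q + 1) and 2c² ≤ q ≤ 2^q, so (cΔ²)² ≤ 2^(2q).
decay : ∀ M c Δ d → suc M * (2 * c * c) ≤ d → Δ ^ (4 * suc M) ≤ 2 ^ d → c * (Δ * Δ) * M ^ d ≤ suc M ^ d
decay M c Δ d large Δ≤ = begin
  c * (Δ * Δ) * M ^ d                   ≤⟨ ℕₚ.*-monoˡ-≤ (M ^ d) cΔ²≤ ⟩
  2 ^ q * M ^ d                         ≡⟨ cong (λ x → 2 ^ q * M ^ x) d≡ ⟩
  2 ^ q * M ^ (r + q * t)               ≡⟨ trans (cong (2 ^ q *_) (trans (ℕₚ.^-distribˡ-+-* M r (q * t)) (cong (M ^ r *_) (power M)))) (lemma (2 ^ q) (M ^ r) ((M ^ t) ^ q)) ⟩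
  M ^ r * (2 ^ q * (M ^ t) ^ q)         ≡⟨ cong (M ^ r *_) (sym (^-distribʳ-* q 2 (M ^ t))) ⟩
  M ^ r * (2 * M ^ t) ^ q               ≤⟨ ℕₚ.*-mono-≤ (ℕₚ.^-monoˡ-≤ r (ℕₚ.n≤1+n M)) (ℕₚ.^-monoˡ-≤ q (doubling M)) ⟩
  t ^ r * (t ^ t) ^ q                   ≡⟨ sym (trans (ℕₚ.^-distribˡ-+-* t r (q * t)) (cong (t ^ r *_) (power t))) ⟩
  t ^ (r + q * t)                       ≡⟨ cong (t ^_) (sym d≡) ⟩
  t ^ d                                 ∎
  where
  open ℕₚ.≤-Reasoning
  t = suc M
  q = d / t
  r = d % t
  d≡ : d ≡ r + q * t
  d≡ = DM.m≡m%n+[m/n]*n d t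
  power : ∀ a → a ^ (q * t) ≡ (a ^ t) ^ q
  power a = trans (cong (a ^_) (ℕₚ.*-comm q t)) (sym (ℕₚ.^-*-assoc a t q))
  lemma : ∀ a b c → a * (b * c) ≡ b * (a * c)
  lemma = solve-∀
  2cc≤q : 2 * c * c ≤ q
  2cc≤q = subst (_≤ q) (DM.m*n/n≡m (2 * c * c) t) (DM./-monoˡ-≤ t (subst (_≤ d) (ℕₚ.*-comm t (2 * c * c)) large))
  Δ⁴≤ : Δ ^ 4 ≤ 2 ^ suc q
  Δ⁴≤ = ^-cancelʳ-≤ t (begin
    (Δ ^ 4) ^ t         ≡⟨ ℕₚ.^-*-assoc Δ 4 t ⟩
    Δ ^ (4 * t)         ≤⟨ Δ≤ ⟩
    2 ^ d               ≤⟨ ℕₚ.^-monoʳ-≤ 2 (subst (_≤ suc q * t) (sym d≡) (ℕₚ.+-monoˡ-≤ (q * t) (ℕₚ.<⇒≤ (DM.m%n<n d t)))) ⟩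
    2 ^ (suc q * t)     ≡⟨ sym (ℕₚ.^-*-assoc 2 (suc q) t) ⟩
    (2 ^ suc q) ^ t     ∎)
  cΔ²≤ : c * (Δ * Δ) ≤ 2 ^ q
  cΔ²≤ = ^-cancelʳ-≤ 2 (begin
    (c * (Δ * Δ)) ^ 2          ≡⟨ square c Δ ⟩
    c * c * Δ ^ 4              ≤⟨ ℕₚ.*-monoʳ-≤ (c * c) Δ⁴≤ ⟩
    c * c * (2 * 2 ^ q)        ≡⟨ lemma′ c (2 ^ q) ⟩
    2 * c * c * 2 ^ q          ≤⟨ ℕₚ.*-monoˡ-≤ (2 ^ q) (ℕₚ.≤-trans 2cc≤q (n≤2^n q)) ⟩
    2 ^ q * 2 ^ q              ≡⟨ cong (2 ^ q *_) (sym (ℕₚ.*-identityʳ (2 ^ q))) ⟩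
    (2 ^ q) ^ 2                ∎)
    where
    square : ∀ c Δ → (c * (Δ * Δ)) * ((c * (Δ * Δ)) * 1) ≡ c * c * (Δ * (Δ * (Δ * (Δ * 1))))
    square = solve-∀
    lemma′ : ∀ c p → c * c * (2 * p) ≡ 2 * c * c * p
    lemma′ = solve-∀

𝟚-positive : ∀ x → 𝟚 (0 ℕ.<ᵇ x) ≤ x
𝟚-positive zero    = z≤n
𝟚-positive (suc x) = s≤s z≤n

-- Each such `w` ends a walk of length two from `v`, and there are at most Δ² of these walks.
count-common≤ : ∀ (G : Graph n) Δ → (∀ v → deg G v ≤ Δ) → ∀ v →
  count (λ w → 0 ℕ.<ᵇ count (λ u → adj G v u ∧ adj G w u)) ≤ Δ * Δ
count-common≤ {n} G Δ deg≤ v = begin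
  count (λ w → 0 ℕ.<ᵇ count (λ u → adj G v u ∧ adj G w u))
    ≡⟨ count≡sum (λ w → 0 ℕ.<ᵇ count (λ u → adj G v u ∧ adj G w u)) ⟩
  sum (λ w → 𝟚 (0 ℕ.<ᵇ count (λ u → adj G v u ∧ adj G w u)))
    ≤⟨ sum-mono (λ w → ℕₚ.≤-trans (𝟚-positive (count (λ u → adj G v u ∧ adj G w u))) (ℕₚ.≤-reflexive (count≡sum (λ u → adj G v u ∧ adj G w u)))) ⟩
  sum (λ w → sum (λ u → 𝟚 (adj G v u ∧ adj G w u)))
    ≡⟨ ∑-comm (λ w u → 𝟚 (adj G v u ∧ adj G w u)) ⟩
  sum (λ u → sum (λ w → 𝟚 (adj G v u ∧ adj G w u)))
    ≤⟨ sum-mono row ⟩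
  sum (λ u → 𝟚 (adj G v u) * Δ)
    ≡⟨ sym (*-distribʳ-sum Δ (λ u → 𝟚 (adj G v u))) ⟩
  sum (λ u → 𝟚 (adj G v u)) * Δ
    ≡⟨ cong (_* Δ) (sym (count≡sum (adj G v))) ⟩
  deg G v * Δ
    ≤⟨ ℕₚ.*-monoˡ-≤ Δ (deg≤ v) ⟩
  Δ * Δ ∎
  where
  open ℕₚ.≤-Reasoning
  row : ∀ u → sum (λ w → 𝟚 (adj G v u ∧ adj G w u)) ≤ 𝟚 (adj G v u) * Δ
  row u with adj G v u
  ... | false = ℕₚ.≤-reflexive (trans (sum-const n 0) (ℕₚ.*-zeroʳ n))
  ... | true  = begin
    sum (λ w → 𝟚 (adj G w u))   ≡⟨ sum-cong-≗ (λ w → cong 𝟚 (Graph.sym G w u)) ⟩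
    sum (λ w → 𝟚 (adj G u w))   ≡⟨ sym (count≡sum (adj G u)) ⟩
    deg G u                     ≤⟨ deg≤ u ⟩
    Δ                           ≡⟨ sym (ℕₚ.+-identityʳ Δ) ⟩
    1 * Δ                       ∎

module Labelling {L X Y M e r : ℕ} (X≤Y : X ≤ Y) (mean : X + suc L * Y ≡ suc L * M + Y) .{{_ : NonZero (e + r)}}
  (geometric : suc M ^ (e + r) ≤ X ^ e * Y ^ r) where

  open Tail {suc L} {X} {Y} {M} {suc M} {e} {r} X≤Y mean geometric

  -- The 4 is the constant of the local lemma, and `suc L` comes from the union bound over all
  -- labels.
  C : ℕ
  C = 4 * suc L

  -- Written so that `suc exponent` computes to `4 * suc M`, the power of the maximum degree
  -- required by `decay`.
  exponent : ℕ
  exponent = M + 3 * suc M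

  δ₀ : ℕ
  δ₀ = suc M * (2 * C * C)

  -- Demanding that every label be frequent around every vertex makes the event at `v` independent
  -- of the label of `v` itself. Two events then interact only through a common neighbour.
  labelling : ∀ (G : Graph (suc n)) → (∀ v → δ₀ ≤ deg G v) → (∀ u v → deg G u ^ suc exponent ≤ 2 ^ deg G v) →
    ∃ λ (c : Vec (Fin (suc L)) (suc n)) → ∀ v ℓ → e * deg G v ≤ (e + r) * hits (adj G v) ℓ c
  labelling {n} G large sub = proj₁ found , λ v ℓ → plenty v ℓ
    where
    Ω : Set
    Ω = Vec (Fin (suc L)) (suc n)
    top = argmax (deg G)
    Δ = deg G (proj₁ top)
    scarce-at : Fin (suc n) → Ω → Fin (suc L) → Bool
    scarce-at v ω ℓ = scarce (adj G v) ℓ ω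
    bad : Fin (suc n) → Ω → Bool
    bad v ω = 0 ℕ.<ᵇ count (scarce-at v ω)
    conflict : Fin (suc n) → Fin (suc n) → Bool
    conflict v w = 0 ℕ.<ᵇ count (λ u → adj G v u ∧ adj G w u)
    Δ>0 : 0 < Δ
    Δ>0 = ℕₚ.<-≤-trans (s≤s z≤n) (large (proj₁ top))
    instance
      nonZeroΔ² : NonZero (Δ * Δ)
      nonZeroΔ² = ℕ.>-nonZero (ℕₚ.*-mono-≤ Δ>0 Δ>0)
    open LocalLemma {L} {suc n} bad conflict (Δ * Δ) (count-common≤ G Δ (proj₂ top))
    any-scarce : ∀ v ω → 𝟚 (bad v ω) ≤ sum (λ ℓ → 𝟚 (scarce-at v ω ℓ))
    any-scarce v ω = ℕₚ.≤-trans (𝟚-positive (count (scarce-at v ω))) (ℕₚ.≤-reflexive (count≡sum (scarce-at v ω)))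
    zero-count : ∀ {m} {p : Fin m → Bool} → (0 ℕ.<ᵇ count p) ≡ false → ∀ i → p i ≡ false
    zero-count {suc m} {p} eq i with p zero in p0
    zero-count {suc m} {p} eq zero    | false = p0
    zero-count {suc m} {p} eq (suc i) | false = zero-count {m} {p ∘ suc} eq i
    bad-independent : ∀ w u → adj G w u ≡ false → ∀ ω ℓ → bad w (ω [ u ]≔ ℓ) ≡ bad w ω
    bad-independent w u wu ω ℓ = cong (0 ℕ.<ᵇ_) (count-cong (λ i → cong (λ h → does ((e + r) * h ℕₚ.<? e * deg G w)) (count-cong (same i))))
      where
      same : ∀ i x → adj G w x ∧ does (lookup (ω [ u ]≔ ℓ) x Finₚ.≟ i) ≡ adj G w x ∧ does (lookup ω x Finₚ.≟ i)
      same i x with x Finₚ.≟ u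
      ... | yes refl = trans (cong (_∧ does (lookup (ω [ u ]≔ ℓ) u Finₚ.≟ i)) wu) (sym (cong (_∧ does (lookup ω u Finₚ.≟ i)) wu))
      ... | no  x≢u  = cong (λ y → adj G w x ∧ does (y Finₚ.≟ i)) (Vecₚ.lookup∘update′ x≢u ω ℓ)
    good-independent : ∀ T v → All (λ w → conflict v w ≡ false) T → ∀ u → adj G v u ≡ true → Independent u (good T)
    good-independent []      v _          u vu ω ℓ = refl
    good-independent (w ∷ T) v (vw ∷ vT) u vu ω ℓ =
      cong₂ (λ b x → 𝟚 (not b) * x) (bad-independent w u wu ω ℓ) (good-independent T v vT u vu ω ℓ)
      where
      wu : adj G w u ≡ false
      wu with adj G w u in eq
      ... | false = refl
      ... | true  = trans (sym (∧-intro vu eq)) (zero-count {p = λ u → adj G v u ∧ adj G w u} vw u)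
    rare : ∀ v T → All (λ w → conflict v w ≡ false) T → 4 * (Δ * Δ) * 𝔼 (λ ω → good T ω * 𝟚 (bad v ω)) ≤ 𝔼 (good T)
    rare v T vT = ℕₚ.*-cancelˡ-≤ (suc M ^ d) {{ℕₚ.m^n≢0 (suc M) d}} (begin
      suc M ^ d * (4 * (Δ * Δ) * 𝔼 (λ ω → good T ω * 𝟚 (bad v ω)))
        ≤⟨ ℕₚ.*-monoʳ-≤ (suc M ^ d) (ℕₚ.*-monoʳ-≤ (4 * (Δ * Δ)) union) ⟩
      suc M ^ d * (4 * (Δ * Δ) * sum (λ ℓ → 𝔼 (λ ω → good T ω * 𝟚 (scarce-at v ω ℓ))))
        ≡⟨ lemma (suc M ^ d) (4 * (Δ * Δ)) (sum (λ ℓ → 𝔼 (λ ω → good T ω * 𝟚 (scarce-at v ω ℓ)))) ⟩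
      4 * (Δ * Δ) * (suc M ^ d * sum (λ ℓ → 𝔼 (λ ω → good T ω * 𝟚 (scarce-at v ω ℓ))))
        ≡⟨ cong (4 * (Δ * Δ) *_) (*-distribˡ-sum (suc M ^ d) (λ ℓ → 𝔼 (λ ω → good T ω * 𝟚 (scarce-at v ω ℓ)))) ⟩
      4 * (Δ * Δ) * sum (λ ℓ → suc M ^ d * 𝔼 (λ ω → good T ω * 𝟚 (scarce-at v ω ℓ)))
        ≤⟨ ℕₚ.*-monoʳ-≤ (4 * (Δ * Δ)) (sum-mono (λ ℓ → tail-bound (adj G v) ℓ (good T) (good-independent T v vT))) ⟩
      4 * (Δ * Δ) * sum (λ (_ : Fin (suc L)) → M ^ d * 𝔼 (good T))
        ≡⟨ cong (4 * (Δ * Δ) *_) (sum-const (suc L) (M ^ d * 𝔼 (good T))) ⟩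
      4 * (Δ * Δ) * (suc L * (M ^ d * 𝔼 (good T)))
        ≡⟨ lemma′ (Δ * Δ) (suc L) (M ^ d) (𝔼 (good T)) ⟩
      C * (Δ * Δ) * M ^ d * 𝔼 (good T)
        ≤⟨ ℕₚ.*-monoˡ-≤ (𝔼 (good T)) (decay M C Δ d (large v) (sub (proj₁ top) v)) ⟩
      suc M ^ d * 𝔼 (good T) ∎)
      where
      open ℕₚ.≤-Reasoning
      d = deg G v
      lemma : ∀ a b c → a * (b * c) ≡ b * (a * c)
      lemma = solve-∀
      lemma′ : ∀ D l m x → 4 * D * (l * (m * x)) ≡ 4 * l * D * m * x
      lemma′ = solve-∀
      union : 𝔼 (λ ω → good T ω * 𝟚 (bad v ω)) ≤ sum (λ ℓ → 𝔼 (λ ω → good T ω * 𝟚 (scarce-at v ω ℓ)))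
      union = begin
        𝔼 (λ ω → good T ω * 𝟚 (bad v ω))
          ≤⟨ ΣΩ-mono (suc n) (λ ω → ℕₚ.≤-trans (ℕₚ.*-monoʳ-≤ (good T ω) (any-scarce v ω)) (ℕₚ.≤-reflexive (*-distribˡ-sum (good T ω) (λ ℓ → 𝟚 (scarce-at v ω ℓ))))) ⟩
        𝔼 (λ ω → sum (λ ℓ → good T ω * 𝟚 (scarce-at v ω ℓ)))
          ≡⟨ ΣΩ-sum (suc n) (λ ℓ ω → good T ω * 𝟚 (scarce-at v ω ℓ)) ⟩
        sum (λ ℓ → 𝔼 (λ ω → good T ω * 𝟚 (scarce-at v ω ℓ))) ∎
    found = all-good rare
    plenty : ∀ v ℓ → e * deg G v ≤ (e + r) * hits (adj G v) ℓ (proj₁ found)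
    plenty v ℓ = ℕₚ.≮⇒≥ (λ lt → contradiction (trans (sym (dec-true ((e + r) * hits (adj G v) ℓ (proj₁ found) ℕₚ.<? e * deg G v) lt)) (zero-count {p = scarce-at v (proj₁ found)} (proj₂ found v) ℓ)) λ ())

-- Counting neighbours by label

count-labels : ∀ (mask : Fin n → Bool) (Q : Fin L → Bool) ω →
               count (λ u → mask u ∧ Q (lookup ω u)) ≡ sum (λ ℓ → if Q ℓ then hits mask ℓ ω else 0)
count-labels {n} {L} mask Q ω = begin
  count (λ u → mask u ∧ Q (lookup ω u))
    ≡⟨ count≡sum (λ u → mask u ∧ Q (lookup ω u)) ⟩
  sum (λ u → 𝟚 (mask u ∧ Q (lookup ω u)))
    ≡⟨ sum-cong-≗ (λ u → sym (sum-pick (lookup ω u) (λ ℓ → 𝟚 (mask u ∧ Q ℓ)))) ⟩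
  sum (λ u → sum (λ ℓ → if does (ℓ Finₚ.≟ lookup ω u) then 𝟚 (mask u ∧ Q ℓ) else 0))
    ≡⟨ ∑-comm (λ u ℓ → if does (ℓ Finₚ.≟ lookup ω u) then 𝟚 (mask u ∧ Q ℓ) else 0) ⟩
  sum (λ ℓ → sum (λ u → if does (ℓ Finₚ.≟ lookup ω u) then 𝟚 (mask u ∧ Q ℓ) else 0))
    ≡⟨ sum-cong-≗ (λ ℓ → column ℓ (Q ℓ)) ⟩
  sum (λ ℓ → if Q ℓ then hits mask ℓ ω else 0) ∎
  where
  open ≡-Reasoning
  swap-if : ∀ a b → (if b then 𝟚 (a ∧ true) else 0) ≡ 𝟚 (a ∧ b)
  swap-if true  true  = refl
  swap-if true  false = refl
  swap-if false true  = refl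
  swap-if false false = refl
  vanish : ∀ a b → (if b then 𝟚 (a ∧ false) else 0) ≡ 0
  vanish true  true  = refl
  vanish true  false = refl
  vanish false true  = refl
  vanish false false = refl
  column : ∀ ℓ q → sum (λ u → if does (ℓ Finₚ.≟ lookup ω u) then 𝟚 (mask u ∧ q) else 0) ≡ (if q then hits mask ℓ ω else 0)
  column ℓ true  = trans (sum-cong-≗ (λ u → trans (swap-if (mask u) _) (cong (λ b → 𝟚 (mask u ∧ b)) (does-≟-sym ℓ (lookup ω u)))))
                     (sym (count≡sum (λ u → mask u ∧ does (lookup ω u Finₚ.≟ ℓ))))
  column ℓ false = sum-0 {n} (λ u → vanish (mask u) (does (ℓ Finₚ.≟ lookup ω u)))

many-labels : ∀ (mask : Fin n → Bool) (Q : Fin L → Bool) ω x T → (∀ ℓ → x ≤ T * hits mask ℓ ω) →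
              count Q * x ≤ T * count (λ u → mask u ∧ Q (lookup ω u))
many-labels mask Q ω x T plenty = begin
  count Q * x
    ≡⟨ cong (_* x) (count≡sum Q) ⟩
  sum (𝟚 ∘ Q) * x
    ≡⟨ *-distribʳ-sum x (𝟚 ∘ Q) ⟩
  sum (λ ℓ → 𝟚 (Q ℓ) * x)
    ≤⟨ sum-mono (λ ℓ → each ℓ (Q ℓ)) ⟩
  sum (λ ℓ → T * (if Q ℓ then hits mask ℓ ω else 0))
    ≡⟨ sym (*-distribˡ-sum T (λ ℓ → if Q ℓ then hits mask ℓ ω else 0)) ⟩
  T * sum (λ ℓ → if Q ℓ then hits mask ℓ ω else 0)
    ≡⟨ cong (T *_) (sym (count-labels mask Q ω)) ⟩
  T * count (λ u → mask u ∧ Q (lookup ω u)) ∎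
  where
  open ℕₚ.≤-Reasoning
  each : ∀ ℓ q → 𝟚 q * x ≤ T * (if q then hits mask ℓ ω else 0)
  each ℓ true  = subst (_≤ T * hits mask ℓ ω) (sym (ℕₚ.+-identityʳ x)) (plenty ℓ)
  each ℓ false = z≤n

-- Without denominators: f/d ≤ q/p and c/d ≥ a/T yield s f ≤ c as soon as s q/p ≤ a/T.
ratio : ∀ {f d c} p q a s T .{{_ : NonZero p}} .{{_ : NonZero T}} → p * f ≤ q * d → a * d ≤ T * c → s * T * q ≤ a * p → s * f ≤ c
ratio {f} {d} {c} p q a s T pf ad st = ℕₚ.*-cancelˡ-≤ (p * T) {{ℕₚ.m*n≢0 p T}} (begin
  p * T * (s * f)       ≡⟨ lemma₁ p T s f ⟩
  s * T * (p * f)       ≤⟨ ℕₚ.*-monoʳ-≤ (s * T) pf ⟩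
  s * T * (q * d)       ≡⟨ sym (ℕₚ.*-assoc (s * T) q d) ⟩
  s * T * q * d         ≤⟨ ℕₚ.*-monoˡ-≤ d st ⟩
  a * p * d             ≡⟨ lemma₂ a p d ⟩
  p * (a * d)           ≤⟨ ℕₚ.*-monoʳ-≤ p ad ⟩
  p * (T * c)           ≡⟨ sym (ℕₚ.*-assoc p T c) ⟩
  p * T * c             ∎)
  where
  open ℕₚ.≤-Reasoning
  lemma₁ : ∀ a b c d → a * b * (c * d) ≡ c * b * (a * d)
  lemma₁ = solve-∀
  lemma₂ : ∀ a b c → a * b * c ≡ b * (a * c)
  lemma₂ = solve-∀

-- Only lower bounds on label frequencies are available, so x is bounded from above through its
-- complement y in d.
fewer : ∀ {d x y b} a₁ a₂ T → 0 < d → x + y ≡ d → a₁ * d ≤ T * y → a₂ * d ≤ T * b → T < a₁ + a₂ → x < b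
fewer {d} {x} {y} {b} a₁ a₂ T d>0 x+y y-large b-large T< = ℕₚ.≰⇒> (λ b≤x → ℕₚ.<-irrefl refl (begin-strict
  T * d              <⟨ ℕₚ.*-monoˡ-< d {{ℕ.>-nonZero d>0}} T< ⟩
  (a₁ + a₂) * d      ≡⟨ ℕₚ.*-distribʳ-+ d a₁ a₂ ⟩
  a₁ * d + a₂ * d    ≤⟨ ℕₚ.+-mono-≤ y-large b-large ⟩
  T * y + T * b      ≤⟨ ℕₚ.+-monoʳ-≤ (T * y) (ℕₚ.*-monoʳ-≤ T b≤x) ⟩
  T * y + T * x      ≡⟨ trans (sym (ℕₚ.*-distribˡ-+ T y x)) (cong (T *_) (trans (ℕₚ.+-comm y x) x+y)) ⟩
  T * d              ∎))
  where open ℕₚ.≤-Reasoning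

-- The fraction 17/12 just exceeds √2, as 17² = 2 · 12² + 1; so 12 f > 5 d would push f + d beyond
-- √2 d. The strict inequality is kept as an added 1, which also covers d = 0.
√2-1<5/12 : ∀ k f d → (suc k * f + (2 + k) * d) ^ 2 ≤ 2 * (suc k * d) ^ 2 → 12 * f ≤ 5 * d
√2-1<5/12 k f d le = ℕₚ.≮⇒≥ (λ lt → ℕₚ.<-irrefl refl (begin-strict
  288 * (d * d)                                <⟨ ℕₚ.≤-trans (s≤s (ℕₚ.m≤m+n (288 * (d * d)) _)) (ℕₚ.≤-reflexive (lemma₁ d)) ⟩
  (1 + 17 * d) * (1 + 17 * d)                  ≤⟨ ℕₚ.*-mono-≤ (shifted lt) (shifted lt) ⟩
  12 * (f + d) * (12 * (f + d))                ≡⟨ lemma₂ (f + d) ⟩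
  144 * ((f + d) * (f + d))                    ≤⟨ ℕₚ.*-monoʳ-≤ 144 squares ⟩
  144 * (2 * (d * d))                          ≡⟨ sym (ℕₚ.*-assoc 144 2 (d * d)) ⟩
  288 * (d * d)                                ∎))
  where
  open ℕₚ.≤-Reasoning
  lemma₁ : ∀ d → 1 + (288 * (d * d) + (d * d + 34 * d)) ≡ (1 + 17 * d) * (1 + 17 * d)
  lemma₁ = solve-∀
  lemma₂ : ∀ x → 12 * x * (12 * x) ≡ 144 * (x * x)
  lemma₂ = solve-∀
  lemma₃ : ∀ f d → 12 * f + 12 * d ≡ 12 * (f + d)
  lemma₃ = solve-∀
  lemma₄ : ∀ d → (1 + 5 * d) + 12 * d ≡ 1 + 17 * d
  lemma₄ = solve-∀
  shifted : 5 * d < 12 * f → 1 + 17 * d ≤ 12 * (f + d)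
  shifted lt = subst₂ _≤_ (lemma₄ d) (lemma₃ f d) (ℕₚ.+-monoˡ-≤ (12 * d) lt)
  a = suc k
  lemma₅ : ∀ a x → a * a * (x * x) ≡ a * x * (a * x * 1)
  lemma₅ = solve-∀
  lemma₆ : ∀ a d → 2 * (a * d * (a * d * 1)) ≡ a * a * (2 * (d * d))
  lemma₆ = solve-∀
  squares : (f + d) * (f + d) ≤ 2 * (d * d)
  squares = ℕₚ.*-cancelˡ-≤ (a * a) (begin
    a * a * ((f + d) * (f + d))      ≡⟨ lemma₅ a (f + d) ⟩
    (a * (f + d)) ^ 2                ≤⟨ ℕₚ.^-monoˡ-≤ 2 (ℕₚ.≤-trans (ℕₚ.≤-reflexive (ℕₚ.*-distribˡ-+ a f d))
                                          (ℕₚ.+-monoʳ-≤ (a * f) (ℕₚ.*-monoˡ-≤ d (ℕₚ.n≤1+n a)))) ⟩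
    (a * f + (2 + k) * d) ^ 2        ≤⟨ le ⟩
    2 * (a * d) ^ 2                  ≡⟨ lemma₆ a d ⟩
    a * a * (2 * (d * d))            ∎)

count-+ : ∀ m {k} (p : Fin (m + k) → Bool) → count p ≡ count (λ i → p (i ↑ˡ k)) + count (λ i → p (m ↑ʳ i))
count-+ zero    p = refl
count-+ (suc m) p = trans (cong (𝟚 (p zero) +_) (count-+ m (p ∘ suc))) (sym (ℕₚ.+-assoc (𝟚 (p zero)) _ _))

count-remQuot : ∀ m k (p : Fin m → Fin k → Bool) →
                count {m * k} (λ i → p (proj₁ (remQuot k i)) (proj₂ (remQuot {m} k i))) ≡ sum (λ i → count (p i))
count-remQuot zero    k p = refl
count-remQuot (suc m) k p = trans (count-+ k (λ i → p (proj₁ (remQuot {suc m} k i)) (proj₂ (remQuot {suc m} k i)))) (cong₂ _+_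
  (count-cong {p = λ i → p (proj₁ (remQuot {suc m} k (i ↑ˡ (m * k)))) (proj₂ (remQuot {suc m} k (i ↑ˡ (m * k))))}
    (λ i → cong (λ q → p (proj₁ q) (proj₂ q)) (first i)))
  (trans (count-cong {p = λ i → p (proj₁ (remQuot {suc m} k (k ↑ʳ i))) (proj₂ (remQuot {suc m} k (k ↑ʳ i)))}
    (λ i → cong (λ q → p (proj₁ q) (proj₂ q)) (later i))) (count-remQuot m k (p ∘ suc))))
  where
  first : ∀ i → remQuot {suc m} k (i ↑ˡ (m * k)) ≡ (zero , i)
  first i rewrite Finₚ.splitAt-↑ˡ k i (m * k) = refl
  later : ∀ i → remQuot {suc m} k (k ↑ʳ i) ≡ (suc (proj₁ (remQuot {m} k i)) , proj₂ (remQuot {m} k i))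
  later i rewrite Finₚ.splitAt-↑ʳ k (m * k) i = refl

sided : Bool → Bool → Bool
sided s b = if s then b else not b

-- A label is a pair of a class and a group; the class determines membership in the reservoir and the side.
module Labelled {m k : ℕ} (reservoir left : Fin m → Bool) (T e N-rest N-side N-other N-owner : ℕ) .{{_ : NonZero T}}
  (rest-labels  : sum (λ i → count {k} (λ _ → not (reservoir i))) ≡ N-rest)
  (side-labels  : ∀ s → sum (λ i → count {k} (λ _ → reservoir i ∧ sided s (left i))) ≡ N-side)
  (other-labels : ∀ s g → sum (λ i → count {k} (λ j → not ((reservoir i ∧ sided s (left i)) ∧ not (does (j Finₚ.≟ g))))) ≡ N-other)
  (owner-labels : ∀ s g → sum (λ i → count {k} (λ j → not (reservoir i) ∧ (does (left i Boolₚ.≟ s) ∧ not (does (j Finₚ.≟ g))))) ≡ N-owner)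
  (rest-large  : 2 * T * 5 ≤ N-rest * e * 12) (owner-large : 1 * T * 5 ≤ N-owner * e * 12) (side-large : T < N-other * e + N-side * e)
  {n : ℕ} (G : Graph n) (c : Vec (Fin (m * k)) n) (plenty : ∀ v ℓ → e * deg G v ≤ T * hits (adj G v) ℓ c)
  where

  class : Fin n → Fin m
  class u = proj₁ (remQuot k (lookup c u))

  group : Fin n → Fin k
  group u = proj₂ (remQuot {m} k (lookup c u))

  -- The labels of `v` itself may occur in `p` as constants, since the frequencies hold for all
  -- labels at once.
  frequent : ∀ v (p : Fin m → Fin k → Bool) {N} → sum (λ i → count (p i)) ≡ N →
             N * e * deg G v ≤ T * count (λ u → adj G v u ∧ p (class u) (group u))
  frequent v p refl = subst (_≤ T * count (λ u → adj G v u ∧ p (class u) (group u)))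
    (trans (cong (_* (e * deg G v)) {x = count {m * k} (λ ℓ → p (proj₁ (remQuot k ℓ)) (proj₂ (remQuot {m} k ℓ)))} (count-remQuot m k p)) (sym (ℕₚ.*-assoc (sum (λ i → count (p i))) e (deg G v))))
    (many-labels (adj G v) (λ ℓ → p (proj₁ (remQuot k ℓ)) (proj₂ (remQuot {m} k ℓ))) c (e * deg G v) T (plenty v))

  module R = Reservoir G (reservoir ∘ class) (left ∘ class) group

  few-inflexible : ∀ s t v → 0 < deg G v →
    count (λ u → adj G v u ∧ (reservoir (class u) ∧ sided s (left (class u))) ∧ not (does (group u Finₚ.≟ group v))) <
    count (λ u → adj G v u ∧ (reservoir (class u) ∧ sided t (left (class u))))
  few-inflexible s t v d>0 = fewer (N-other * e) (N-side * e) T d>0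
    (count-split (adj G v) (λ u → (reservoir (class u) ∧ sided s (left (class u))) ∧ not (does (group u Finₚ.≟ group v))))
    (frequent v (λ i j → not ((reservoir i ∧ sided s (left i)) ∧ not (does (j Finₚ.≟ group v)))) (other-labels s (group v)))
    (frequent v (λ i _ → reservoir i ∧ sided t (left i)) (side-labels t)) side-large

  orientation : (F : Fin n → List ℕ) → (∀ v → 12 * length (F v) ≤ 5 * deg G v) → (∀ v → 0 < deg G v) →
                ∃ λ (D : Orientation G) → ∀ v → outdeg D v ∉ F v
  orientation F few d>0 = R.reservoir-orientation F
    (λ v _ → ratio {length (F v)} 12 5 (N-rest * e) 2 T (few v) (frequent v (λ i _ → not (reservoir i)) rest-labels) rest-large)
    (λ v → inflexible true true v) (λ v → inflexible true false v) (λ v → inflexible false true v) (λ v → inflexible false false v)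
    (λ s _ → subst (_≤ count (λ v → adj G s v ∧ (R.rest v ∧ (R.same s v ∧ R.differ s v)))) (ℕₚ.*-identityˡ (length (F s)))
      (ratio {length (F s)} 12 5 (N-owner * e) 1 T (few s)
        (frequent s (λ i j → not (reservoir i) ∧ (does (left i Boolₚ.≟ left (class s)) ∧ not (does (j Finₚ.≟ group s)))) (owner-labels (left (class s)) (group s)))
        owner-large))
    where
    inflexible : ∀ s t v →
      count (λ u → (adj G v u ∧ (reservoir (class u) ∧ sided s (left (class u)))) ∧ not (does (group u Finₚ.≟ group v))) <
      count (λ u → adj G v u ∧ (reservoir (class u) ∧ sided t (left (class u))))
    inflexible s t v = subst (_< count (λ u → adj G v u ∧ (reservoir (class u) ∧ sided t (left (class u)))))
      (count-cong (λ u → sym (Boolₚ.∧-assoc (adj G v u) (reservoir (class u) ∧ sided s (left (class u))) (not (does (group u Finₚ.≟ group v)))))) (few-inflexible s t v (d>0 v))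

module Conclusion {m k X Y M e r : ℕ} (reservoir left : Fin (suc m) → Bool) (N-rest N-side N-other N-owner : ℕ) .{{_ : NonZero (e + r)}}
  (X≤Y : X ≤ Y) (mean : X + suc m * suc k * Y ≡ suc m * suc k * M + Y) (geometric : suc M ^ (e + r) ≤ X ^ e * Y ^ r)
  (rest-labels  : sum (λ i → count {suc k} (λ _ → not (reservoir i))) ≡ N-rest)
  (side-labels  : ∀ s → sum (λ i → count {suc k} (λ _ → reservoir i ∧ sided s (left i))) ≡ N-side)
  (other-labels : ∀ s g → sum (λ i → count {suc k} (λ j → not ((reservoir i ∧ sided s (left i)) ∧ not (does (j Finₚ.≟ g))))) ≡ N-other)
  (owner-labels : ∀ s g → sum (λ i → count {suc k} (λ j → not (reservoir i) ∧ (does (left i Boolₚ.≟ s) ∧ not (does (j Finₚ.≟ g))))) ≡ N-owner)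
  (rest-large  : 2 * (e + r) * 5 ≤ N-rest * e * 12) (owner-large : 1 * (e + r) * 5 ≤ N-owner * e * 12)
  (side-large : e + r < N-other * e + N-side * e)
  where

  module Lab = Labelling {k + m * suc k} {X} {Y} {M} {e} {r} X≤Y mean geometric

  avoiding-orientation : ∀ n (G : Graph n) (F : Fin n → List ℕ) → (∀ v → Lab.δ₀ ≤ deg G v) →
    (∀ u v → deg G u ^ suc Lab.exponent ≤ 2 ^ deg G v) → (∀ v → 12 * length (F v) ≤ 5 * deg G v) →
    ∃ λ (D : Orientation G) → ∀ v → outdeg D v ∉ F v
  -- The maximum degree used in `Labelling` needs a vertex, so the empty graph is treated apart.
  avoiding-orientation zero    G F large sub few = orientation-from G (λ _ _ → true) , λ ()
  avoiding-orientation (suc n) G F large sub few = Labelled.orientation {suc m} {suc k} reservoir left (e + r) e N-rest N-side N-other N-owner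
    rest-labels side-labels other-labels owner-labels rest-large owner-large side-large G (proj₁ labels) (proj₂ labels) F few
    (λ v → ℕₚ.<-≤-trans (s≤s z≤n) (large v))
    where
    labels = Lab.labelling G large sub

  conclusion : (κ : ℕ) → Σ ℕ λ m → Σ ℕ λ δ₀ →
    (n : ℕ) (G : Graph n) (F : Fin n → List ℕ) →
    (∀ v → Unique (F v)) →
    (∀ v → δ₀ ≤ deg G v) →
    (∀ u v → deg G u ^ suc m ≤ 2 ^ deg G v) →
    (∀ v → (suc κ * length (F v) + (2 + κ) * deg G v) ^ 2 ≤ 2 * (suc κ * deg G v) ^ 2) →
    Σ (Orientation G) λ D → ∀ v → outdeg D v ∉ F v
  conclusion κ = Lab.exponent , Lab.δ₀ , λ n G F _ large sub few →
    avoiding-orientation n G F large sub (λ v → √2-1<5/12 κ (length (F v)) (deg G v) (few v))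

-- The numerical choice of labels and weights

isZero : Fin (suc n) → Bool
isZero zero    = true
isZero (suc _) = false

theorem5 : (k : ℕ) → Σ ℕ λ m → Σ ℕ λ δ₀ →
    (n : ℕ) (G : Graph n) (F : Fin n → List ℕ) →
    (∀ v → Unique (F v)) →
    (∀ v → δ₀ ≤ deg G v) →
    (∀ u v → deg G u ^ suc m ≤ 2 ^ deg G v) →
    (∀ v → (suc k * length (F v) + (2 + k) * deg G v) ^ 2 ≤ 2 * (suc k * deg G v) ^ 2) →
    Σ (Orientation G) λ D → ∀ v → outdeg D v ∉ F v
-- With E = 300 and L = 288 = 2 · 12 · 12 labels, every label occurs at least (1 - 1/E) d / L times around a vertex of
-- degree d. The exponential moments use Y = 4E³L, X = Y - 2EL, M = Y - 2E, e = E - 1 and r = EL - e.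
theorem5 = Conclusion.conclusion {23} {11} {31103827200} {31104000000} {31103999400} {299} {86101} reservoir left 264 12 277 121
  (ℕₚ.≤ᵇ⇒≤ 31103827200 31104000000 tt) refl
  -- Here B = M + 1, w = 2E - 1, v = 2EL and z = Y - ev. The required Y² ≤ (Y + EL(2E - 1))(Y -
  -- 2EL(E - 1)) amounts to Y ≥ 2EL(2E - 1)(E - 1), whence the size of Y.
  (geometric-mean {31103999401} {599} {31103827200} {172800} {299} {86101} {31052332800} {31104000000} refl refl refl
    (ℕₚ.≤ᵇ⇒≤ (31104000000 * 31104000000) ((31104000000 + (299 + 86101) * 599) * 31052332800) tt))
  refl (λ { true → refl ; false → refl })
  (λ { true  → toWitness {a? = Finₚ.all? (λ g → sum {24} (λ i → count {12} (λ j → not ((reservoir i ∧ left i) ∧ not (does (j Finₚ.≟ g))))) ℕₚ.≟ 277)} tt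
     ; false → toWitness {a? = Finₚ.all? (λ g → sum {24} (λ i → count {12} (λ j → not ((reservoir i ∧ not (left i)) ∧ not (does (j Finₚ.≟ g))))) ℕₚ.≟ 277)} tt })
  (λ { true  → toWitness {a? = Finₚ.all? (λ g → sum {24} (λ i → count {12} (λ j → not (reservoir i) ∧ (does (left i Boolₚ.≟ true) ∧ not (does (j Finₚ.≟ g))))) ℕₚ.≟ 121)} tt
     ; false → toWitness {a? = Finₚ.all? (λ g → sum {24} (λ i → count {12} (λ j → not (reservoir i) ∧ (does (left i Boolₚ.≟ false) ∧ not (does (j Finₚ.≟ g))))) ℕₚ.≟ 121)} tt })
  (ℕₚ.≤ᵇ⇒≤ (2 * (299 + 86101) * 5) (264 * 299 * 12) tt) (ℕₚ.≤ᵇ⇒≤ (1 * (299 + 86101) * 5) (121 * 299 * 12) tt)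
  -- The tightest condition: 289(1 - 1/E) > 288 needs E > 289.
  (ℕₚ.≤ᵇ⇒≤ (suc (299 + 86101)) (277 * 299 + 12 * 299) tt)
  where
  -- A class is a fair side together with a 1/12 chance of lying in the reservoir, and there are 12
  -- groups. Hence 264 = 22 · 12 labels lie outside the reservoir, 12 on each of its sides; 11 of
  -- those 12 avoid a given group, so 277 = 288 - 11. The owner count is 121 = 11 · 11: classes
  -- outside S on a given side, times the other groups.
  reservoir left : Fin 24 → Bool
  reservoir i = isZero (proj₂ (remQuot {2} 12 i))
  left      i = isZero (proj₁ (remQuot {2} 12 i))
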